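{- Let $k$ and $\ell$ be odd positive integers, and put $q:=2^k$ and $Q:=2^\ell$. Let $a,b,c,d\in\mathbb{F}_{q^2}$ and write $A(X):=aX^{Q+1}+bX^Q+cX+d$. Then $f(X):=X^{Q+1}A(X^{q-1})$ permutes $\mathbb{F}_{q^2}$ if and only if all of the following hold: (1) $e:=a^{q+1}+b^{q+1}+c^{q+1}+d^{q+1}$ is nonzero; (2) $(a^qb+c^qd)^Q=e^{Q-1}(a^qc+b^qd)$; (3) $\mathrm{Tr}_{\mathbb{F}_q/\mathbb{F}_2}\Bigl(\frac{b^{q+1}+c^{q+1}}{e}\Bigr)=1$.
   Context: A polynomial permutes $\mathbb{F}_{q^2}$ if it induces a bijection of $\mathbb{F}_{q^2}$. $\mathrm{Tr}_{\mathbb{F}_q/\mathbb{F}_2}$ is the trace map; its argument lies in $\mathbb{F}_q$. -}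

module Defs where

open import Algebra.Apartness.Bundles using (HeytingField; HeytingCommutativeRing)
open import Algebra.Bundles using (CommutativeRing; Semiring)
import Algebra.Definitions as AlgebraDefinitions
import Algebra.Definitions.RawSemiring as RawSemiringDefinitions
import Algebra.Properties.AbelianGroup as AbelianGroupProperties
open import Data.Fin.Base using (Fin; toℕ)
open import Data.List.Base using (List; []; _∷_; map)
open import Data.Nat.Base as ℕ using (ℕ; zero; suc)
open import Data.Product.Base using (_,_; proj₁)
open import Function.Bundles using (Inverse)
open import Function.Definitions using (Bijective)
open import Relation.Binary.PropositionalEquality as ≡ using ()

-- Polynomials in one variable, as lists of coefficients with the constant
-- term first.  Lists differing by trailing zeros stand for the same polynomial.
module Polynomials {u v} (R : CommutativeRing u v) where
  open CommutativeRing R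

  infixl 6 _⊕_
  infixl 7 _⊗_
  infixr 8 _↑_

  Poly : Set u
  Poly = List Carrier

  const : Carrier → Poly
  const a = a ∷ []

  X : Poly
  X = 0# ∷ 1# ∷ []

  _⊕_ : Poly → Poly → Poly
  []      ⊕ g       = g
  (a ∷ f) ⊕ []      = a ∷ f
  (a ∷ f) ⊕ (b ∷ g) = a + b ∷ f ⊕ g

  _⊗_ : Poly → Poly → Poly
  []      ⊗ g = []
  (a ∷ f) ⊗ g = map (a *_) g ⊕ (0# ∷ f ⊗ g)

  _↑_ : Poly → ℕ → Poly
  f ↑ zero  = const 1#
  f ↑ suc n = f ⊗ f ↑ n

  -- The composite f(g(X)).
  _⟨_⟩ : Poly → Poly → Poly
  []      ⟨ g ⟩ = []
  (a ∷ f) ⟨ g ⟩ = const a ⊕ g ⊗ f ⟨ g ⟩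

  eval : Poly → Carrier → Carrier
  eval []      x = 0#
  eval (a ∷ f) x = a + x * eval f x

  Permutes : Poly → Set _
  Permutes f = Bijective _≈_ _≈_ (eval f)

-- On a finite carrier ≈ is decidable, so _#_ is just inequality and a Heyting
-- field is a field in the usual sense.
module FieldNotions {u v w} (F : HeytingField u v w) where
  open HeytingField F

  private
    R : CommutativeRing u v
    R = HeytingCommutativeRing.commutativeRing (HeytingField.heytingCommutativeRing F)

  open Polynomials R public
  open RawSemiringDefinitions (Semiring.rawSemiring (CommutativeRing.semiring R)) public using (_^_; sum)
  open AlgebraDefinitions _≈_ using (Invertible)
  open AbelianGroupProperties (CommutativeRing.+-abelianGroup R) using (ε⁻¹≈ε)

  HasCardinality : ℕ → Set _
  HasCardinality n = Inverse (CommutativeRing.setoid R) (≡.setoid (Fin n))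

  #0⇒invertible : ∀ {x} → x # 0# → Invertible 1# _*_ x
  #0⇒invertible {x} x#0 =
    let y , yx≈1 , xy≈1 = #⇒invertible x#0
        x≈x-0 = sym (trans (+-congˡ ε⁻¹≈ε) (+-identityʳ x))
    in y , trans (*-congˡ x≈x-0) yx≈1 , trans (*-congʳ x≈x-0) xy≈1

  -- The quotient x / y; the last argument witnesses that y is nonzero.
  divide : (x y : Carrier) → y # 0# → Carrier
  divide x y y#0 = x * proj₁ (#0⇒invertible y#0)

  -- The trace from the field with 2 ^ k elements to the field with 2 elements,
  -- Tr x = x + x² + x⁴ + ⋯ + x^(2^(k-1)), the sum of the conjugates of x.
  -- It is written on a field F containing the one with 2 ^ k elements, and is
  -- that trace only at those x with x ^ (2 ^ k) ≈ x.
  Tr : ℕ → Carrier → Carrier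
  Tr k x = sum {k} (λ i → x ^ (2 ℕ.^ toℕ i))

{-# OPTIONS --safe #-}

-- Write x ‾ = x^q and X = x^Q.  On the field, f x = a X‾ x‾ + b X‾ x + c X x‾ + d X x is B(X , x)
-- for an 𝔽_q-bilinear map B, that is, for a 2 × 2 × 2 tensor over 𝔽_q, and e is the square root of
-- its hyperdeterminant.  When e ≠ 0, the binary quadratic form det (p B + p′ B ‾) in (p , p′) has two
-- zeros over 𝔽_(q²), and at each of them p f + p′ f ‾ is a product α(X) β(x) of linear forms.  So f
-- is equivalent to x ↦ (α(X) β(x) , α₂(X) β₂(x)).  Condition (2) says that {α , α₂} and {β^Q , β₂^Q}
-- agree up to scalars: f is either "straight", (β^(Q+1) , β₂^(Q+1)), or "crossed", (β₂^Q β , β^Q β₂).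
-- If ‾ exchanges the two zeros, f is then equivalent to w ↦ w^(Q+1) or w ↦ w^(qQ+1) on 𝔽_(q²), and
-- only the latter is injective; if ‾ fixes each zero, only the straight case is injective.  The
-- trace in (3) singles out the injective combinations.  That an injective f satisfies (2) follows
-- from Hermite's criterion with exponent q - 1 if ‾ exchanges the zeros, and otherwise because f
-- maps the zeros of α(X) and of β(x) into one line.
module Submission where

open import Defs
open import Algebra.Apartness.Bundles using (HeytingField; HeytingCommutativeRing)
open import Algebra.Bundles using (CommutativeMonoid; CommutativeRing; RawRing)
import Algebra.Properties.AbelianGroup as AbelianGroupProperties
import Algebra.Properties.CommutativeMonoid.Mult as MonoidMult
import Algebra.Properties.CommutativeMonoid.Sum as MonoidSum
import Algebra.Properties.CommutativeSemigroup as CommutativeSemigroupProperties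
import Algebra.Properties.CommutativeSemiring.Exp as Exp
import Algebra.Properties.Semiring.Mult as Mult
import Algebra.Properties.Semiring.Sum as SemiringSum
import Algebra.Solver.Ring as RingSolver
open import Algebra.Solver.Ring.AlmostCommutativeRing
  using (AlmostCommutativeRing; _-Raw-AlmostCommutative⟶_; Induced-equivalence; fromCommutativeSemiring)
open import Data.Bool.Base using (Bool; true; false; T; _∧_; _xor_)
open import Data.Fin.Base using (Fin; zero; suc; inject≤; punchOut; toℕ)
open import Data.Fin.Permutation using (permutation)
import Data.Fin.Properties as Fin
open import Data.List.Base using ([]; _∷_; map)
open import Data.Maybe.Base using (just; nothing; is-just)
open import Data.Nat.Base as ℕ using (ℕ; zero; suc)
open import Data.Nat.Divisibility
  using (_∣_; _∤_; divides; quotient; ∣-refl; ∣⇒≤; ∣m∣n⇒∣m+n; ∣m+n∣m⇒∣n; ∣m⇒∣m*n; ∣n⇒∣m*n; m%n≡0⇒n∣m)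
open import Data.Nat.DivMod using (_/_; _%_; m≡m%n+[m/n]*n; m%n<n)
import Data.Nat.Properties as ℕ
open import Data.Nat.Tactic.RingSolver using (solve-∀)
open import Data.Product.Base using (Σ-syntax; ∃-syntax; _×_; _,_; proj₁; proj₂)
open import Data.Sum.Base using (_⊎_; inj₁; inj₂; [_,_]′)
open import Data.Vec.N-ary using (N-ary; Eq; curryⁿ; curryⁿ-cong)
open import Function.Base using (_∘_; id)
open import Function.Bundles using (Inverse; _⇔_; mk⇔)
open import Function.Definitions using (Congruent; Injective)
open import Function.Properties.Inverse using (Inverse⇒Injection)
open import Level using (_⊔_)
open import Relation.Binary.Definitions using (Decidable; WeaklyDecidable)
open import Relation.Binary.PropositionalEquality as ≡ using (_≡_; _≢_)
import Relation.Binary.Reasoning.Setoid as SetoidReasoning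
import Relation.Binary.Reflection as Reflection
open import Relation.Nullary.Decidable using (Dec; yes; no; decidable-stable; via-injection)
open import Relation.Nullary.Negation using (¬_; contradiction)

-- Condition (3) is a parity count. The two zeros determine an element `h` such that (b^(q+1) +
-- c^(q+1)) / e is h + h^Q in the straight case and h + h^Q + 1 in the crossed case. Now h + h^Q =
-- `trace ℓ (h * h + h)`, and the additive polynomials `trace k` and `trace ℓ` commute, so h + h^Q
-- has trace `trace ℓ (h ‾ + h)`. Here h ‾ + h is 0 if ‾ exchanges the zeros and 1 if it fixes them.
-- As k and ℓ are odd, 1 has trace 1 for either length, so (3) holds exactly for exchanged with
-- crossed and for fixed with straight. Oddness also decides injectivity. Q + 1 divides Q^k + 1, and
-- x^(Q^k + 1) = x² on 𝔽_q, so w ↦ w^(Q+1) is bijective on 𝔽_q; on 𝔽_(q²) a primitive cube root of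
-- unity ω has ω^(Q+1) = 1. The zeros themselves come from z² + z = θ θ′ / e², the form taken by a
-- quadratic equation in characteristic two. Its constant lies in 𝔽_q, so z ‾ is z or z + 1, and
-- this is the alternative between exchanged and fixed zeros.

-- Divisibility and pigeonhole.

2∤⇒odd : ∀ n → 2 ∤ n → ∃[ j ] n ≡ suc (j ℕ.* 2)
2∤⇒odd n 2∤n with n % 2 | m≡m%n+[m/n]*n n 2 | m%n<n n 2
... | 0 | n≡ | _ = contradiction (divides (n / 2) n≡) 2∤n
... | 1 | n≡ | _ = n / 2 , n≡
... | suc (suc _) | _ | ℕ.s≤s (ℕ.s≤s ())

x+1∣x^odd+1 : ∀ x j → x ℕ.+ 1 ∣ x ℕ.^ suc (j ℕ.* 2) ℕ.+ 1
x+1∣x^odd+1 x zero = ≡.subst (λ y → x ℕ.+ 1 ∣ y ℕ.+ 1) (≡.sym (ℕ.*-identityʳ x)) ∣-refl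
-- x^(n+2) + 1 + (x + 1) x^n = x^(n+1) (x + 1) + (x^n + 1)
x+1∣x^odd+1 x (suc j) =
  ∣m+n∣m⇒∣n (≡.subst (x ℕ.+ 1 ∣_) (identity x (x ℕ.^ suc (j ℕ.* 2)))
               (∣m∣n⇒∣m+n (∣n⇒∣m*n (x ℕ.* x ℕ.^ suc (j ℕ.* 2)) ∣-refl) (x+1∣x^odd+1 x j)))
             (∣m⇒∣m*n (x ℕ.^ suc (j ℕ.* 2)) ∣-refl)
  where
  identity : ∀ x y → x ℕ.* y ℕ.* (x ℕ.+ 1) ℕ.+ (y ℕ.+ 1) ≡ (x ℕ.+ 1) ℕ.* y ℕ.+ (x ℕ.* (x ℕ.* y) ℕ.+ 1)
  identity = solve-∀

-- A missed value could be punched out of the codomain, which would inject `Fin (suc n)` into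
-- `Fin n`.
Fin-injective⇒surjective : ∀ {n} (f : Fin n → Fin n) → Injective _≡_ _≡_ f → ∀ j → ∃[ i ] f i ≡ j
Fin-injective⇒surjective {suc n} f f-injective j =
  decidable-stable (Fin.any? (λ i → f i Fin.≟ j)) λ missed →
    let j≢f = λ i j≡fi → missed (i , ≡.sym j≡fi)
    in ℕ.1+n≰n (Fin.injective⇒≤ {f = λ i → punchOut (j≢f i)}
         (λ eq → f-injective (Fin.punchOut-injective (j≢f _) (j≢f _) eq)))

-- Sums over an enumerated commutative monoid.

module Total {r₁ r₂} (M : CommutativeMonoid r₁ r₂) {N : ℕ}
             (enumeration : Inverse (CommutativeMonoid.setoid M) (≡.setoid (Fin N))) where

  open CommutativeMonoid M
  open Inverse enumeration
  open MonoidSum M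
  open MonoidMult M using () renaming (_×_ to _×ₙ_)
  open SetoidReasoning setoid

  -- Kept to a commutative monoid so that it serves a field twice: additively for power sums,
  -- multiplicatively for x^N = x.
  total : (Carrier → Carrier) → Carrier
  total g = sum (g ∘ from)

  total-cong : ∀ {g h} → (∀ x → g x ≈ h x) → total g ≈ total h
  total-cong g≈h = sum-cong-≋ (g≈h ∘ from)

  total-∙ : ∀ g h → total (λ x → g x ∙ h x) ≈ total g ∙ total h
  total-∙ g h = ∑-distrib-+ (g ∘ from) (h ∘ from)

  total-const : ∀ x → total (λ _ → x) ≈ N ×ₙ x
  total-const x = sum-replicate N

  total-permute : ∀ {g h h⁻¹ : Carrier → Carrier} →
                  Congruent _≈_ _≈_ g → Congruent _≈_ _≈_ h → Congruent _≈_ _≈_ h⁻¹ →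
                  (∀ x → h (h⁻¹ x) ≈ x) → (∀ x → h⁻¹ (h x) ≈ x) →
                  total g ≈ total (g ∘ h)
  total-permute {g} {h} {h⁻¹} g-cong h-cong h⁻¹-cong hh⁻¹ h⁻¹h = begin
    sum (g ∘ from)                  ≈⟨ sum-permute (g ∘ from) (permutation (to ∘ h ∘ from) (to ∘ h⁻¹ ∘ from) left right) ⟩
    sum (g ∘ from ∘ to ∘ h ∘ from)  ≈⟨ sum-cong-≋ (λ i → g-cong (strictlyInverseʳ (h (from i)))) ⟩
    sum (g ∘ h ∘ from)              ∎
    where
    left : ∀ i → to (h (from (to (h⁻¹ (from i))))) ≡ i
    left i = ≡.trans (to-cong (trans (h-cong (strictlyInverseʳ _)) (hh⁻¹ (from i)))) (strictlyInverseˡ i)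
    right : ∀ i → to (h⁻¹ (from (to (h (from i))))) ≡ i
    right i = ≡.trans (to-cong (trans (h⁻¹-cong (strictlyInverseʳ _)) (h⁻¹h (from i)))) (strictlyInverseˡ i)

  private
    sum-single : ∀ {n} (t : Fin n → Carrier) i → (∀ j → j ≢ i → t j ≈ ε) → sum t ≈ t i
    sum-single {suc n} t zero t≈ε =
      trans (∙-congˡ (trans (sum-cong-≋ (λ j → t≈ε (suc j) λ ())) (sum-replicate-zero n))) (identityʳ _)
    sum-single t (suc i) t≈ε =
      trans (∙-cong (t≈ε zero λ ()) (sum-single (t ∘ suc) i λ j j≢i → t≈ε (suc j) (j≢i ∘ Fin.suc-injective)))
            (identityˡ _)

  total-single : ∀ {g} → Congruent _≈_ _≈_ g → ∀ c → (∀ x → ¬ x ≈ c → g x ≈ ε) → total g ≈ g c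
  total-single {g} g-cong c g≈ε = trans
    (sum-single (g ∘ from) (to c) λ j j≢c → g≈ε (from j) λ fj≈c →
      j≢c (≡.trans (≡.sym (strictlyInverseˡ j)) (to-cong fj≈c)))
    (g-cong (strictlyInverseʳ c))

-- Finite fields.

record IsFiniteField {r₁ r₂} (R : CommutativeRing r₁ r₂) (N : ℕ) : Set (r₁ ⊔ r₂) where
  open CommutativeRing R
  field
    1≉0         : ¬ 1# ≈ 0#
    inverse     : ∀ x → ¬ x ≈ 0# → ∃[ y ] x * y ≈ 1#
    enumeration : Inverse setoid (≡.setoid (Fin N))

module FiniteField {r₁ r₂} (R : CommutativeRing r₁ r₂) {N : ℕ} (isFiniteField : IsFiniteField R N) where

  open CommutativeRing R hiding (zero)
  open IsFiniteField isFiniteField public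
  open Inverse enumeration using (to; from; to-cong; from-cong; strictlyInverseˡ; strictlyInverseʳ)
  open Exp commutativeSemiring
  open Mult semiring using () renaming (_×_ to _×ₙ_)
  open SetoidReasoning setoid
  open SemiringSum semiring using (*-distribˡ-sum)
  open Total +-commutativeMonoid enumeration public
  open Total *-commutativeMonoid enumeration public
    using () renaming (total to product; total-cong to product-cong; total-∙ to product-*; total-const to product-const;
                       total-permute to product-permute; total-single to product-single)

  infix 4 _≟_

  _≟_ : Decidable _≈_
  _≟_ = via-injection (Inverse⇒Injection enumeration) Fin._≟_

  injective⇒surjective : ∀ {f : Carrier → Carrier} → Congruent _≈_ _≈_ f → Injective _≈_ _≈_ f →
                         ∀ y → ∃[ x ] f x ≈ y
  injective⇒surjective {f} f-cong f-injective y =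
    let i , eq = Fin-injective⇒surjective (to ∘ f ∘ from)
                   (λ {i} {j} eq → ≡.trans (≡.sym (strictlyInverseˡ i)) (≡.trans
                     (to-cong (f-injective (to-injective eq))) (strictlyInverseˡ j))) (to y)
    in from i , to-injective eq
    where
    to-injective : ∀ {x y} → to x ≡ to y → x ≈ y
    to-injective {x} {y} eq = trans (sym (strictlyInverseʳ x)) (trans (from-cong eq) (strictlyInverseʳ y))

  total-injective : ∀ {f g} → Congruent _≈_ _≈_ g → Congruent _≈_ _≈_ f → Injective _≈_ _≈_ f →
                    total g ≈ total (g ∘ f)
  total-injective {f} g-cong f-cong f-injective = total-permute {h⁻¹ = f⁻¹} g-cong f-cong
    (λ {x} {y} x≈y → f-injective (trans (ff⁻¹ x) (trans x≈y (sym (ff⁻¹ y))))) ff⁻¹ (λ x → f-injective (ff⁻¹ (f x)))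
    where
    f⁻¹ = λ y → proj₁ (injective⇒surjective f-cong f-injective y)
    ff⁻¹ : ∀ y → f (f⁻¹ y) ≈ y
    ff⁻¹ y = proj₂ (injective⇒surjective f-cong f-injective y)

  ¬∀⇒∃¬ : ∀ {f g : Carrier → Carrier} → Congruent _≈_ _≈_ f → Congruent _≈_ _≈_ g →
          ¬ (∀ x → f x ≈ g x) → ∃[ x ] ¬ f x ≈ g x
  ¬∀⇒∃¬ {f} {g} f-cong g-cong ¬∀ =
    let i , ne = Fin.¬∀⟶∃¬ N (λ i → f (from i) ≈ g (from i)) (λ i → f (from i) ≟ g (from i))
                   (λ all → ¬∀ λ x → trans (f-cong (sym (strictlyInverseʳ x)))
                                       (trans (all (to x)) (g-cong (strictlyInverseʳ x))))
    in from i , ne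

  inverse-cancelˡ : ∀ {x y} → x * y ≈ 1# → ∀ z → x * (y * z) ≈ z
  inverse-cancelˡ xy≈1 z = trans (sym (*-assoc _ _ _)) (trans (*-congʳ xy≈1) (*-identityˡ z))

  *-cancelˡ-nonzero : ∀ {x} y z → ¬ x ≈ 0# → x * y ≈ x * z → y ≈ z
  *-cancelˡ-nonzero {x} y z x≉0 xy≈xz with inverse x x≉0
  ... | x⁻¹ , xx⁻¹≈1 = begin
    y              ≈⟨ inverse-cancelˡ (trans (*-comm _ _) xx⁻¹≈1) y ⟨
    x⁻¹ * (x * y)  ≈⟨ *-congˡ xy≈xz ⟩
    x⁻¹ * (x * z)  ≈⟨ inverse-cancelˡ (trans (*-comm _ _) xx⁻¹≈1) z ⟩
    z              ∎

  integral : ∀ {x y} → ¬ x ≈ 0# → x * y ≈ 0# → y ≈ 0#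
  integral x≉0 xy≈0 = *-cancelˡ-nonzero _ _ x≉0 (trans xy≈0 (sym (zeroʳ _)))

  *-nonzero : ∀ {x y} → ¬ x ≈ 0# → ¬ y ≈ 0# → ¬ x * y ≈ 0#
  *-nonzero x≉0 y≉0 xy≈0 = y≉0 (integral x≉0 xy≈0)

  ^-nonzero : ∀ {x} n → ¬ x ≈ 0# → ¬ x ^ n ≈ 0#
  ^-nonzero zero    x≉0 = 1≉0
  ^-nonzero (suc n) x≉0 = *-nonzero x≉0 (^-nonzero n x≉0)

  0^ : ∀ n → 1 ℕ.≤ n → 0# ^ n ≈ 0#
  0^ (suc n) _ = zeroˡ _

  total-*ˡ : ∀ s g → total (λ x → s * g x) ≈ s * total g
  total-*ˡ s g = sym (*-distribˡ-sum s (g ∘ from))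

  -- The translation x ↦ x + 1 permutes the field, so adding 1 to every element does not change the
  -- sum of all elements.
  characteristic : N ×ₙ 1# ≈ 0#
  characteristic = begin
    N ×ₙ 1#                                 ≈⟨ total-const 1# ⟨
    total (λ _ → 1#)                       ≈⟨ +-identityˡ _ ⟨
    0# + total (λ _ → 1#)                  ≈⟨ +-congʳ (-‿inverseˡ _) ⟨
    - S + S + total (λ _ → 1#)             ≈⟨ +-assoc _ _ _ ⟩
    - S + (S + total (λ _ → 1#))           ≈⟨ +-congˡ (total-∙ id (λ _ → 1#)) ⟨
    - S + total (λ x → x + 1#)             ≈⟨ +-congˡ (total-permute id +-congʳ +-congʳ
                                               (λ x → shift x (-‿inverseˡ 1#)) (λ x → shift x (-‿inverseʳ 1#))) ⟨
    - S + S                                ≈⟨ -‿inverseˡ _ ⟩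
    0#                                     ∎
    where
    S = total id
    shift : ∀ x {a b} → a + b ≈ 0# → x + a + b ≈ x
    shift x a+b≈0 = trans (+-assoc _ _ _) (trans (+-congˡ a+b≈0) (+-identityʳ x))

  private
    -- Products over the nonzero elements are taken over the whole field, with the factor at 0
    -- overwritten.
    ifNonzero : Carrier → Carrier → Carrier → Carrier
    ifNonzero y a b with y ≟ 0#
    ... | yes _ = b
    ... | no  _ = a

    ifNonzero-zero : ∀ {y} a b → y ≈ 0# → ifNonzero y a b ≈ b
    ifNonzero-zero {y} a b y≈0 with y ≟ 0#
    ... | yes _  = refl
    ... | no y≉0 = contradiction y≈0 y≉0

    ifNonzero-nonzero : ∀ {y} a b → ¬ y ≈ 0# → ifNonzero y a b ≈ a
    ifNonzero-nonzero {y} a b y≉0 with y ≟ 0#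
    ... | yes y≈0 = contradiction y≈0 y≉0
    ... | no _    = refl

    ifNonzero-cong : ∀ {y z a b c d} → y ≈ z → a ≈ b → c ≈ d → ifNonzero y a c ≈ ifNonzero z b d
    ifNonzero-cong {y} {z} y≈z a≈b c≈d with y ≟ 0# | z ≟ 0#
    ... | yes _   | yes _   = c≈d
    ... | no _    | no _    = a≈b
    ... | yes y≈0 | no z≉0  = contradiction (trans (sym y≈z) y≈0) z≉0
    ... | no y≉0  | yes z≈0 = contradiction (trans y≈z z≈0) y≉0

    product-nonzero : ∀ g → (∀ x → ¬ g x ≈ 0#) → ¬ product g ≈ 0#
    product-nonzero g g≉0 = go (g ∘ from) (g≉0 ∘ from)
      where
      open MonoidSum *-commutativeMonoid using (sum)
      go : ∀ {n} (t : Fin n → Carrier) → (∀ i → ¬ t i ≈ 0#) → ¬ sum t ≈ 0#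
      go {zero}  t t≉0 = 1≉0
      go {suc n} t t≉0 = *-nonzero (t≉0 zero) (go (t ∘ suc) (t≉0 ∘ suc))

  -- The constant x splits as `off` (x away from 0) times `at` (x at 0 only). Multiplication by x
  -- permutes the nonzero elements, hence multiplies their product `nz` by `product off` without
  -- changing it; so `product off`, which is x^(N-1), is 1.
  x^N≈x : ∀ x → 1 ℕ.≤ N → x ^ N ≈ x
  x^N≈x x 1≤N with x ≟ 0#
  ... | yes x≈0 = trans (^-congˡ N x≈0) (trans (0^ N 1≤N) (sym x≈0))
  ... | no x≉0 = begin
    x ^ N                                ≈⟨ product-const x ⟨
    product (λ _ → x)                    ≈⟨ product-cong split ⟩
    product (λ y → off y * at y)         ≈⟨ product-* off at ⟩
    product off * product at             ≈⟨ *-cong product-off product-at ⟩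
    1# * x                               ≈⟨ *-identityˡ x ⟩
    x                                    ∎
    where
    x⁻¹ = proj₁ (inverse x x≉0)
    xx⁻¹≈1 = proj₂ (inverse x x≉0)
    off at nz : Carrier → Carrier
    off y = ifNonzero y x 1#
    at  y = ifNonzero y 1# x
    nz  y = ifNonzero y y 1#

    split : ∀ y → x ≈ off y * at y
    split y with y ≟ 0#
    ... | yes _ = sym (*-identityˡ x)
    ... | no  _ = sym (*-identityʳ x)

    product-at : product at ≈ x
    product-at = trans (product-single (λ y≈z → ifNonzero-cong y≈z refl refl) 0# (λ y → ifNonzero-nonzero 1# x))
                       (ifNonzero-zero 1# x refl)

    nz-nonzero : ∀ y → ¬ nz y ≈ 0#
    nz-nonzero y with y ≟ 0#
    ... | yes _  = 1≉0
    ... | no y≉0 = y≉0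

    nz-* : ∀ y → nz (x * y) ≈ nz y * off y
    nz-* y with y ≟ 0#
    ... | yes y≈0 = trans (ifNonzero-zero _ _ (trans (*-congˡ y≈0) (zeroʳ x))) (sym (*-identityˡ _))
    ... | no y≉0 = trans (ifNonzero-nonzero _ _ (*-nonzero x≉0 y≉0)) (*-comm _ _)

    product-off : product off ≈ 1#
    product-off = *-cancelˡ-nonzero _ _ (product-nonzero nz nz-nonzero) (begin
      product nz * product off          ≈⟨ product-* nz off ⟨
      product (λ y → nz y * off y)      ≈⟨ product-cong nz-* ⟨
      product (λ y → nz (x * y))        ≈⟨ product-permute (λ y≈z → ifNonzero-cong y≈z y≈z refl) *-congˡ *-congˡ
                                            (inverse-cancelˡ xx⁻¹≈1) (inverse-cancelˡ (trans (*-comm _ _) xx⁻¹≈1)) ⟨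
      product nz                        ≈⟨ *-identityʳ _ ⟨
      product nz * 1#                   ∎)

-- Characteristic two: ring solver, traces and half traces.

HasCharTwo : ∀ {r₁ r₂} → CommutativeRing r₁ r₂ → Set r₂
HasCharTwo R = 1# + 1# ≈ 0#
  where open CommutativeRing R

module CharTwo {r₁ r₂} (R : CommutativeRing r₁ r₂) (1+1≈0 : HasCharTwo R) where

  open CommutativeRing R hiding (zero)

  private
    -- The solver takes its coefficients in the field with two elements, so that normal forms
    -- already incorporate x + x = 0.
    boolRing : RawRing _ _
    boolRing = record { Carrier = Bool ; _≈_ = _≡_ ; _+_ = _xor_ ; _*_ = _∧_ ; -_ = id ; 0# = false ; 1# = true }

    almostRing : AlmostCommutativeRing r₁ r₂
    almostRing = fromCommutativeSemiring commutativeSemiring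

    ⟦_⟧₂ : Bool → Carrier
    ⟦ false ⟧₂ = 0#
    ⟦ true  ⟧₂ = 1#

    boolMorphism : boolRing -Raw-AlmostCommutative⟶ almostRing
    boolMorphism = record
      { ⟦_⟧    = ⟦_⟧₂
      ; +-homo = λ where
          false y → sym (+-identityˡ _)
          true false → sym (+-identityʳ _)
          true true → sym 1+1≈0
      ; *-homo = λ where
          false y → sym (zeroˡ _)
          true y → sym (*-identityˡ _)
      ; -‿homo = λ _ → refl
      ; 0-homo = refl
      ; 1-homo = refl
      }

    _≟₂_ : WeaklyDecidable (Induced-equivalence boolMorphism)
    false ≟₂ false = just refl
    true ≟₂ true = just refl
    _ ≟₂ _ = nothing

  open RingSolver boolRing almostRing boolMorphism _≟₂_ public
    using (Polynomial; con; _:+_; _:*_; _:=_)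
  open RingSolver boolRing almostRing boolMorphism _≟₂_
    using (var; ⟦_⟧; ⟦_⟧↓; normalise; _≟N_; ⟦_⟧N-cong; correct)
  open Reflection setoid var ⟦_⟧ ⟦_⟧↓ correct using (close)

  :1 :0 : ∀ {n} → Polynomial n
  :1 = con true
  :0 = con false

  private
    sound : ∀ {n} (e₁ e₂ : Polynomial n) → T (is-just (normalise e₁ ≟N normalise e₂)) →
            ∀ ρ → ⟦ e₁ ⟧ ρ ≈ ⟦ e₂ ⟧ ρ
    sound e₁ e₂ t ρ with normalise e₁ ≟N normalise e₂
    ... | just eq = trans (sym (correct e₁ ρ)) (trans (⟦ eq ⟧N-cong ρ) (correct e₂ ρ))

  -- The implicit argument computes to the unit type once the normal forms agree and is then
  -- inferred; an identity is thus checked by evaluating a Boolean.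
  solve : ∀ n (f : N-ary n (Polynomial n) (Polynomial n × Polynomial n)) →
          (let e₁ , e₂ = close n f) →
          {T (is-just (normalise e₁ ≟N normalise e₂))} →
          Eq n _≈_ (curryⁿ ⟦ e₁ ⟧) (curryⁿ ⟦ e₂ ⟧)
  solve n f {t} = curryⁿ-cong _≈_ ⟦ proj₁ (close n f) ⟧ ⟦ proj₂ (close n f) ⟧ (sound (proj₁ (close n f)) (proj₂ (close n f)) t)

  open Exp commutativeSemiring
  open SetoidReasoning setoid
  open SemiringSum semiring using (sum; sum-cong-≋; ∑-distrib-+)

  x+x≈0 : ∀ x → x + x ≈ 0#
  x+x≈0 = solve 1 (λ x → x :+ x := :0)

  infixl 6 _⊞_
  infix  7 _·_

  ≈⇒+≈0 : ∀ {x y} → x ≈ y → x + y ≈ 0#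
  ≈⇒+≈0 x≈y = trans (+-congʳ x≈y) (x+x≈0 _)

  -- With `_⊞_` and `linear-combination` this gives proofs by ideal membership: to derive x ≈ y from
  -- equations uᵢ ≈ vᵢ, exhibit cofactors cᵢ with x + y = Σ cᵢ (uᵢ + vᵢ), an identity left to
  -- `solve`.
  _·_ : ∀ c {x y} → x ≈ y → c * (x + y) ≈ 0#
  c · x≈y = trans (*-congˡ (≈⇒+≈0 x≈y)) (zeroʳ c)

  _⊞_ : ∀ {x y} → x ≈ 0# → y ≈ 0# → x + y ≈ 0#
  x≈0 ⊞ y≈0 = trans (+-cong x≈0 y≈0) (+-identityˡ 0#)

  +≈0⇒≈ : ∀ {x y} → x + y ≈ 0# → x ≈ y
  +≈0⇒≈ {x} {y} x+y≈0 = begin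
    x            ≈⟨ solve 2 (λ x y → x := (x :+ y) :+ y) x y ⟩
    x + y + y    ≈⟨ +-congʳ x+y≈0 ⟩
    0# + y       ≈⟨ +-identityˡ y ⟩
    y            ∎

  linear-combination : ∀ {x y z} → x + y ≈ z → z ≈ 0# → x ≈ y
  linear-combination x+y≈z z≈0 = +≈0⇒≈ (trans x+y≈z z≈0)

  ^-double : ∀ x n → x ^ (2 ℕ.* n) ≈ (x * x) ^ n
  ^-double x n = trans (sym (^-assocʳ x 2 n)) (^-congˡ n (*-congˡ (*-identityʳ x)))

  ^2^-+ : ∀ n x y → (x + y) ^ (2 ℕ.^ n) ≈ x ^ (2 ℕ.^ n) + y ^ (2 ℕ.^ n)
  ^2^-+ zero x y = solve 2 (λ x y → (x :+ y) :* :1 := x :* :1 :+ y :* :1) x y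
  ^2^-+ (suc n) x y = begin
    (x + y) ^ (2 ℕ.* 2 ℕ.^ n)                      ≈⟨ ^-double (x + y) (2 ℕ.^ n) ⟩
    ((x + y) * (x + y)) ^ (2 ℕ.^ n)                ≈⟨ ^-congˡ (2 ℕ.^ n) (solve 2 (λ x y → (x :+ y) :* (x :+ y) := x :* x :+ y :* y) x y) ⟩
    (x * x + y * y) ^ (2 ℕ.^ n)                    ≈⟨ ^2^-+ n (x * x) (y * y) ⟩
    (x * x) ^ (2 ℕ.^ n) + (y * y) ^ (2 ℕ.^ n)      ≈⟨ +-cong (^-double x (2 ℕ.^ n)) (^-double y (2 ℕ.^ n)) ⟨
    x ^ (2 ℕ.* 2 ℕ.^ n) + y ^ (2 ℕ.* 2 ℕ.^ n)      ∎

  -- The same sum as `Tr`. It is also used with length ℓ on all of 𝔽_(q²), where it is merely an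
  -- additive polynomial.
  trace : ℕ → Carrier → Carrier
  trace n x = sum {n} (λ i → x ^ (2 ℕ.^ toℕ i))

  trace-cong : ∀ n {x y} → x ≈ y → trace n x ≈ trace n y
  trace-cong n x≈y = sum-cong-≋ {n} (λ i → ^-congˡ (2 ℕ.^ toℕ i) x≈y)

  trace-+ : ∀ n x y → trace n (x + y) ≈ trace n x + trace n y
  trace-+ n x y = trans (sum-cong-≋ {n} (λ i → ^2^-+ (toℕ i) x y)) (∑-distrib-+ {n} _ _)

  trace-suc : ∀ n x → trace (suc n) x ≈ x + trace n (x * x)
  trace-suc n x = +-cong (*-identityʳ x) (sum-cong-≋ {n} (λ i → ^-double x (2 ℕ.^ toℕ i)))

  trace-² : ∀ n x → trace n (x * x) ≈ trace n x * trace n x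
  trace-² zero    x = sym (zeroˡ 0#)
  trace-² (suc n) x = begin
    trace (suc n) (x * x)                              ≈⟨ trace-suc n (x * x) ⟩
    x * x + trace n (x * x * (x * x))                  ≈⟨ +-congˡ (trace-² n (x * x)) ⟩
    x * x + trace n (x * x) * trace n (x * x)          ≈⟨ solve 2 (λ x y → x :* x :+ y :* y := (x :+ y) :* (x :+ y)) x (trace n (x * x)) ⟩
    (x + trace n (x * x)) * (x + trace n (x * x))      ≈⟨ *-cong (trace-suc n x) (trace-suc n x) ⟨
    trace (suc n) x * trace (suc n) x                  ∎

  trace-^2^ : ∀ n m x → trace n (x ^ (2 ℕ.^ m)) ≈ trace n x ^ (2 ℕ.^ m)
  trace-^2^ n zero x = trans (trace-cong n (*-identityʳ x)) (sym (*-identityʳ _))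
  trace-^2^ n (suc m) x = begin
    trace n (x ^ (2 ℕ.* 2 ℕ.^ m))           ≈⟨ trace-cong n (^-double x (2 ℕ.^ m)) ⟩
    trace n ((x * x) ^ (2 ℕ.^ m))           ≈⟨ trace-^2^ n m (x * x) ⟩
    trace n (x * x) ^ (2 ℕ.^ m)             ≈⟨ ^-congˡ (2 ℕ.^ m) (trace-² n x) ⟩
    (trace n x * trace n x) ^ (2 ℕ.^ m)     ≈⟨ ^-double (trace n x) (2 ℕ.^ m) ⟨
    trace n x ^ (2 ℕ.* 2 ℕ.^ m)             ∎

  -- The sum of the x^(2^i) + x^(2^(i+1)) telescopes.
  trace-x²+x : ∀ n x → trace n (x * x + x) ≈ x ^ (2 ℕ.^ n) + x
  trace-x²+x zero x = solve 1 (λ x → :0 := x :* :1 :+ x) x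
  trace-x²+x (suc n) x = begin
    trace (suc n) (x * x + x)                                 ≈⟨ trace-suc n _ ⟩
    x * x + x + trace n ((x * x + x) * (x * x + x))           ≈⟨ +-congˡ (trace-cong n (solve 1 (λ x → (x :* x :+ x) :* (x :* x :+ x) := x :* x :* (x :* x) :+ x :* x) x)) ⟩
    x * x + x + trace n (x * x * (x * x) + x * x)             ≈⟨ +-congˡ (trace-x²+x n (x * x)) ⟩
    x * x + x + ((x * x) ^ (2 ℕ.^ n) + x * x)                 ≈⟨ solve 3 (λ x y z → y :+ x :+ (z :+ y) := z :+ x) x (x * x) ((x * x) ^ (2 ℕ.^ n)) ⟩
    (x * x) ^ (2 ℕ.^ n) + x                                   ≈⟨ +-congʳ (^-double x (2 ℕ.^ n)) ⟨
    x ^ (2 ℕ.* 2 ℕ.^ n) + x                                   ∎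

  trace-1-odd : ∀ j → trace (suc (j ℕ.* 2)) 1# ≈ 1#
  trace-1-odd zero = solve 0 (:1 :* :1 :+ :0 := :1)
  trace-1-odd (suc j) = begin
    trace (suc (suc (suc (j ℕ.* 2)))) 1#                 ≈⟨ step (suc (suc (j ℕ.* 2))) ⟩
    1# + trace (suc (suc (j ℕ.* 2))) 1#                  ≈⟨ +-congˡ (step (suc (j ℕ.* 2))) ⟩
    1# + (1# + trace (suc (j ℕ.* 2)) 1#)                 ≈⟨ solve 1 (λ x → :1 :+ (:1 :+ x) := x) _ ⟩
    trace (suc (j ℕ.* 2)) 1#                             ≈⟨ trace-1-odd j ⟩
    1#                                                   ∎
    where
    step : ∀ n → trace (suc n) 1# ≈ 1# + trace n 1#
    step n = trans (trace-suc n 1#) (+-congˡ (trace-cong n (*-identityʳ 1#)))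

  -- The half trace x + x^4 + x^16 + ⋯ + x^(4^j). Its square supplies the powers in between, so for
  -- odd n = 2j + 1 it solves h² + h = x up to the trace, given x^(2^n) = x.
  halfTrace : ℕ → Carrier → Carrier
  halfTrace zero    x = x
  halfTrace (suc j) x = x + halfTrace j (x * x * (x * x))

  halfTrace-²+ : ∀ j x → let h = halfTrace j x ; n = suc (j ℕ.* 2) in
                 h * h + h ≈ trace n x + x ^ (2 ℕ.^ n)
  halfTrace-²+ zero x = solve 1 (λ x → x :* x :+ x := (x :* :1 :+ :0) :+ x :* (x :* :1)) x
  halfTrace-²+ (suc j) x = begin
    (x + h) * (x + h) + (x + h)                          ≈⟨ solve 2 (λ x h → (x :+ h) :* (x :+ h) :+ (x :+ h) := x :+ x :* x :+ (h :* h :+ h)) x h ⟩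
    x + x * x + (h * h + h)                              ≈⟨ +-congˡ (halfTrace-²+ j x⁴) ⟩
    x + x * x + (trace n x⁴ + x⁴ ^ (2 ℕ.^ n))            ≈⟨ solve 4 (λ a b c d → a :+ b :+ (c :+ d) := a :+ (b :+ c) :+ d) x (x * x) (trace n x⁴) (x⁴ ^ (2 ℕ.^ n)) ⟩
    x + (x * x + trace n x⁴) + x⁴ ^ (2 ℕ.^ n)            ≈⟨ +-cong (trans (trace-suc (suc n) x) (+-congˡ (trace-suc n (x * x))))
                                                                   (trans (^-double x (2 ℕ.* 2 ℕ.^ n)) (^-double (x * x) (2 ℕ.^ n))) ⟨
    trace (suc (suc n)) x + x ^ (2 ℕ.* (2 ℕ.* 2 ℕ.^ n))  ∎
    where
    n = suc (j ℕ.* 2)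
    x⁴ = x * x * (x * x)
    h = halfTrace j x⁴

-- Fields with 2^m elements: roots of polynomials and power sums.

module EvenField {r₁ r₂} (R : CommutativeRing r₁ r₂) {m : ℕ} (isFiniteField : IsFiniteField R (2 ℕ.^ m)) where

  open CommutativeRing R hiding (zero)
  open FiniteField R isFiniteField public
  open Inverse enumeration using (to; from; to-cong; strictlyInverseˡ)
  open Exp commutativeSemiring
  open Mult semiring using (×1-homo-*) renaming (_×_ to _×ₙ_)
  open SetoidReasoning setoid

  -- The field satisfies 2^m = 0, and in a field a power of 2 vanishes only if 2 does.
  1+1≈0 : HasCharTwo R
  1+1≈0 = decidable-stable (1# + 1# ≟ 0#) λ 2≉0 → 2^×1≉0 2≉0 m characteristic
    where
    2^×1≉0 : ¬ 1# + 1# ≈ 0# → ∀ m → ¬ (2 ℕ.^ m) ×ₙ 1# ≈ 0#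
    2^×1≉0 2≉0 zero    eq = 1≉0 (trans (sym (+-identityʳ 1#)) eq)
    2^×1≉0 2≉0 (suc m) eq = *-nonzero (2≉0 ∘ trans (+-congˡ (sym (+-identityʳ 1#)))) (2^×1≉0 2≉0 m)
      (trans (sym (×1-homo-* 2 (2 ℕ.^ m))) eq)

  open CharTwo R 1+1≈0 public

  N : ℕ
  N = 2 ℕ.^ m

  x^N : ∀ x → x ^ N ≈ x
  x^N x = x^N≈x x (ℕ.m^n>0 2 m)

  -- Monic polynomial functions in Horner form, indexed by degree. Functions are described up to
  -- pointwise equality, so root counting needs no coefficient lists.
  data Monic : ℕ → (Carrier → Carrier) → Set (r₁ ⊔ r₂) where
    one  : ∀ {g} → (∀ x → g x ≈ 1#) → Monic zero g
    step : ∀ {d g h} a → Monic d h → (∀ x → g x ≈ a + x * h x) → Monic (suc d) g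

  private
    monic-+ : ∀ {d g h} r → Monic (suc d) g → Monic d h → Monic (suc d) (λ x → g x + r * h x)
    monic-+ r (step a (one g'≈1) g≈) (one h≈1) =
      step (a + r) (one λ _ → refl) λ x → trans (+-cong (trans (g≈ x) (+-congˡ (*-congˡ (g'≈1 x)))) (*-congˡ (h≈1 x)))
        (solve 3 (λ a r x → a :+ x :* :1 :+ r :* :1 := a :+ r :+ x :* :1) a r x)
    monic-+ r (step {h = g'} a g'-monic g≈) (step {h = h'} b h'-monic h≈) =
      step (a + r * b) (monic-+ r g'-monic h'-monic) λ x → trans (+-cong (g≈ x) (*-congˡ (h≈ x)))
        (solve 6 (λ a b r x y z → a :+ x :* y :+ r :* (b :+ x :* z) := a :+ r :* b :+ x :* (y :+ r :* z)) a b r x (g' x) (h' x))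

    divide-root : ∀ {d g} r → Monic (suc d) g → ∃[ h ] Monic d h × (∀ x → g x + g r ≈ (x + r) * h x)
    divide-root r (step a g'-monic@(one g'≈1) g≈) = (λ _ → 1#) , one (λ _ → refl) , λ x →
      trans (+-cong (trans (g≈ x) (+-congˡ (*-congˡ (g'≈1 x)))) (trans (g≈ r) (+-congˡ (*-congˡ (g'≈1 r)))))
        (solve 3 (λ a r x → a :+ x :* :1 :+ (a :+ r :* :1) := (x :+ r) :* :1) a r x)
    divide-root {g = g} r (step {h = g'} a g'-monic@(step _ _ _) g≈) with divide-root r g'-monic
    ... | h , h-monic , g'≈ = (λ x → g' x + r * h x) , monic-+ r g'-monic h-monic , λ x →
      trans (+-cong (g≈ x) (g≈ r)) (linear-combination
        (solve 6 (λ a r x y z w → a :+ x :* y :+ (a :+ r :* z) :+ (x :+ r) :* (y :+ r :* w) := r :* (y :+ z :+ (x :+ r) :* w))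
          a r x (g' x) (g' r) (h x))
        (r · g'≈ x))

  monic-roots : ∀ {d g} → Monic d g → (p : Fin (suc d) → Carrier) → (∀ {i j} → p i ≈ p j → i ≡ j) →
                ¬ (∀ i → g (p i) ≈ 0#)
  monic-roots (one g≈1) p p-injective roots = 1≉0 (trans (sym (g≈1 _)) (roots zero))
  monic-roots {g = g} g-monic@(step _ _ _) p p-injective roots with divide-root (p zero) g-monic
  ... | h , h-monic , g≈ = monic-roots h-monic (p ∘ suc) (Fin.suc-injective ∘ p-injective) λ i →
    integral (λ p+p≈0 → contradiction (p-injective (+≈0⇒≈ p+p≈0)) λ ())
      (trans (sym (g≈ (p (suc i)))) (roots (suc i) ⊞ roots zero))

  monic-nonvanishing : ∀ {d g} → Monic d g → d ℕ.< N → ¬ (∀ x → g x ≈ 0#)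
  monic-nonvanishing g-monic d<N g≈0 = monic-roots g-monic (λ i → from (inject≤ i d<N))
    (λ eq → Fin.inject≤-injective d<N d<N _ _ (≡.trans (≡.sym (strictlyInverseˡ _)) (≡.trans (to-cong eq) (strictlyInverseˡ _))))
    (λ i → g≈0 _)

  monic-^ : ∀ n → Monic n (_^ n)
  monic-^ zero    = one λ _ → refl
  monic-^ (suc n) = step 0# (monic-^ n) λ x → sym (+-identityˡ _)

  -- X^n + X is monic of degree n, too small for N roots. With n = q this yields an element outside
  -- 𝔽_q.
  x^n≉x : ∀ n → 2 ℕ.≤ n → n ℕ.< N → ¬ (∀ x → x ^ n ≈ x)
  x^n≉x (suc (suc n)) (ℕ.s≤s (ℕ.s≤s _)) n<N x^n≈x = monic-nonvanishing
    (step 0# (step 1# (monic-^ n) (λ x → refl))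
      (λ x → solve 2 (λ x y → x :* (x :* y) :+ x := :0 :+ x :* (:1 :+ x :* y)) x (x ^ n)))
    n<N (λ x → ≈⇒+≈0 (x^n≈x x))

  -- Substituting x y for y multiplies the sum by x^n for each x ≠ 0. Were the sum nonzero, every
  -- such x^n would be 1 and x^(n+1) = x throughout, against `x^n≉x`.
  power-sum : ∀ n → 1 ℕ.≤ n → suc n ℕ.< N → total (_^ n) ≈ 0#
  power-sum n 1≤n n<N = decidable-stable (total (_^ n) ≟ 0#) λ S≉0 →
    x^n≉x (suc n) (ℕ.s≤s 1≤n) n<N λ x → x^n+1≈x S≉0 x (x ≟ 0#)
    where
    S = total (_^ n)
    x^n+1≈x : ¬ S ≈ 0# → ∀ x → Dec (x ≈ 0#) → x * x ^ n ≈ x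
    x^n+1≈x S≉0 x (yes x≈0) = trans (*-congʳ x≈0) (trans (zeroˡ _) (sym x≈0))
    x^n+1≈x S≉0 x (no x≉0) = trans (*-congˡ x^n≈1) (*-identityʳ x)
      where
      x⁻¹ = proj₁ (inverse x x≉0)
      xx⁻¹≈1 = proj₂ (inverse x x≉0)
      x^n≈1 : x ^ n ≈ 1#
      x^n≈1 = *-cancelˡ-nonzero _ _ S≉0 (begin
        S * x ^ n                    ≈⟨ *-comm _ _ ⟩
        x ^ n * S                    ≈⟨ total-*ˡ (x ^ n) (_^ n) ⟨
        total (λ y → x ^ n * y ^ n)  ≈⟨ total-cong (λ y → ^-distrib-* x y n) ⟨
        total (λ y → (x * y) ^ n)    ≈⟨ total-permute (^-congˡ n) *-congˡ *-congˡ
                                          (inverse-cancelˡ xx⁻¹≈1) (inverse-cancelˡ (trans (*-comm _ _) xx⁻¹≈1)) ⟨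
        S                            ≈⟨ *-identityʳ S ⟨
        S * 1#                       ∎)

-- The field 𝔽_(q²): conjugation, (Q+1)-th powers and Artin-Schreier equations.

module QuadraticExtension {r₁ r₂} (R : CommutativeRing r₁ r₂) (i j : ℕ)
                          (isFiniteField : IsFiniteField R (2 ℕ.^ (suc (i ℕ.* 2) ℕ.* 2))) where

  open CommutativeRing R hiding (zero)

  k ℓ : ℕ
  k = suc (i ℕ.* 2)
  ℓ = suc (j ℕ.* 2)

  open EvenField R {k ℕ.* 2} isFiniteField public
  open Exp commutativeSemiring
  open SetoidReasoning setoid

  q Q : ℕ
  q = 2 ℕ.^ k
  Q = 2 ℕ.^ ℓ

  infix 9 _‾ _ᵠ

  _‾ _ᵠ : Carrier → Carrier
  x ‾ = x ^ q
  x ᵠ = x ^ Q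

  q*q≡N : q ℕ.* q ≡ N
  q*q≡N = ≡.trans (≡.cong (q ℕ.*_) (≡.sym (ℕ.*-identityʳ q))) (ℕ.^-*-assoc 2 k 2)

  ‾-cong : ∀ {x y} → x ≈ y → x ‾ ≈ y ‾
  ‾-cong = ^-congˡ q

  ᵠ-cong : ∀ {x y} → x ≈ y → x ᵠ ≈ y ᵠ
  ᵠ-cong = ^-congˡ Q

  ‾-+ : ∀ x y → (x + y) ‾ ≈ x ‾ + y ‾
  ‾-+ = ^2^-+ k

  ᵠ-+ : ∀ x y → (x + y) ᵠ ≈ x ᵠ + y ᵠ
  ᵠ-+ = ^2^-+ ℓ

  ‾-* : ∀ x y → (x * y) ‾ ≈ x ‾ * y ‾
  ‾-* x y = ^-distrib-* x y q

  ᵠ-* : ∀ x y → (x * y) ᵠ ≈ x ᵠ * y ᵠ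
  ᵠ-* x y = ^-distrib-* x y Q

  ‾‾ : ∀ x → x ‾ ‾ ≈ x
  ‾‾ x = begin
    (x ^ q) ^ q     ≈⟨ ^-assocʳ x q q ⟩
    x ^ (q ℕ.* q)   ≡⟨ ≡.cong (x ^_) q*q≡N ⟩
    x ^ N           ≈⟨ x^N x ⟩
    x               ∎

  ^-comm : ∀ x m n → (x ^ m) ^ n ≈ (x ^ n) ^ m
  ^-comm x m n = trans (^-assocʳ x m n) (trans (^-congʳ x (ℕ.*-comm m n)) (sym (^-assocʳ x n m)))

  ᵠ‾ : ∀ x → x ᵠ ‾ ≈ x ‾ ᵠ
  ᵠ‾ x = ^-comm x Q q

  1^ : ∀ n → 1# ^ n ≈ 1#
  1^ zero    = refl
  1^ (suc n) = trans (*-identityˡ _) (1^ n)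

  0‾ : 0# ‾ ≈ 0#
  0‾ = 0^ q (ℕ.m^n>0 2 k)

  0ᵠ : 0# ᵠ ≈ 0#
  0ᵠ = 0^ Q (ℕ.m^n>0 2 ℓ)

  ^2^-injective : ∀ n {x y} → x ^ (2 ℕ.^ n) ≈ y ^ (2 ℕ.^ n) → x ≈ y
  ^2^-injective n {x} {y} eq = +≈0⇒≈ (decidable-stable (x + y ≟ 0#) λ x+y≉0 →
    ^-nonzero (2 ℕ.^ n) x+y≉0 (trans (^2^-+ n x y) (≈⇒+≈0 eq)))

  ²-injective : ∀ {x y} → x * x ≈ y * y → x ≈ y
  ²-injective {x} {y} eq = ^2^-injective 1 (trans (*-congˡ (*-identityʳ x)) (trans eq (sym (*-congˡ (*-identityʳ y)))))

  √ : ∀ y → ∃[ x ] x * x ≈ y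
  √ = injective⇒surjective (λ eq → *-cong eq eq) ²-injective

  ᵠ√ : ∀ y → ∃[ x ] x ᵠ ≈ y
  ᵠ√ = injective⇒surjective ᵠ-cong (^2^-injective ℓ)

  ^-fixed : ∀ x m n → x ^ m ≈ x → x ^ (m ℕ.^ n) ≈ x
  ^-fixed x m zero    _  = *-identityʳ x
  ^-fixed x m (suc n) eq = trans (sym (^-assocʳ x m (m ℕ.^ n))) (trans (^-congˡ (m ℕ.^ n) eq) (^-fixed x m n eq))

  private
    ^2^-twist : ∀ x m n → x ^ ((2 ℕ.^ m) ℕ.^ n) ≈ x ^ ((2 ℕ.^ n) ℕ.^ m)
    ^2^-twist x m n = ^-congʳ x (≡.trans (ℕ.^-*-assoc 2 m n) (≡.trans (≡.cong (2 ℕ.^_) (ℕ.*-comm m n)) (≡.sym (ℕ.^-*-assoc 2 n m))))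

    -- As k is odd, m + 1 divides m^k + 1, so x^(m+1) = 1 gives x^(m^k) x = 1; when x^(m^k) = x this
    -- reads x² = 1.
    ^+1≈1 : ∀ x m → x ^ m * x ≈ 1# → x ^ (m ℕ.^ k) ≈ x → x ≈ 1#
    ^+1≈1 x m eq fixed with x+1∣x^odd+1 m i
    ... | divides r r≡ = ²-injective (begin
      x * x                          ≈⟨ *-cong fixed (*-identityʳ x) ⟨
      x ^ (m ℕ.^ k) * x ^ 1          ≈⟨ ^-homo-* x (m ℕ.^ k) 1 ⟨
      x ^ (m ℕ.^ k ℕ.+ 1)            ≡⟨ ≡.cong (x ^_) (≡.trans r≡ (ℕ.*-comm r (m ℕ.+ 1))) ⟩
      x ^ ((m ℕ.+ 1) ℕ.* r)          ≈⟨ ^-assocʳ x (m ℕ.+ 1) r ⟨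
      (x ^ (m ℕ.+ 1)) ^ r            ≈⟨ ^-congˡ r (trans (^-homo-* x m 1) (trans (*-congˡ (*-identityʳ x)) eq)) ⟩
      1# ^ r                         ≈⟨ 1^ r ⟩
      1#                             ≈⟨ *-identityʳ 1# ⟨
      1# * 1#                        ∎)

  -- Q^k = 2^(ℓk) = q^ℓ, an iterate of the conjugation.
  fixed^Q^k : ∀ x → x ‾ ≈ x → x ^ (Q ℕ.^ k) ≈ x
  fixed^Q^k x x‾≈x = trans (^2^-twist x ℓ k) (^-fixed x q ℓ x‾≈x)

  xᵠx≈1⇒x≈1 : ∀ x → x ‾ ≈ x → x ᵠ * x ≈ 1# → x ≈ 1#
  xᵠx≈1⇒x≈1 x x‾≈x eq = ^+1≈1 x Q eq (fixed^Q^k x x‾≈x)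

  -- x ‾ ᵠ = x^(2^(k+ℓ)) with k + ℓ even, so that (k + ℓ) k is a multiple of 2k.
  x‾ᵠx≈1⇒x≈1 : ∀ x → x ‾ ᵠ * x ≈ 1# → x ≈ 1#
  x‾ᵠx≈1⇒x≈1 x eq = ^+1≈1 x P (trans (*-congʳ (sym (^-assocʳ x q Q))) eq)
    (trans (^-congʳ x P^k≡N^h) (^-fixed x N h (x^N x)))
    where
    P = q ℕ.* Q
    h = suc (i ℕ.+ j)
    P^k≡N^h : P ℕ.^ k ≡ N ℕ.^ h
    P^k≡N^h = ≡.trans (≡.cong (ℕ._^ k) (≡.sym (ℕ.^-distribˡ-+-* 2 k ℓ)))
      (≡.trans (ℕ.^-*-assoc 2 (k ℕ.+ ℓ) k) (≡.trans (≡.cong (2 ℕ.^_) (identity i j)) (≡.sym (ℕ.^-*-assoc 2 (k ℕ.* 2) h))))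
      where
      identity : ∀ i j → (suc (i ℕ.* 2) ℕ.+ suc (j ℕ.* 2)) ℕ.* suc (i ℕ.* 2) ≡ suc (i ℕ.* 2) ℕ.* 2 ℕ.* suc (i ℕ.+ j)
      identity = solve-∀

  ratio : ∀ x {y} → ¬ y ≈ 0# → ∃[ w ] x ≈ w * y
  ratio x {y} y≉0 with inverse y y≉0
  ... | y⁻¹ , yy⁻¹≈1 = x * y⁻¹ , linear-combination
    (solve 3 (λ x y z → x :+ x :* z :* y := x :* (y :* z :+ :1)) x y y⁻¹) (x · yy⁻¹≈1)

  -- The equation x y ‾ = x ‾ y expresses linear dependence over 𝔽_q throughout.
  parallel⇒ratio : ∀ x {y} → ¬ y ≈ 0# → x * y ‾ ≈ x ‾ * y → ∃[ w ] w ‾ ≈ w × x ≈ w * y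
  parallel⇒ratio x {y} y≉0 eq with ratio x y≉0
  ... | w , x≈wy = w , *-cancelˡ-nonzero _ _ (*-nonzero y≉0 (^-nonzero q y≉0)) (linear-combination
        (solve 6 (λ x y z t w u → y :* t :* u :+ y :* t :* w := (x :* t :+ z :* y) :+ (t :* (x :+ w :* y) :+ y :* (z :+ u :* t)))
          x y (x ‾) (y ‾) w (w ‾))
        (≈⇒+≈0 eq ⊞ (y ‾ · x≈wy ⊞ y · trans (‾-cong x≈wy) (‾-* w y)))) , x≈wy

  private
    -- Injectivity is reduced to the fibre over 1. The last hypothesis also receives x ≈ w y, so
    -- that the ratio w may first be shown to lie in 𝔽_q.
    multiplicative-injective : ∀ {g : Carrier → Carrier} → (∀ x → ¬ x ≈ 0# → ¬ g x ≈ 0#) → g 0# ≈ 0# →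
                               Congruent _≈_ _≈_ g → (∀ x y → g (x * y) ≈ g x * g y) →
                               ∀ x y → g x ≈ g y → (∀ w → x ≈ w * y → ¬ y ≈ 0# → g w ≈ 1# → w ≈ 1#) → x ≈ y
    multiplicative-injective {g} g≉0 g0≈0 g-cong g-* x y gx≈gy unit with y ≟ 0#
    ... | yes y≈0 = trans (decidable-stable (x ≟ 0#) λ x≉0 → g≉0 x x≉0 (trans gx≈gy (trans (g-cong y≈0) g0≈0))) (sym y≈0)
    ... | no y≉0 with ratio x y≉0
    ...   | w , x≈wy = trans x≈wy (trans (*-congʳ (unit w x≈wy y≉0 (*-cancelˡ-nonzero _ _ (g≉0 y y≉0) (begin
      g y * g w     ≈⟨ *-comm _ _ ⟩
      g w * g y     ≈⟨ g-* w y ⟨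
      g (w * y)     ≈⟨ g-cong x≈wy ⟨
      g x           ≈⟨ gx≈gy ⟩
      g y           ≈⟨ *-identityʳ _ ⟨
      g y * 1#      ∎)))) (*-identityˡ y))

  -- Injectivity is along a line over 𝔽_q only: on the whole field `ω` and 1 collide, by `ωᵠω≈1`
  -- below.
  xᵠx-injective : ∀ {x y} → x * y ‾ ≈ x ‾ * y → x ᵠ * x ≈ y ᵠ * y → x ≈ y
  xᵠx-injective {x} {y} parallel eq = multiplicative-injective
    (λ x x≉0 → *-nonzero (^-nonzero Q x≉0) x≉0) (zeroʳ _) (λ eq → *-cong (ᵠ-cong eq) eq)
    (λ x y → trans (*-congʳ (ᵠ-* x y)) (solve 4 (λ x y z w → x :* y :* (z :* w) := x :* z :* (y :* w)) (x ᵠ) (y ᵠ) x y))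
    x y eq λ w x≈wy y≉0 gw≈1 → let u , u‾≈u , x≈uy = parallel⇒ratio x y≉0 parallel
                                   w≈u = *-cancelˡ-nonzero w u y≉0 (trans (*-comm y w) (trans (sym x≈wy) (trans x≈uy (*-comm u y))))
                               in xᵠx≈1⇒x≈1 w (trans (‾-cong w≈u) (trans u‾≈u (sym w≈u))) gw≈1

  x‾ᵠx-injective : ∀ {x y} → x ‾ ᵠ * x ≈ y ‾ ᵠ * y → x ≈ y
  x‾ᵠx-injective {x} {y} eq = multiplicative-injective
    (λ x x≉0 → *-nonzero (^-nonzero Q (^-nonzero q x≉0)) x≉0) (zeroʳ _) (λ eq → *-cong (ᵠ-cong (‾-cong eq)) eq)
    (λ x y → trans (*-congʳ (trans (ᵠ-cong (‾-* x y)) (ᵠ-* _ _)))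
               (solve 4 (λ x y z w → x :* y :* (z :* w) := x :* z :* (y :* w)) (x ‾ ᵠ) (y ‾ ᵠ) x y))
    x y eq λ w _ _ → x‾ᵠx≈1⇒x≈1 w

  -- With s = √y in 𝔽_q, s^(Q^k + 1) = s² = y, and Q + 1 divides the exponent with quotient r; the
  -- root is s^r.
  xᵠx-root : ∀ y → y ‾ ≈ y → ∃[ x ] x ‾ ≈ x × x ᵠ * x ≈ y
  xᵠx-root y y‾≈y = s ^ r , trans (^-comm s r q) (^-congˡ r s‾≈s) , (begin
    (s ^ r) ^ Q * s ^ r              ≈⟨ *-congˡ (*-identityʳ _) ⟨
    (s ^ r) ^ Q * (s ^ r) ^ 1        ≈⟨ ^-homo-* (s ^ r) Q 1 ⟨
    (s ^ r) ^ (Q ℕ.+ 1)              ≈⟨ ^-assocʳ s r (Q ℕ.+ 1) ⟩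
    s ^ (r ℕ.* (Q ℕ.+ 1))            ≡⟨ ≡.cong (s ^_) r≡ ⟨
    s ^ (Q ℕ.^ k ℕ.+ 1)              ≈⟨ ^-homo-* s (Q ℕ.^ k) 1 ⟩
    s ^ (Q ℕ.^ k) * s ^ 1            ≈⟨ *-cong (fixed^Q^k s s‾≈s) (*-identityʳ s) ⟩
    s * s                            ≈⟨ s²≈y ⟩
    y                                ∎)
    where
    s = proj₁ (√ y)
    s²≈y = proj₂ (√ y)
    r = quotient (x+1∣x^odd+1 Q i)
    r≡ = _∣_.equality (x+1∣x^odd+1 Q i)
    s‾≈s : s ‾ ≈ s
    s‾≈s = ²-injective (trans (sym (‾-* s s)) (trans (‾-cong s²≈y) (trans y‾≈y (sym s²≈y))))

  -- The vector C + D ‾ solves the equation, unless it is zero.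
  equal-norms⇒kernel : ∀ C D → C * C ‾ ≈ D * D ‾ → ∃[ z ] ¬ z ≈ 0# × D * z ≈ C * z ‾
  equal-norms⇒kernel C D norms with C + D ‾ ≟ 0# | D ≟ 0#
  ... | no z≉0  | _ = C + D ‾ , z≉0 , (begin
    D * (C + D ‾)          ≈⟨ distribˡ D C (D ‾) ⟩
    D * C + D * D ‾        ≈⟨ +-cong (*-comm D C) (sym norms) ⟩
    C * D + C * C ‾        ≈⟨ solve 3 (λ c d c' → c :* d :+ c :* c' := c :* (c' :+ d)) C D (C ‾) ⟩
    C * (C ‾ + D)          ≈⟨ *-congˡ (+-congˡ (‾‾ D)) ⟨
    C * (C ‾ + D ‾ ‾)      ≈⟨ *-congˡ (‾-+ C (D ‾)) ⟨
    C * (C + D ‾) ‾        ∎)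
  ... | yes z≈0 | no D≉0 = D ‾ , ^-nonzero q D≉0 , trans (*-comm D (D ‾)) (*-cong (sym (+≈0⇒≈ z≈0)) (sym (‾‾ D)))
  ... | yes z≈0 | yes D≈0 = 1# , 1≉0 , trans (*-congʳ D≈0) (trans (zeroˡ _) (sym (trans (*-congʳ C≈0) (zeroˡ _))))
    where
    C≈0 : C ≈ 0#
    C≈0 = trans (+≈0⇒≈ z≈0) (trans (‾-cong D≈0) 0‾)

  idempotent : ∀ {x} → x * x ≈ x → x ≈ 0# ⊎ x ≈ 1#
  idempotent {x} x²≈x with x ≟ 0#
  ... | yes x≈0 = inj₁ x≈0
  ... | no x≉0  = inj₂ (*-cancelˡ-nonzero _ _ x≉0 (trans x²≈x (sym (*-identityʳ x))))

  -- For y outside the fixed field of ‾, the element z = y / (y + y ‾) satisfies z + z ‾ = 1,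
  -- so z² + z lies in the fixed field and has trace 1; its half trace corrects z to ω.
  ω-exists : ∃[ ω ] ω * ω ≈ ω + 1#
  ω-exists with ¬∀⇒∃¬ ‾-cong id (x^n≉x q (ℕ.*-monoʳ-≤ 2 (ℕ.m^n>0 2 (i ℕ.* 2)))
                  (ℕ.<-≤-trans (ℕ.m<m*n q q {{ℕ.>-nonZero (ℕ.m^n>0 2 k)}} (ℕ.*-monoʳ-≤ 2 (ℕ.m^n>0 2 (i ℕ.* 2)))) (ℕ.≤-reflexive q*q≡N)))
  ... | y , y‾≉y with inverse (y ‾ + y) (λ eq → y‾≉y (+≈0⇒≈ eq))
  ...   | s , s-inverse = z + h , linear-combination
    (solve 3 (λ z h t → (z :+ h) :* (z :+ h) :+ (z :+ h :+ :1) := (h :* h :+ h :+ (t :+ (z :* z :+ z))) :+ (t :+ :1)) z h (trace k u))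
    (≈⇒+≈0 (trans (halfTrace-²+ i u) (+-congˡ u‾≈u)) ⊞ ≈⇒+≈0 trace-u)
    where
    z = y * s
    u = z * z + z
    h = halfTrace i u
    s‾≈s : s ‾ ≈ s
    s‾≈s = *-cancelˡ-nonzero _ _ (λ eq → y‾≉y (+≈0⇒≈ eq)) (begin
      (y ‾ + y) * s ‾          ≈⟨ *-congʳ (+-comm _ _) ⟩
      (y + y ‾) * s ‾          ≈⟨ *-congʳ (+-congʳ (‾‾ y)) ⟨
      (y ‾ ‾ + y ‾) * s ‾      ≈⟨ *-congʳ (‾-+ (y ‾) y) ⟨
      (y ‾ + y) ‾ * s ‾        ≈⟨ ‾-* _ s ⟨
      ((y ‾ + y) * s) ‾        ≈⟨ ‾-cong s-inverse ⟩
      1# ‾                     ≈⟨ 1^ q ⟩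
      1#                       ≈⟨ s-inverse ⟨
      (y ‾ + y) * s            ∎)
    z‾+z≈1 : z ‾ + z ≈ 1#
    z‾+z≈1 = trans (+-congʳ (trans (‾-* y s) (*-congˡ s‾≈s))) (trans (sym (distribʳ s _ _)) s-inverse)
    u‾≈u : u ‾ ≈ u
    u‾≈u = trans (trans (‾-+ (z * z) z) (+-congʳ (‾-* z z))) (linear-combination
      (solve 2 (λ z z' → z' :* z' :+ z' :+ (z :* z :+ z) := (z' :+ z) :* (z' :+ z :+ :1)) z (z ‾)) ((z ‾ + z) · z‾+z≈1))
    trace-u : trace k u ≈ 1#
    trace-u = trans (trace-x²+x k z) z‾+z≈1

  ω = proj₁ ω-exists
  ω²≈ω+1 = proj₂ ω-exists

  -- ω generates the field with four elements, on which Q, an odd power of 2, acts as squaring; and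
  -- ω³ = 1.
  ωᵠω≈1 : ω ᵠ * ω ≈ 1#
  ωᵠω≈1 = trans (*-congʳ (ω^2^odd j)) (trans (solve 1 (λ w → (w :+ :1) :* w := w :* w :+ w) ω)
                (trans (+-congʳ ω²≈ω+1) (solve 1 (λ w → w :+ :1 :+ w := :1) ω)))
    where
    ω^2^odd : ∀ j → ω ^ (2 ℕ.^ suc (j ℕ.* 2)) ≈ ω + 1#
    ω^2^odd zero    = trans (*-congˡ (*-identityʳ ω)) ω²≈ω+1
    ω^2^odd (suc j) = begin
      ω ^ (2 ℕ.* (2 ℕ.* n))     ≈⟨ ^-double ω (2 ℕ.* n) ⟩
      (ω * ω) ^ (2 ℕ.* n)       ≈⟨ ^-double (ω * ω) n ⟩
      (ω * ω * (ω * ω)) ^ n     ≈⟨ ^-congˡ n ω⁴≈ω ⟩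
      ω ^ n                     ≈⟨ ω^2^odd j ⟩
      ω + 1#                    ∎
      where
      n = 2 ℕ.^ suc (j ℕ.* 2)
      ω⁴≈ω : ω * ω * (ω * ω) ≈ ω
      ω⁴≈ω = linear-combination (solve 1 (λ w → w :* w :* (w :* w) :+ w := (w :* w :+ w) :* (w :* w :+ (w :+ :1))) ω)
        ((ω * ω + ω) · ω²≈ω+1)

  ω≉1 : ¬ ω ≈ 1#
  ω≉1 ω≈1 = 1≉0 (begin
    1#          ≈⟨ *-identityʳ 1# ⟨
    1# * 1#     ≈⟨ *-cong ω≈1 ω≈1 ⟨
    ω * ω       ≈⟨ ω²≈ω+1 ⟩
    ω + 1#      ≈⟨ ≈⇒+≈0 ω≈1 ⟩
    0#          ∎)

  -- The trace of u is idempotent, hence 0 or 1. The half trace of u solves the equation up to the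
  -- trace, and adding `ω`, which solves z² + z = 1, removes a trace of 1.
  artin-schreier : ∀ u → u ‾ ≈ u → ∃[ z ] z * z + z ≈ u
  artin-schreier u u‾≈u = [ trace-0 , trace-1 ]′ (idempotent (begin
    trace k u * trace k u        ≈⟨ trace-² k u ⟨
    trace k (u * u)              ≈⟨ +≈0⇒≈ (trans (sym (trace-+ k (u * u) u)) (trans (trace-x²+x k u) (≈⇒+≈0 u‾≈u))) ⟩
    trace k u                    ∎))
    where
    h = halfTrace i u
    trace-0 : trace k u ≈ 0# → ∃[ z ] z * z + z ≈ u
    trace-0 t≈0 = h , trans (halfTrace-²+ i u) (trans (+-cong t≈0 u‾≈u) (+-identityˡ u))
    trace-1 : trace k u ≈ 1# → ∃[ z ] z * z + z ≈ u
    trace-1 t≈1 = h + ω , linear-combination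
      (solve 3 (λ h w u → (h :+ w) :* (h :+ w) :+ (h :+ w) :+ u := (h :* h :+ h :+ (:1 :+ u)) :+ (w :* w :+ (w :+ :1))) h ω u)
      (≈⇒+≈0 (trans (halfTrace-²+ i u) (+-cong t≈1 u‾≈u)) ⊞ ≈⇒+≈0 ω²≈ω+1)

  -- Power sums of w^(q-1) and Hermite's criterion.

  open Mult semiring using () renaming (_×_ to _×ₙ_)

  private
    D p : ℕ
    D = suc q
    p = ℕ.pred q

    instance
      q-nonZero : ℕ.NonZero q
      q-nonZero = ℕ.>-nonZero (ℕ.m^n>0 2 k)

    1+p≡q : suc p ≡ q
    1+p≡q = ℕ.suc-pred q

    2≤q : 2 ℕ.≤ q
    2≤q = ℕ.*-monoʳ-≤ 2 (ℕ.m^n>0 2 (i ℕ.* 2))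

    1≤p : 1 ℕ.≤ p
    1≤p = ℕ.s≤s⁻¹ (≡.subst (2 ℕ.≤_) (≡.sym 1+p≡q) 2≤q)

    Q^k≡q^ℓ : Q ℕ.^ k ≡ q ℕ.^ ℓ
    Q^k≡q^ℓ = ≡.trans (ℕ.^-*-assoc 2 ℓ k) (≡.trans (≡.cong (2 ℕ.^_) (ℕ.*-comm ℓ k)) (≡.sym (ℕ.^-*-assoc 2 k ℓ)))

    D∣1+Q^k : D ∣ 1 ℕ.+ Q ℕ.^ k
    D∣1+Q^k = ≡.subst₂ _∣_ (ℕ.+-comm q 1) (≡.trans (ℕ.+-comm _ 1) (≡.cong suc (≡.sym Q^k≡q^ℓ))) (x+1∣x^odd+1 q j)

    D∤1 : ¬ D ∣ 1
    D∤1 D∣1 = ℕ.<⇒≱ (ℕ.s≤s (ℕ.m^n>0 2 k)) (∣⇒≤ D∣1)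

    -- Since Q^k = q^ℓ is -1 modulo D = q + 1, the solution of 1 + Q r = 0 modulo D is r = Q^(k-1).
    -- Its residue is nonzero because D does not divide 1, hence of the form `suc n` with n < q.
    exponent-exists : ∃[ n ] n ℕ.< q × D ∣ 1 ℕ.+ Q ℕ.* suc n
    exponent-exists = go (I % D) (m%n<n I D) D∣1+Qr
      where
      I = Q ℕ.^ (i ℕ.* 2)
      D∣1+Qr : D ∣ 1 ℕ.+ Q ℕ.* (I % D)
      D∣1+Qr = ∣m+n∣m⇒∣n
        (≡.subst (D ∣_) (≡.trans (≡.cong (λ x → 1 ℕ.+ Q ℕ.* x) (m≡m%n+[m/n]*n I D)) (identity Q (I % D) (I / D) D)) D∣1+Q^k)
        (∣n⇒∣m*n (Q ℕ.* (I / D)) ∣-refl)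
        where
        identity : ∀ a b c d → 1 ℕ.+ a ℕ.* (b ℕ.+ c ℕ.* d) ≡ a ℕ.* c ℕ.* d ℕ.+ (1 ℕ.+ a ℕ.* b)
        identity = solve-∀
      go : ∀ r → r ℕ.< D → D ∣ 1 ℕ.+ Q ℕ.* r → ∃[ n ] n ℕ.< q × D ∣ 1 ℕ.+ Q ℕ.* suc n
      go zero    _   D∣ = contradiction (≡.subst (D ∣_) (≡.cong suc (ℕ.*-zeroʳ Q)) D∣) D∤1
      go (suc n) n<q D∣ = n , ℕ.s≤s⁻¹ n<q , D∣

    n₀ = proj₁ exponent-exists
    n₀<q = proj₁ (proj₂ exponent-exists)
    D∣n₀ = proj₂ (proj₂ exponent-exists)

    -- D divides Q d for the difference d. As (1 + Q^k) d = Q^(k-1) Q d + d, it divides d as well,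
    -- and d < D.
    exponent-≤ : ∀ {m n} → n ℕ.< q → D ∣ 1 ℕ.+ Q ℕ.* suc m → D ∣ 1 ℕ.+ Q ℕ.* suc n → m ℕ.≤ n → m ≡ n
    exponent-≤ {m} n<q D∣m D∣n m≤n with ℕ.m≤n⇒∃[o]m+o≡n m≤n
    ... | d , ≡.refl = go d n<q (∣m+n∣m⇒∣n
            (≡.subst (D ∣_) (identity (Q ℕ.^ (i ℕ.* 2)) d) (∣m⇒∣m*n d D∣1+Q^k))
            (∣n⇒∣m*n (Q ℕ.^ (i ℕ.* 2)) (∣m+n∣m⇒∣n (≡.subst (D ∣_) (identity′ Q m d) D∣n) D∣m)))
      where
      identity : ∀ a d → (1 ℕ.+ Q ℕ.* a) ℕ.* d ≡ a ℕ.* (Q ℕ.* d) ℕ.+ d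
      identity a d = lemma Q a d
        where
        lemma : ∀ b a d → (1 ℕ.+ b ℕ.* a) ℕ.* d ≡ a ℕ.* (b ℕ.* d) ℕ.+ d
        lemma = solve-∀
      identity′ : ∀ b m d → 1 ℕ.+ b ℕ.* suc (m ℕ.+ d) ≡ (1 ℕ.+ b ℕ.* suc m) ℕ.+ b ℕ.* d
      identity′ = solve-∀
      go : ∀ d → m ℕ.+ d ℕ.< q → D ∣ d → m ≡ m ℕ.+ d
      go zero    _   _   = ≡.sym (ℕ.+-identityʳ m)
      go (suc d) <q D∣d = contradiction (∣⇒≤ D∣d) (ℕ.<⇒≱ (ℕ.m<n⇒m<1+n (ℕ.≤-<-trans (ℕ.m≤n+m (suc d) m) <q)))

    exponent-unique : ∀ {n} → n ℕ.< q → D ∣ 1 ℕ.+ Q ℕ.* suc n → n ≡ n₀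
    exponent-unique {n} n<q D∣n = [ exponent-≤ n₀<q D∣n D∣n₀ , ≡.sym ∘ exponent-≤ n<q D∣n₀ D∣n ]′ (ℕ.≤-total n n₀)

    -- w^(q-1), which for w ≠ 0 is w ‾ / w, a root of unity of order dividing D = q + 1.
    v : Carrier → Carrier
    v w = w ^ p

    w*v≈w‾ : ∀ w → w * v w ≈ w ‾
    w*v≈w‾ w = ^-congʳ w 1+p≡q

    v-0 : ∀ {w} → w ≈ 0# → v w ≈ 0#
    v-0 w≈0 = trans (^-congˡ p w≈0) (0^ p 1≤p)

    v^D≈1 : ∀ {w} → ¬ w ≈ 0# → v w ^ D ≈ 1#
    v^D≈1 {w} w≉0 = *-cancelˡ-nonzero _ _ w≉0 (begin
      w * (v w * v w ‾)      ≈⟨ *-assoc _ _ _ ⟨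
      w * v w * v w ‾        ≈⟨ *-congʳ (w*v≈w‾ w) ⟩
      w ‾ * v w ‾            ≈⟨ ‾-* w (v w) ⟨
      (w * v w) ‾            ≈⟨ ‾-cong (w*v≈w‾ w) ⟩
      w ‾ ‾                  ≈⟨ ‾‾ w ⟩
      w                      ≈⟨ *-identityʳ w ⟨
      w * 1#                 ∎)

    -- The terms are 1 except at w = 0. Adding N × 1 = 0, that is 1 to each term, leaves only the
    -- term at 0.
    v-power-sum-1 : ∀ M → 1 ℕ.≤ M → D ∣ M → total (λ w → v w ^ M) ≈ 1#
    v-power-sum-1 M 1≤M (divides r M≡rD) = begin
      total (λ w → v w ^ M)                          ≈⟨ +-identityʳ _ ⟨
      total (λ w → v w ^ M) + 0#                     ≈⟨ +-congˡ characteristic ⟨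
      total (λ w → v w ^ M) + N ×ₙ 1#                ≈⟨ +-congˡ (total-const 1#) ⟨
      total (λ w → v w ^ M) + total (λ _ → 1#)       ≈⟨ total-∙ (λ w → v w ^ M) (λ _ → 1#) ⟨
      total (λ w → v w ^ M + 1#)                     ≈⟨ total-single (λ eq → +-congʳ (^-congˡ M (^-congˡ p eq))) 0#
                                                          (λ w w≉0 → ≈⇒+≈0 (v^M≈1 w w≉0)) ⟩
      v 0# ^ M + 1#                                  ≈⟨ +-congʳ (trans (^-congˡ M (v-0 refl)) (0^ M 1≤M)) ⟩
      0# + 1#                                        ≈⟨ +-identityˡ 1# ⟩
      1#                                             ∎
      where
      v^M≈1 : ∀ w → ¬ w ≈ 0# → v w ^ M ≈ 1#
      v^M≈1 w w≉0 = begin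
        v w ^ M            ≡⟨ ≡.cong (v w ^_) (≡.trans M≡rD (ℕ.*-comm r D)) ⟩
        v w ^ (D ℕ.* r)    ≈⟨ ^-assocʳ (v w) D r ⟨
        (v w ^ D) ^ r      ≈⟨ ^-congˡ r (v^D≈1 w≉0) ⟩
        1# ^ r             ≈⟨ 1^ r ⟩
        1#                 ∎

    -- The exponent M can be reduced to its residue r modulo D, with 1 ≤ r ≤ q; the exponent (q - 1)
    -- r of w is then at most q² - q, below N - 1.
    v-power-sum-0 : ∀ M → 1 ℕ.≤ M → ¬ D ∣ M → total (λ w → v w ^ M) ≈ 0#
    v-power-sum-0 M 1≤M D∤M = begin
      total (λ w → v w ^ M)          ≈⟨ total-cong (λ w → reduce w (w ≟ 0#)) ⟩
      total (_^ (p ℕ.* r))           ≈⟨ power-sum (p ℕ.* r) (ℕ.*-mono-≤ 1≤p 1≤r) bound ⟩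
      0#                             ∎
      where
      r = M % D
      1≤r : 1 ℕ.≤ r
      1≤r = ℕ.n≢0⇒n>0 (D∤M ∘ m%n≡0⇒n∣m M D)
      bound : suc (p ℕ.* r) ℕ.< N
      bound = ≡.subst (suc (p ℕ.* r) ℕ.<_) (≡.trans (≡.cong (ℕ._* q) 1+p≡q) q*q≡N)
        (ℕ.+-mono-≤ 2≤q (ℕ.*-monoʳ-≤ p (ℕ.s≤s⁻¹ (m%n<n M D))))
      reduce : ∀ w → Dec (w ≈ 0#) → v w ^ M ≈ w ^ (p ℕ.* r)
      reduce w (yes w≈0) = trans (trans (^-congˡ M (v-0 w≈0)) (0^ M 1≤M))
        (sym (trans (sym (^-assocʳ w p r)) (trans (^-congˡ r (v-0 w≈0)) (0^ r 1≤r))))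
      reduce w (no w≉0) = begin
        v w ^ M                             ≡⟨ ≡.cong (v w ^_) (≡.trans (m≡m%n+[m/n]*n M D) (≡.cong (r ℕ.+_) (ℕ.*-comm (M / D) D))) ⟩
        v w ^ (r ℕ.+ D ℕ.* (M / D))         ≈⟨ ^-homo-* (v w) r (D ℕ.* (M / D)) ⟩
        v w ^ r * v w ^ (D ℕ.* (M / D))     ≈⟨ *-congˡ (^-assocʳ (v w) D (M / D)) ⟨
        v w ^ r * (v w ^ D) ^ (M / D)       ≈⟨ *-congˡ (trans (^-congˡ (M / D) (v^D≈1 w≉0)) (1^ (M / D))) ⟩
        v w ^ r * 1#                        ≈⟨ *-identityʳ _ ⟩
        v w ^ r                             ≈⟨ ^-assocʳ w p r ⟩
        w ^ (p ℕ.* r)                       ∎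

  -- The quotient (x^n + y^n) / (x + y). For n = q it is (x + y)^(q-1) expanded: in characteristic
  -- two every binomial coefficient of q - 1 is 1.
  geometric : ℕ → Carrier → Carrier → Carrier
  geometric zero    x y = 0#
  geometric (suc n) x y = y ^ n + x * geometric n x y

  geometric-* : ∀ n x y → (x + y) * geometric n x y ≈ x ^ n + y ^ n
  geometric-* zero    x y = trans (zeroʳ _) (sym 1+1≈0)
  geometric-* (suc n) x y = linear-combination
    (solve 5 (λ x y xⁿ yⁿ g → (x :+ y) :* (yⁿ :+ x :* g) :+ (x :* xⁿ :+ y :* yⁿ) := x :* ((x :+ y) :* g :+ (xⁿ :+ yⁿ)))
      x y (x ^ n) (y ^ n) (geometric n x y))
    (x · geometric-* n x y)

  -- Hermite's criterion with exponent q - 1: of the terms of the expanded power,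
  -- all but one have vanishing sum over the field.
  module _ (s t : Carrier) (s≉0 : ¬ s ≈ 0#) (t≉0 : ¬ t ≈ 0#) where
    private
      G : Carrier → Carrier
      G w = (s * w ᵠ + t * w ‾ ᵠ) * w

      V : Carrier → Carrier
      V w = v w ᵠ

      -- `S q` is the sum of all G w ^ (q - 1). Unfolding `geometric` makes it a combination of the
      -- `E n` with n < q and coefficients s^(q-1-n) t^n, of which only the one at `n₀` survives.
      S E : ℕ → Carrier
      S n = total (λ w → v w * V w * geometric n s (t * V w))
      E n = total (λ w → v w ^ (1 ℕ.+ Q ℕ.* suc n))

      S-zero : S 0 ≈ 0#
      S-zero = trans (total-cong (λ w → trans (zeroʳ (v w * V w)) (sym (zeroˡ 1#)))) (trans (total-*ˡ 0# (λ _ → 1#)) (zeroˡ _))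

      S-suc : ∀ n → S (suc n) ≈ t ^ n * E n + s * S n
      S-suc n = begin
        S (suc n)                                                    ≈⟨ total-cong pointwise ⟩
        total (λ w → t ^ n * g w + s * h w)                          ≈⟨ total-∙ (λ w → t ^ n * g w) (λ w → s * h w) ⟩
        total (λ w → t ^ n * g w) + total (λ w → s * h w)            ≈⟨ +-cong (total-*ˡ (t ^ n) g) (total-*ˡ s h) ⟩
        t ^ n * E n + s * S n                                        ∎
        where
        g h : Carrier → Carrier
        g w = v w ^ (1 ℕ.+ Q ℕ.* suc n)
        h w = v w * V w * geometric n s (t * V w)
        pointwise : ∀ w → v w * V w * geometric (suc n) s (t * V w) ≈ t ^ n * g w + s * h w
        pointwise w = trans (*-congˡ (+-congʳ (^-distrib-* t (V w) n)))
          (trans (solve 6 (λ v V Vⁿ tⁿ s g → v :* V :* (tⁿ :* Vⁿ :+ s :* g) := tⁿ :* (v :* (V :* Vⁿ)) :+ s :* (v :* V :* g))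
                    (v w) (V w) (V w ^ n) (t ^ n) s (geometric n s (t * V w)))
                 (+-congʳ (*-congˡ (*-congˡ (^-assocʳ (v w) Q (suc n))))))

      E-1 : E n₀ ≈ 1#
      E-1 = v-power-sum-1 (1 ℕ.+ Q ℕ.* suc n₀) (ℕ.s≤s ℕ.z≤n) D∣n₀

      E-0 : ∀ {n} → n ℕ.< q → n ≢ n₀ → E n ≈ 0#
      E-0 {n} n<q n≢n₀ = v-power-sum-0 (1 ℕ.+ Q ℕ.* suc n) (ℕ.s≤s ℕ.z≤n) (n≢n₀ ∘ exponent-unique n<q)

      S-suc-0 : ∀ {n} → n ℕ.< q → n ≢ n₀ → S (suc n) ≈ s * S n
      S-suc-0 {n} n<q n≢n₀ = trans (S-suc n) (trans (+-congʳ (trans (*-congˡ (E-0 n<q n≢n₀)) (zeroʳ _))) (+-identityˡ _))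

      S-below : ∀ n → n ℕ.≤ n₀ → S n ≈ 0#
      S-below zero    _    = S-zero
      S-below (suc n) n<n₀ = trans (S-suc-0 (ℕ.<-trans n<n₀ n₀<q) (ℕ.<⇒≢ n<n₀))
                                   (trans (*-congˡ (S-below n (ℕ.<⇒≤ n<n₀))) (zeroʳ s))

      S-above : ∀ m → m ℕ.+ suc n₀ ℕ.≤ q → ¬ S (m ℕ.+ suc n₀) ≈ 0#
      S-above zero    _  S≈0 = ^-nonzero n₀ t≉0 (begin
        t ^ n₀                       ≈⟨ solve 2 (λ x s → x := x :* :1 :+ s :* :0) (t ^ n₀) s ⟩
        t ^ n₀ * 1# + s * 0#         ≈⟨ +-cong (*-congˡ E-1) (*-congˡ (S-below n₀ ℕ.≤-refl)) ⟨
        t ^ n₀ * E n₀ + s * S n₀     ≈⟨ S-suc n₀ ⟨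
        S (suc n₀)                   ≈⟨ S≈0 ⟩
        0#                           ∎)
      S-above (suc m) ≤q S≈0 = *-nonzero s≉0 (S-above m (ℕ.<⇒≤ ≤q))
        (trans (sym (S-suc-0 ≤q (ℕ.>⇒≢ (ℕ.m≤n+m (suc n₀) m)))) S≈0)

      S-q≉0 : ¬ S q ≈ 0#
      S-q≉0 = ≡.subst (λ n → ¬ S n ≈ 0#) (ℕ.m∸n+n≡m n₀<q) (S-above (q ℕ.∸ suc n₀) (ℕ.≤-reflexive (ℕ.m∸n+n≡m n₀<q)))

    hermite : ¬ Injective _≈_ _≈_ G
    hermite G-injective = S-q≉0 (begin
      S q                         ≈⟨ total-cong (λ w → G^p w (w ≟ 0#)) ⟨
      total (λ w → G w ^ p)       ≈⟨ total-injective (^-congˡ p)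
                                       (λ eq → *-cong (+-cong (*-congˡ (ᵠ-cong eq)) (*-congˡ (ᵠ-cong (‾-cong eq)))) eq) G-injective ⟨
      total (_^ p)                ≈⟨ power-sum p 1≤p (≡.subst₂ ℕ._<_ (≡.sym 1+p≡q) q*q≡N (ℕ.m<m*n q q 2≤q)) ⟩
      0#                          ∎)
      where
      G^p : ∀ w → Dec (w ≈ 0#) → G w ^ p ≈ v w * V w * geometric q s (t * V w)
      G^p w (yes w≈0) = trans (trans (^-congˡ p (trans (*-congˡ w≈0) (zeroʳ _))) (0^ p 1≤p))
        (sym (trans (*-congʳ (trans (*-congʳ (v-0 w≈0)) (zeroˡ _))) (zeroˡ _)))
      G^p w (no w≉0) = begin
        G w ^ p                                 ≈⟨ ^-congˡ p Gw≈ ⟩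
        (w * w ᵠ * (s + t * V w)) ^ p           ≈⟨ trans (^-distrib-* _ _ p) (*-congʳ (^-distrib-* _ _ p)) ⟩
        v w * (w ᵠ) ^ p * (s + t * V w) ^ p     ≈⟨ *-cong (*-congˡ (^-comm w Q p)) power ⟩
        v w * V w * geometric q s (t * V w)     ∎
        where
        Gw≈ : G w ≈ w * w ᵠ * (s + t * V w)
        Gw≈ = trans (*-congʳ (+-congˡ (*-congˡ (trans (ᵠ-cong (sym (w*v≈w‾ w))) (ᵠ-* w (v w))))))
          (solve 5 (λ s t w W V → (s :* W :+ t :* (W :* V)) :* w := w :* W :* (s :+ t :* V)) s t w (w ᵠ) (V w))
        -- Injectivity permits the division: if this factor vanished, G w would equal G 0.
        s+tV≉0 : ¬ s + t * V w ≈ 0#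
        s+tV≉0 eq = w≉0 (G-injective (trans Gw≈ (trans (*-congˡ eq) (trans (zeroʳ _) (sym (zeroʳ _))))))
        power : (s + t * V w) ^ p ≈ geometric q s (t * V w)
        power = *-cancelˡ-nonzero _ _ s+tV≉0 (begin
          (s + t * V w) * (s + t * V w) ^ p             ≡⟨ ≡.cong ((s + t * V w) ^_) 1+p≡q ⟩
          (s + t * V w) ‾                               ≈⟨ ‾-+ s (t * V w) ⟩
          s ‾ + (t * V w) ‾                             ≈⟨ geometric-* q s (t * V w) ⟨
          (s + t * V w) * geometric q s (t * V w)       ∎)

  -- `hermite` excludes s and t both nonzero. If t = 0 the map is s w^(Q+1), which takes the same
  -- value at `ω` and at 1.
  twisted-form-injective : ∀ s t → Injective _≈_ _≈_ (λ w → (s * w ᵠ + t * w ‾ ᵠ) * w) → s ≈ 0#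
  twisted-form-injective s t G-injective = decidable-stable (s ≟ 0#) λ s≉0 →
    hermite s t s≉0 (λ t≈0 → ω≉1 (G-injective (trans (G-straight t≈0 ω ωᵠω≈1)
      (sym (G-straight t≈0 1# (trans (*-identityʳ _) (1^ Q))))))) G-injective
    where
    G-straight : t ≈ 0# → ∀ w → w ᵠ * w ≈ 1# → (s * w ᵠ + t * w ‾ ᵠ) * w ≈ s
    G-straight t≈0 w wᵠw≈1 = linear-combination
      (solve 5 (λ s t w W W' → (s :* W :+ t :* W') :* w :+ s := s :* (W :* w :+ :1) :+ W' :* w :* (t :+ :0)) s t w (w ᵠ) (w ‾ ᵠ))
      (s · wᵠw≈1 ⊞ (w ‾ ᵠ * w) · t≈0)

-- The map f, its tensor, and the case e = 0.

module Quadrinomial {r₁ r₂} (R : CommutativeRing r₁ r₂) (i j : ℕ)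
                    (isFiniteField : IsFiniteField R (2 ℕ.^ (suc (i ℕ.* 2) ℕ.* 2)))
                    (a b c d : CommutativeRing.Carrier R) where

  open CommutativeRing R hiding (zero)
  open QuadraticExtension R i j isFiniteField
  open Exp commutativeSemiring
  open SetoidReasoning setoid

  -- Three binary quadratic forms, the determinants of the slices of the tensor, share the middle
  -- coefficient e: B(· , x) gives γ x² + e x x ‾ + γ′ x ‾ ², B(u , ·) gives δ u² + e u u ‾ + δ′ u ‾
  -- ², and p B + p′ B ‾ gives θ p² + e p p′ + θ′ p′². Condition (2) says that the Q-th power twist
  -- of the first is proportional to the second.
  a′ b′ c′ d′ e γ γ′ δ δ′ n θ θ′ : Carrier
  a′ = a ‾
  b′ = b ‾
  c′ = c ‾
  d′ = d ‾
  e  = a * a′ + b * b′ + c * c′ + d * d′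
  γ  = a′ * b + c′ * d
  γ′ = a * b′ + c * d′
  δ  = a′ * c + b′ * d
  δ′ = a * c′ + b * d′
  n  = b * b′ + c * c′
  θ  = a * d + b * c
  θ′ = a′ * d′ + b′ * c′

  ‾-+* : ∀ x y z w → (x * y + z * w) ‾ ≈ x ‾ * y ‾ + z ‾ * w ‾
  ‾-+* x y z w = trans (‾-+ _ _) (+-cong (‾-* x y) (‾-* z w))

  ᵠ-+* : ∀ x y z w → (x * y + z * w) ᵠ ≈ x ᵠ * y ᵠ + z ᵠ * w ᵠ
  ᵠ-+* x y z w = trans (ᵠ-+ _ _) (+-cong (ᵠ-* x y) (ᵠ-* z w))

  norm‾ : ∀ x → (x * x ‾) ‾ ≈ x * x ‾
  norm‾ x = trans (‾-* x (x ‾)) (trans (*-congˡ (‾‾ x)) (*-comm _ _))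

  e‾ : e ‾ ≈ e
  e‾ = trans (‾-+ _ _) (+-cong (trans (‾-+ _ _) (+-cong (trans (‾-+ _ _) (+-cong (norm‾ a) (norm‾ b))) (norm‾ c))) (norm‾ d))

  γ‾ : γ ‾ ≈ γ′
  γ‾ = trans (‾-+* a′ b c′ d) (+-cong (*-congʳ (‾‾ a)) (*-congʳ (‾‾ c)))

  δ‾ : δ ‾ ≈ δ′
  δ‾ = trans (‾-+* a′ c b′ d) (+-cong (*-congʳ (‾‾ a)) (*-congʳ (‾‾ b)))

  θ‾ : θ ‾ ≈ θ′
  θ‾ = ‾-+* a d b c

  θ′‾ : θ′ ‾ ≈ θ
  θ′‾ = trans (‾-cong (sym θ‾)) (‾‾ θ)

  f : Carrier → Carrier
  f x = a * (x ‾ ᵠ * x ‾) + b * (x ‾ ᵠ * x) + c * (x ᵠ * x ‾) + d * (x ᵠ * x)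

  f-cong : ∀ {x y} → x ≈ y → f x ≈ f y
  f-cong eq = +-cong (+-cong (+-cong
    (*-congˡ (*-cong (ᵠ-cong (‾-cong eq)) (‾-cong eq)))
    (*-congˡ (*-cong (ᵠ-cong (‾-cong eq)) eq)))
    (*-congˡ (*-cong (ᵠ-cong eq) (‾-cong eq))))
    (*-congˡ (*-cong (ᵠ-cong eq) eq))

  f‾ : ∀ x → f x ‾ ≈ a′ * (x ᵠ * x) + b′ * (x ᵠ * x ‾) + c′ * (x ‾ ᵠ * x) + d′ * (x ‾ ᵠ * x ‾)
  f‾ x = trans (‾-+ _ _) (+-cong (trans (‾-+ _ _) (+-cong (trans (‾-+ _ _) (+-cong
    (trans (‾-* a _) (*-congˡ (trans (‾-* _ _) (*-cong X′‾ (‾‾ x)))))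
    (trans (‾-* b _) (*-congˡ (trans (‾-* _ _) (*-congʳ X′‾))))))
    (trans (‾-* c _) (*-congˡ (trans (‾-* _ _) (*-cong (ᵠ‾ x) (‾‾ x)))))))
    (trans (‾-* d _) (*-congˡ (trans (‾-* _ _) (*-congʳ (ᵠ‾ x))))))
    where
    X′‾ : x ‾ ᵠ ‾ ≈ x ᵠ
    X′‾ = trans (ᵠ‾ (x ‾)) (ᵠ-cong (‾‾ x))

  f-homogeneous : ∀ w x → w ‾ ≈ w → f (w * x) ≈ w ᵠ * w * f x
  f-homogeneous w x w‾≈w = trans
    (+-cong (+-cong (+-cong
      (*-congˡ (*-cong X′ x′))
      (*-congˡ (*-congʳ X′)))
      (*-congˡ (*-cong (ᵠ-* w x) x′)))
      (*-congˡ (*-congʳ (ᵠ-* w x))))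
    (solve 10 (λ a b c d w W x x' X X' → a :* (W :* X' :* (w :* x')) :+ b :* (W :* X' :* (w :* x)) :+ c :* (W :* X :* (w :* x')) :+ d :* (W :* X :* (w :* x))
       := W :* w :* (a :* (X' :* x') :+ b :* (X' :* x) :+ c :* (X :* x') :+ d :* (X :* x))) a b c d w (w ᵠ) x (x ‾) (x ᵠ) (x ‾ ᵠ))
    where
    x′ : (w * x) ‾ ≈ w * x ‾
    x′ = trans (‾-* w x) (*-congʳ w‾≈w)
    X′ : (w * x) ‾ ᵠ ≈ w ᵠ * x ‾ ᵠ
    X′ = trans (ᵠ-cong x′) (ᵠ-* w (x ‾))

  f-0 : f 0# ≈ 0#
  f-0 = trans (f-cong (sym (zeroˡ 0#))) (trans (f-homogeneous 0# 0# 0‾) (trans (*-congʳ (zeroʳ _)) (zeroˡ _)))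

  f-nonzero : Injective _≈_ _≈_ f → ∀ {x} → ¬ x ≈ 0# → ¬ f x ≈ 0#
  f-nonzero f-injective x≉0 fx≈0 = x≉0 (f-injective (trans fx≈0 (sym f-0)))

  -- By homogeneity f (u y) = u^(Q+1) f y for u in 𝔽_q, and every element of 𝔽_q is such a power; so
  -- f maps the line of y onto the line of f y, and by injectivity nothing else goes there.
  f-reflects-parallel : Injective _≈_ _≈_ f → ∀ x {y} → ¬ y ≈ 0# → f x * f y ‾ ≈ f x ‾ * f y → x * y ‾ ≈ x ‾ * y
  f-reflects-parallel f-injective x {y} y≉0 parallel =
    let w , w‾≈w , fx≈wfy = parallel⇒ratio (f x) (f-nonzero f-injective y≉0) parallel
        u , u‾≈u , uᵠu≈w = xᵠx-root w w‾≈w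
        x≈uy = f-injective (trans fx≈wfy (sym (trans (f-homogeneous u y u‾≈u) (*-congʳ uᵠu≈w))))
    in begin
      x * y ‾        ≈⟨ *-congʳ x≈uy ⟩
      u * y * y ‾    ≈⟨ solve 3 (λ u y y' → u :* y :* y' := u :* y' :* y) u y (y ‾) ⟩
      u * y ‾ * y    ≈⟨ *-congʳ (*-congʳ u‾≈u) ⟨
      u ‾ * y ‾ * y  ≈⟨ *-congʳ (‾-* u y) ⟨
      (u * y) ‾ * y  ≈⟨ *-congʳ (‾-cong x≈uy) ⟨
      x ‾ * y        ∎

  -- If e = 0, the quadratic form u ↦ det B(u , ·) is a square, hence has a zero u = y ᵠ;
  -- a vector z in the kernel of B(u , ·) then has f z parallel to f y.
  f-injective⇒e≉0 : Injective _≈_ _≈_ f → ¬ e ≈ 0#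
  f-injective⇒e≉0 f-injective e≈0 = no-zero (isotropic (√ δ′))
    where
    -- For u = √δ′ the two terms are both δ δ′. If δ′ = 0 the form is identically zero and 1 serves
    -- as the nonzero vector.
    isotropic : ∃[ u ] u * u ≈ δ′ → ∃[ u ] ¬ u ≈ 0# × δ * (u * u) + δ′ * (u ‾ * u ‾) ≈ 0#
    isotropic (u , u²≈δ′) with u ≟ 0#
    ... | no u≉0 = u , u≉0 , linear-combination
      (solve 4 (λ d d' s s' → d :* s :+ d' :* s' :+ :0 := d :* (s :+ d') :+ d' :* (s' :+ d)) δ δ′ (u * u) (u ‾ * u ‾))
      (δ · u²≈δ′ ⊞ δ′ · trans (sym (‾-* u u)) (trans (‾-cong (trans u²≈δ′ (sym δ‾))) (‾‾ δ)))
    ... | yes u≈0 = 1# , 1≉0 , trans (+-cong (trans (*-congʳ δ≈0) (zeroˡ _)) (trans (*-congʳ δ′≈0) (zeroˡ _))) (+-identityˡ 0#)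
      where
      δ′≈0 : δ′ ≈ 0#
      δ′≈0 = trans (sym u²≈δ′) (trans (*-congʳ u≈0) (zeroˡ u))
      δ≈0 : δ ≈ 0#
      δ≈0 = trans (sym (‾‾ δ)) (trans (‾-cong (trans δ‾ δ′≈0)) 0‾)

    no-zero : ¬ (∃[ u ] ¬ u ≈ 0# × δ * (u * u) + δ′ * (u ‾ * u ‾) ≈ 0#)
    -- y turns out parallel to z, which B(u , ·) kills; hence f y = B(u , y) = 0 although y ≠ 0.
    no-zero (u , u≉0 , u-isotropic) = f-nonzero f-injective y≉0 (integral z≉0 (begin
        z * f y
          ≈⟨ *-congˡ fy ⟩
        z * (C * y ‾ + D * y)
          ≈⟨ linear-combination
               (solve 6 (λ C D z z' y y' → z :* (C :* y' :+ D :* y) :+ :0 := C :* (y :* z' :+ y' :* z) :+ y :* (D :* z :+ C :* z'))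
                 C D z (z ‾) y (y ‾))
               (C · y∥z ⊞ y · Dz≈Cz‾) ⟩
        0#
          ∎))
      where
      u′ = u ‾
      C = a * u′ + c * u
      D = b * u′ + d * u
      C‾ : C ‾ ≈ a′ * u + c′ * u′
      C‾ = trans (‾-+* a u′ c u) (+-congʳ (*-congˡ (‾‾ u)))
      D‾ : D ‾ ≈ b′ * u + d′ * u′
      D‾ = trans (‾-+* b u′ d u) (+-congʳ (*-congˡ (‾‾ u)))

      norms : C * C ‾ ≈ D * D ‾
      norms = trans (*-congˡ C‾) (trans (linear-combination
        (solve 10 (λ a b c d a' b' c' d' u u' →
            (a :* u' :+ c :* u) :* (a' :* u :+ c' :* u') :+ (b :* u' :+ d :* u) :* (b' :* u :+ d' :* u')
            := u :* u' :* (a :* a' :+ b :* b' :+ c :* c' :+ d :* d' :+ :0)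
               :+ :1 :* ((a' :* c :+ b' :* d) :* (u :* u) :+ (a :* c' :+ b :* d') :* (u' :* u') :+ :0))
          a b c d a′ b′ c′ d′ u u′)
        ((u * u′) · e≈0 ⊞ 1# · u-isotropic)) (*-congˡ (sym D‾)))

      kernel = equal-norms⇒kernel C D norms
      z = proj₁ kernel
      z≉0 = proj₁ (proj₂ kernel)
      Dz≈Cz‾ = proj₂ (proj₂ kernel)
      y = proj₁ (ᵠ√ u)
      yᵠ≈u = proj₂ (ᵠ√ u)
      y≉0 : ¬ y ≈ 0#
      y≉0 y≈0 = u≉0 (trans (sym yᵠ≈u) (trans (ᵠ-cong y≈0) 0ᵠ))

      y‾ᵠ≈u′ : y ‾ ᵠ ≈ u′
      y‾ᵠ≈u′ = trans (sym (ᵠ‾ y)) (‾-cong yᵠ≈u)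

      fy : f y ≈ C * y ‾ + D * y
      fy = trans (+-cong (+-cong (+-cong (*-congˡ (*-congʳ y‾ᵠ≈u′)) (*-congˡ (*-congʳ y‾ᵠ≈u′)))
          (*-congˡ (*-congʳ yᵠ≈u))) (*-congˡ (*-congʳ yᵠ≈u)))
        (solve 8 (λ a b c d u u' y y' → a :* (u' :* y') :+ b :* (u' :* y) :+ c :* (u :* y') :+ d :* (u :* y)
                    := (a :* u' :+ c :* u) :* y' :+ (b :* u' :+ d :* u) :* y) a b c d u u′ y (y ‾))

      fy‾ : f y ‾ ≈ (a′ * u + c′ * u′) * y + (b′ * u + d′ * u′) * y ‾
      fy‾ = trans (‾-cong fy) (trans (‾-+* C (y ‾) D y) (+-cong (*-cong C‾ (‾‾ y)) (*-congʳ D‾)))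

      Dz‾≈Cz : (b′ * u + d′ * u′) * z ‾ ≈ (a′ * u + c′ * u′) * z
      Dz‾≈Cz = trans (*-congʳ (sym D‾)) (trans (sym (‾-* D z)) (trans (‾-cong Dz≈Cz‾) (trans (‾-* C (z ‾)) (*-cong C‾ (‾‾ z)))))

      y∥z : y * z ‾ ≈ y ‾ * z
      y∥z = f-reflects-parallel f-injective y z≉0 (trans (*-cong fy (f‾ z)) (trans (linear-combination
        (solve 16 (λ a b c d a' b' c' d' u u' y y' z z' Z Z' →
             ((a :* u' :+ c :* u) :* y' :+ (b :* u' :+ d :* u) :* y)
               :* (a' :* (Z :* z) :+ b' :* (Z :* z') :+ c' :* (Z' :* z) :+ d' :* (Z' :* z'))
             :+ ((a' :* u :+ c' :* u') :* y :+ (b' :* u :+ d' :* u') :* y')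
               :* (a :* (Z' :* z') :+ b :* (Z' :* z) :+ c :* (Z :* z') :+ d :* (Z :* z))
             := (u :* Z' :+ u' :* Z) :* (y :* z' :+ y' :* z) :* (a :* a' :+ b :* b' :+ c :* c' :+ d :* d' :+ :0)
             :+ (a' :* (Z :* y) :+ b' :* (Z :* y') :+ c' :* (Z' :* y) :+ d' :* (Z' :* y'))
                   :* ((b :* u' :+ d :* u) :* z :+ (a :* u' :+ c :* u) :* z')
             :+ (a :* (Z' :* y') :+ b :* (Z' :* y) :+ c :* (Z :* y') :+ d :* (Z :* y))
                   :* ((b' :* u :+ d' :* u') :* z' :+ (a' :* u :+ c' :* u') :* z))
          a b c d a′ b′ c′ d′ u u′ y (y ‾) z (z ‾) (z ᵠ) (z ‾ ᵠ))
        (((u * z ‾ ᵠ + u′ * z ᵠ) * (y * z ‾ + y ‾ * z)) · e≈0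
          ⊞ (a′ * (z ᵠ * y) + b′ * (z ᵠ * y ‾) + c′ * (z ‾ ᵠ * y) + d′ * (z ‾ ᵠ * y ‾)) · Dz≈Cz‾
          ⊞ (a * (z ‾ ᵠ * y ‾) + b * (z ‾ ᵠ * y) + c * (z ᵠ * y ‾) + d * (z ᵠ * y)) · Dz‾≈Cz))
        (*-congʳ (sym fy‾))))

  -- x + x^Q is `trace ℓ (x * x + x)`. Squaring passes through `trace ℓ`, so the outer trace
  -- telescopes to conjugate plus identity at `trace ℓ x`.
  trace-x+xᵠ : ∀ x → trace k (x + x ᵠ) ≈ trace ℓ (x ‾ + x)
  trace-x+xᵠ x = begin
    trace k (x + x ᵠ)                                  ≈⟨ trace-cong k (trans (+-comm x (x ᵠ)) (sym (trace-x²+x ℓ x))) ⟩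
    trace k (trace ℓ (x * x + x))                      ≈⟨ trace-cong k (trans (trace-+ ℓ (x * x) x) (+-congʳ (trace-² ℓ x))) ⟩
    trace k (trace ℓ x * trace ℓ x + trace ℓ x)        ≈⟨ trace-x²+x k (trace ℓ x) ⟩
    trace ℓ x ‾ + trace ℓ x                            ≈⟨ +-congʳ (trace-^2^ ℓ k x) ⟨
    trace ℓ (x ‾) + trace ℓ x                          ≈⟨ trace-+ ℓ (x ‾) x ⟨
    trace ℓ (x ‾ + x)                                  ∎

  -- Rank-one members of the pencil p B + p′ B ‾.

  -- The 2 × 2 matrix of p B + p′ B ‾ as an outer product: (m₁ , m₂) are the coefficients of α, (m₃
  -- , m₄) those of β.
  record Factored (p p′ : Carrier) : Set (r₁ ⊔ r₂) where
    field
      m₁ m₂ m₃ m₄ : Carrier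
      m₁m₃ : p * d + p′ * a′ ≈ m₁ * m₃
      m₁m₄ : p * c + p′ * b′ ≈ m₁ * m₄
      m₂m₃ : p * b + p′ * c′ ≈ m₂ * m₃
      m₂m₄ : p * a + p′ * d′ ≈ m₂ * m₄

    α β : Carrier → Carrier
    α x = m₁ * x ᵠ + m₂ * x ‾ ᵠ
    β x = m₃ * x + m₄ * x ‾

    factored : ∀ x → p * f x + p′ * f x ‾ ≈ α x * β x
    factored x = begin
      p * f x + p′ * f x ‾
        ≈⟨ +-congˡ (*-congˡ (f‾ x)) ⟩
      p * f x + p′ * (a′ * (x ᵠ * x) + b′ * (x ᵠ * x ‾) + c′ * (x ‾ ᵠ * x) + d′ * (x ‾ ᵠ * x ‾))
        ≈⟨ solve 14 (λ a b c d a' b' c' d' p p' x x' X X' →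
             p :* (a :* (X' :* x') :+ b :* (X' :* x) :+ c :* (X :* x') :+ d :* (X :* x))
             :+ p' :* (a' :* (X :* x) :+ b' :* (X :* x') :+ c' :* (X' :* x) :+ d' :* (X' :* x'))
             := (p :* d :+ p' :* a') :* (X :* x) :+ (p :* c :+ p' :* b') :* (X :* x')
             :+ (p :* b :+ p' :* c') :* (X' :* x) :+ (p :* a :+ p' :* d') :* (X' :* x'))
             a b c d a′ b′ c′ d′ p p′ x (x ‾) (x ᵠ) (x ‾ ᵠ) ⟩
      (p * d + p′ * a′) * (x ᵠ * x) + (p * c + p′ * b′) * (x ᵠ * x ‾) + (p * b + p′ * c′) * (x ‾ ᵠ * x) + (p * a + p′ * d′) * (x ‾ ᵠ * x ‾)
        ≈⟨ +-cong (+-cong (+-cong (*-congʳ m₁m₃) (*-congʳ m₁m₄)) (*-congʳ m₂m₃)) (*-congʳ m₂m₄) ⟩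
      m₁ * m₃ * (x ᵠ * x) + m₁ * m₄ * (x ᵠ * x ‾) + m₂ * m₃ * (x ‾ ᵠ * x) + m₂ * m₄ * (x ‾ ᵠ * x ‾)
        ≈⟨ solve 8 (λ m₁ m₂ m₃ m₄ x x' X X' →
             m₁ :* m₃ :* (X :* x) :+ m₁ :* m₄ :* (X :* x') :+ m₂ :* m₃ :* (X' :* x) :+ m₂ :* m₄ :* (X' :* x')
             := (m₁ :* X :+ m₂ :* X') :* (m₃ :* x :+ m₄ :* x')) m₁ m₂ m₃ m₄ x (x ‾) (x ᵠ) (x ‾ ᵠ) ⟩
      α x * β x
        ∎

  -- The hypothesis is that p B + p′ B ‾ has determinant zero.
  factor : ∀ {p p′} → θ * (p * p) + e * (p * p′) + θ′ * (p′ * p′) ≈ 0# → Factored p p′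
  factor {p} {p′} isotropic with p * d + p′ * a′ ≟ 0# | p * c + p′ * b′ ≟ 0#
  ... | no P≉0 | _ = let P⁻¹ , PP⁻¹≈1 = inverse (p * d + p′ * a′) P≉0 in record
    { m₁ = 1# ; m₂ = (p * b + p′ * c′) * P⁻¹ ; m₃ = p * d + p′ * a′ ; m₄ = p * c + p′ * b′
    ; m₁m₃ = sym (*-identityˡ _)
    ; m₁m₄ = sym (*-identityˡ _)
    ; m₂m₃ = linear-combination (solve 3 (λ P S I → S :+ S :* I :* P := S :* (P :* I :+ :1)) (p * d + p′ * a′) (p * b + p′ * c′) P⁻¹)
               ((p * b + p′ * c′) · PP⁻¹≈1)
    ; m₂m₄ = linear-combination
        (solve 11 (λ a b c d a' b' c' d' p p' I →
           (p :* a :+ p' :* d') :+ (p :* b :+ p' :* c') :* I :* (p :* c :+ p' :* b')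
           := (p :* a :+ p' :* d') :* ((p :* d :+ p' :* a') :* I :+ :1)
           :+ I :* ((a :* d :+ b :* c) :* (p :* p) :+ (a :* a' :+ b :* b' :+ c :* c' :+ d :* d') :* (p :* p') :+ (a' :* d' :+ b' :* c') :* (p' :* p') :+ :0))
           a b c d a′ b′ c′ d′ p p′ P⁻¹)
        ((p * a + p′ * d′) · PP⁻¹≈1 ⊞ P⁻¹ · isotropic)
    }
  ... | yes P≈0 | no R≉0 = let R⁻¹ , RR⁻¹≈1 = inverse (p * c + p′ * b′) R≉0 in record
    { m₁ = 1# ; m₂ = (p * a + p′ * d′) * R⁻¹ ; m₃ = 0# ; m₄ = p * c + p′ * b′
    ; m₁m₃ = trans P≈0 (sym (zeroʳ _))
    ; m₁m₄ = sym (*-identityˡ _)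
    ; m₂m₃ = trans (integral R≉0 (linear-combination
        (solve 10 (λ a b c d a' b' c' d' p p' →
           (p :* c :+ p' :* b') :* (p :* b :+ p' :* c') :+ :0
           := (p :* a :+ p' :* d') :* ((p :* d :+ p' :* a') :+ :0)
           :+ :1 :* ((a :* d :+ b :* c) :* (p :* p) :+ (a :* a' :+ b :* b' :+ c :* c' :+ d :* d') :* (p :* p') :+ (a' :* d' :+ b' :* c') :* (p' :* p') :+ :0))
           a b c d a′ b′ c′ d′ p p′)
        ((p * a + p′ * d′) · P≈0 ⊞ 1# · isotropic))) (sym (zeroʳ _))
    ; m₂m₄ = linear-combination (solve 3 (λ P S I → S :+ S :* I :* P := S :* (P :* I :+ :1)) (p * c + p′ * b′) (p * a + p′ * d′) R⁻¹)
               ((p * a + p′ * d′) · RR⁻¹≈1)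
    }
  ... | yes P≈0 | yes R≈0 = record
    { m₁ = 0# ; m₂ = 1# ; m₃ = p * b + p′ * c′ ; m₄ = p * a + p′ * d′
    ; m₁m₃ = trans P≈0 (sym (zeroˡ _))
    ; m₁m₄ = trans R≈0 (sym (zeroˡ _))
    ; m₂m₃ = sym (*-identityˡ _)
    ; m₂m₄ = sym (*-identityˡ _)
    }

  -- Two independent rank-one members: straight and crossed position.

  module Pair {p p′ r r′} (F : Factored p p′) (G : Factored r r′)
              (e≉0 : ¬ e ≈ 0#) (Δ≉0 : ¬ p * r′ + p′ * r ≈ 0#) where

    open Factored F public
    open Factored G public renaming
      ( m₁ to n₁; m₂ to n₂; m₃ to n₃; m₄ to n₄; m₁m₃ to n₁n₃; m₁m₄ to n₁n₄; m₂m₃ to n₂n₃; m₂m₄ to n₂n₄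
      ; α to α₂; β to β₂; factored to factored₂ )

    Δ Δα Δβ : Carrier
    Δ  = p * r′ + p′ * r
    Δα = m₁ * n₂ + m₂ * n₁
    Δβ = m₃ * n₄ + m₄ * n₃

    M₃ M₄ N₃ N₄ : Carrier
    M₃ = m₃ ᵠ
    M₄ = m₄ ᵠ
    N₃ = n₃ ᵠ
    N₄ = n₄ ᵠ

    private
      P₁ P₂ P₃ P₄ R₁ R₂ R₃ R₄ : Carrier
      P₁ = p * d + p′ * a′
      P₂ = p * c + p′ * b′
      P₃ = p * b + p′ * c′
      P₄ = p * a + p′ * d′
      R₁ = r * d + r′ * a′
      R₂ = r * c + r′ * b′
      R₃ = r * b + r′ * c′
      R₄ = r * a + r′ * d′

    -- Here and in the next identities, Δ times an invariant of f is a sum of products of an entry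
    -- of the first matrix and one of the second; it simplifies because both matrices have rank one.
    -- So, up to a common scalar, the γ-form is β β₂ and the δ-form is α α₂.
    Δe : Δ * e ≈ Δα * Δβ
    Δe = begin
      Δ * e
        ≈⟨ solve 12 (λ a b c d a' b' c' d' p p' r r' →
             (p :* r' :+ p' :* r) :* (a :* a' :+ b :* b' :+ c :* c' :+ d :* d')
             := (p :* d :+ p' :* a') :* (r :* a :+ r' :* d') :+ (p :* c :+ p' :* b') :* (r :* b :+ r' :* c')
             :+ (p :* b :+ p' :* c') :* (r :* c :+ r' :* b') :+ (p :* a :+ p' :* d') :* (r :* d :+ r' :* a'))
             a b c d a′ b′ c′ d′ p p′ r r′ ⟩
      P₁ * R₄ + P₂ * R₃ + P₃ * R₂ + P₄ * R₁
        ≈⟨ +-cong (+-cong (+-cong (*-cong m₁m₃ n₂n₄) (*-cong m₁m₄ n₂n₃)) (*-cong m₂m₃ n₁n₄)) (*-cong m₂m₄ n₁n₃) ⟩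
      m₁ * m₃ * (n₂ * n₄) + m₁ * m₄ * (n₂ * n₃) + m₂ * m₃ * (n₁ * n₄) + m₂ * m₄ * (n₁ * n₃)
        ≈⟨ solve 8 (λ m₁ m₂ m₃ m₄ n₁ n₂ n₃ n₄ →
             m₁ :* m₃ :* (n₂ :* n₄) :+ m₁ :* m₄ :* (n₂ :* n₃) :+ m₂ :* m₃ :* (n₁ :* n₄) :+ m₂ :* m₄ :* (n₁ :* n₃)
             := (m₁ :* n₂ :+ m₂ :* n₁) :* (m₃ :* n₄ :+ m₄ :* n₃)) m₁ m₂ m₃ m₄ n₁ n₂ n₃ n₄ ⟩
      Δα * Δβ
        ∎

    Δγ : Δ * γ ≈ Δα * (m₃ * n₃)
    Δγ = begin
      Δ * γ
        ≈⟨ solve 12 (λ a b c d a' b' c' d' p p' r r' →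
             (p :* r' :+ p' :* r) :* (a' :* b :+ c' :* d)
             := (p :* d :+ p' :* a') :* (r :* b :+ r' :* c') :+ (p :* b :+ p' :* c') :* (r :* d :+ r' :* a'))
             a b c d a′ b′ c′ d′ p p′ r r′ ⟩
      P₁ * R₃ + P₃ * R₁
        ≈⟨ +-cong (*-cong m₁m₃ n₂n₃) (*-cong m₂m₃ n₁n₃) ⟩
      m₁ * m₃ * (n₂ * n₃) + m₂ * m₃ * (n₁ * n₃)
        ≈⟨ solve 6 (λ m₁ m₂ m₃ n₁ n₂ n₃ →
             m₁ :* m₃ :* (n₂ :* n₃) :+ m₂ :* m₃ :* (n₁ :* n₃) := (m₁ :* n₂ :+ m₂ :* n₁) :* (m₃ :* n₃)) m₁ m₂ m₃ n₁ n₂ n₃ ⟩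
      Δα * (m₃ * n₃)
        ∎

    Δγ′ : Δ * γ′ ≈ Δα * (m₄ * n₄)
    Δγ′ = begin
      Δ * γ′
        ≈⟨ solve 12 (λ a b c d a' b' c' d' p p' r r' →
             (p :* r' :+ p' :* r) :* (a :* b' :+ c :* d')
             := (p :* c :+ p' :* b') :* (r :* a :+ r' :* d') :+ (p :* a :+ p' :* d') :* (r :* c :+ r' :* b'))
             a b c d a′ b′ c′ d′ p p′ r r′ ⟩
      P₂ * R₄ + P₄ * R₂
        ≈⟨ +-cong (*-cong m₁m₄ n₂n₄) (*-cong m₂m₄ n₁n₄) ⟩
      m₁ * m₄ * (n₂ * n₄) + m₂ * m₄ * (n₁ * n₄)
        ≈⟨ solve 6 (λ m₁ m₂ m₃ n₁ n₂ n₃ →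
             m₁ :* m₃ :* (n₂ :* n₃) :+ m₂ :* m₃ :* (n₁ :* n₃) := (m₁ :* n₂ :+ m₂ :* n₁) :* (m₃ :* n₃)) m₁ m₂ m₄ n₁ n₂ n₄ ⟩
      Δα * (m₄ * n₄)
        ∎

    Δδ : Δ * δ ≈ Δβ * (m₁ * n₁)
    Δδ = begin
      Δ * δ
        ≈⟨ solve 12 (λ a b c d a' b' c' d' p p' r r' →
             (p :* r' :+ p' :* r) :* (a' :* c :+ b' :* d)
             := (p :* d :+ p' :* a') :* (r :* c :+ r' :* b') :+ (p :* c :+ p' :* b') :* (r :* d :+ r' :* a'))
             a b c d a′ b′ c′ d′ p p′ r r′ ⟩
      P₁ * R₂ + P₂ * R₁
        ≈⟨ +-cong (*-cong m₁m₃ n₁n₄) (*-cong m₁m₄ n₁n₃) ⟩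
      m₁ * m₃ * (n₁ * n₄) + m₁ * m₄ * (n₁ * n₃)
        ≈⟨ solve 6 (λ m₁ m₃ m₄ n₁ n₃ n₄ →
             m₁ :* m₃ :* (n₁ :* n₄) :+ m₁ :* m₄ :* (n₁ :* n₃) := (m₃ :* n₄ :+ m₄ :* n₃) :* (m₁ :* n₁)) m₁ m₃ m₄ n₁ n₃ n₄ ⟩
      Δβ * (m₁ * n₁)
        ∎

    Δδ′ : Δ * δ′ ≈ Δβ * (m₂ * n₂)
    Δδ′ = begin
      Δ * δ′
        ≈⟨ solve 12 (λ a b c d a' b' c' d' p p' r r' →
             (p :* r' :+ p' :* r) :* (a :* c' :+ b :* d')
             := (p :* b :+ p' :* c') :* (r :* a :+ r' :* d') :+ (p :* a :+ p' :* d') :* (r :* b :+ r' :* c'))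
             a b c d a′ b′ c′ d′ p p′ r r′ ⟩
      P₃ * R₄ + P₄ * R₃
        ≈⟨ +-cong (*-cong m₂m₃ n₂n₄) (*-cong m₂m₄ n₂n₃) ⟩
      m₂ * m₃ * (n₂ * n₄) + m₂ * m₄ * (n₂ * n₃)
        ≈⟨ solve 6 (λ m₁ m₃ m₄ n₁ n₃ n₄ →
             m₁ :* m₃ :* (n₁ :* n₄) :+ m₁ :* m₄ :* (n₁ :* n₃) := (m₃ :* n₄ :+ m₄ :* n₃) :* (m₁ :* n₁)) m₂ m₃ m₄ n₂ n₃ n₄ ⟩
      Δβ * (m₂ * n₂)
        ∎

    Δn : Δ * n ≈ m₂ * m₃ * (n₁ * n₄) + m₁ * m₄ * (n₂ * n₃)
    Δn = begin
      Δ * n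
        ≈⟨ solve 8 (λ b c b' c' p p' r r' →
             (p :* r' :+ p' :* r) :* (b :* b' :+ c :* c')
             := (p :* b :+ p' :* c') :* (r :* c :+ r' :* b') :+ (p :* c :+ p' :* b') :* (r :* b :+ r' :* c'))
             b c b′ c′ p p′ r r′ ⟩
      P₃ * R₂ + P₂ * R₃
        ≈⟨ +-cong (*-cong m₂m₃ n₁n₄) (*-cong m₁m₄ n₂n₃) ⟩
      m₂ * m₃ * (n₁ * n₄) + m₁ * m₄ * (n₂ * n₃)
        ∎

    ΔαΔβ≉0 : ¬ Δα * Δβ ≈ 0#
    ΔαΔβ≉0 eq = *-nonzero Δ≉0 e≉0 (trans Δe eq)

    Δα≉0 : ¬ Δα ≈ 0#
    Δα≉0 eq = ΔαΔβ≉0 (trans (*-congʳ eq) (zeroˡ _))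

    Δβ≉0 : ¬ Δβ ≈ 0#
    Δβ≉0 eq = ΔαΔβ≉0 (trans (*-congˡ eq) (zeroʳ _))

    Δβᵠ≉0 : ¬ Δβ ᵠ ≈ 0#
    Δβᵠ≉0 = ^-nonzero Q Δβ≉0

    Δβᵠ : Δβ ᵠ ≈ M₃ * N₄ + M₄ * N₃
    Δβᵠ = ᵠ-+* m₃ n₄ m₄ n₃

    -- The determinants of α, α₂ against β₂ ^Q, β ^Q (for s) and β ^Q, β₂ ^Q (for t).
    s₁ s₂ t₁ t₂ : Carrier
    s₁ = m₁ * N₄ + m₂ * N₃
    s₂ = n₁ * M₄ + n₂ * M₃
    t₁ = m₁ * M₄ + m₂ * M₃
    t₂ = n₁ * N₄ + n₂ * N₃

    Straight Crossed : Set r₂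
    Straight = t₁ ≈ 0# × t₂ ≈ 0#
    Crossed  = s₁ ≈ 0# × s₂ ≈ 0#

    -- Condition (2) in factored form: β^Q β₂^Q and α α₂ have the same ratio of first to middle
    -- coefficient. Without signs, the middle coefficients are the determinants Δβ^Q and Δα.
    Proportional : Set r₂
    Proportional = Δα * (M₃ * N₃) ≈ Δβ ᵠ * (m₁ * n₁)

    private
      swap-γδ : ∀ {γ δ m₃ n₃ m₁ n₁} → Δ * γ ≈ Δα * (m₃ * n₃) → Δ * δ ≈ Δβ * (m₁ * n₁) →
                (Δ ᵠ * Δ) * (γ ᵠ * e + e ᵠ * δ) ≈ (Δα ᵠ * Δβ) * (Δα * (m₃ ᵠ * n₃ ᵠ) + Δβ ᵠ * (m₁ * n₁))
      swap-γδ {γ} {δ} {m₃} {n₃} {m₁} {n₁} Δγ Δδ = begin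
        (Δ ᵠ * Δ) * (γ ᵠ * e + e ᵠ * δ)
          ≈⟨ solve 6 (λ D D' g e e' d → (D' :* D) :* (g :* e :+ e' :* d) := (D' :* g) :* (D :* e) :+ (D' :* e') :* (D :* d)) Δ (Δ ᵠ) (γ ᵠ) e (e ᵠ) δ ⟩
        (Δ ᵠ * γ ᵠ) * (Δ * e) + (Δ ᵠ * e ᵠ) * (Δ * δ)
          ≈⟨ +-cong (*-cong Δᵠγᵠ Δe) (*-cong Δᵠeᵠ Δδ) ⟩
        (Δα ᵠ * (m₃ ᵠ * n₃ ᵠ)) * (Δα * Δβ) + (Δα ᵠ * Δβ ᵠ) * (Δβ * (m₁ * n₁))
          ≈⟨ solve 6 (λ A A' B B' x y → (A' :* x) :* (A :* B) :+ (A' :* B') :* (B :* y) := (A' :* B) :* (A :* x :+ B' :* y)) Δα (Δα ᵠ) Δβ (Δβ ᵠ) (m₃ ᵠ * n₃ ᵠ) (m₁ * n₁) ⟩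
        (Δα ᵠ * Δβ) * (Δα * (m₃ ᵠ * n₃ ᵠ) + Δβ ᵠ * (m₁ * n₁))
          ∎
        where
        Δᵠeᵠ : Δ ᵠ * e ᵠ ≈ Δα ᵠ * Δβ ᵠ
        Δᵠeᵠ = trans (sym (ᵠ-* Δ e)) (trans (ᵠ-cong Δe) (ᵠ-* Δα Δβ))
        Δᵠγᵠ : Δ ᵠ * γ ᵠ ≈ Δα ᵠ * (m₃ ᵠ * n₃ ᵠ)
        Δᵠγᵠ = trans (sym (ᵠ-* Δ γ)) (trans (ᵠ-cong Δγ) (trans (ᵠ-* Δα _) (*-congˡ (ᵠ-* m₃ n₃))))

      γδ⇒proportional : ∀ {γ δ m₃ n₃ m₁ n₁} → Δ * γ ≈ Δα * (m₃ * n₃) → Δ * δ ≈ Δβ * (m₁ * n₁) →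
                        γ ᵠ * e ≈ e ᵠ * δ → Δα * (m₃ ᵠ * n₃ ᵠ) ≈ Δβ ᵠ * (m₁ * n₁)
      γδ⇒proportional Δγ Δδ eq = +≈0⇒≈ (integral (*-nonzero (^-nonzero Q Δα≉0) Δβ≉0)
        (trans (sym (swap-γδ Δγ Δδ)) (_ · eq)))

    proportional⇒condition : Proportional → γ ᵠ * e ≈ e ᵠ * δ
    proportional⇒condition eq = +≈0⇒≈ (integral (*-nonzero (^-nonzero Q Δ≉0) Δ≉0) (trans (swap-γδ Δγ Δδ) (_ · eq)))

    straight⇒proportional : Straight → Proportional
    straight⇒proportional (t₁≈0 , t₂≈0) = trans (linear-combination
      (solve 8 (λ m₁ m₂ n₁ n₂ M₃ M₄ N₃ N₄ →
         (m₁ :* n₂ :+ m₂ :* n₁) :* (M₃ :* N₃) :+ (M₃ :* N₄ :+ M₄ :* N₃) :* (m₁ :* n₁)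
         := n₁ :* N₃ :* (m₁ :* M₄ :+ m₂ :* M₃ :+ :0) :+ m₁ :* M₃ :* (n₁ :* N₄ :+ n₂ :* N₃ :+ :0)) m₁ m₂ n₁ n₂ M₃ M₄ N₃ N₄)
      ((n₁ * N₃) · t₁≈0 ⊞ (m₁ * M₃) · t₂≈0)) (*-congʳ (sym Δβᵠ))

    crossed⇒proportional : Crossed → Proportional
    crossed⇒proportional (s₁≈0 , s₂≈0) = trans (linear-combination
      (solve 8 (λ m₁ m₂ n₁ n₂ M₃ M₄ N₃ N₄ →
         (m₁ :* n₂ :+ m₂ :* n₁) :* (M₃ :* N₃) :+ (M₃ :* N₄ :+ M₄ :* N₃) :* (m₁ :* n₁)
         := n₁ :* M₃ :* (m₁ :* N₄ :+ m₂ :* N₃ :+ :0) :+ m₁ :* N₃ :* (n₁ :* M₄ :+ n₂ :* M₃ :+ :0)) m₁ m₂ n₁ n₂ M₃ M₄ N₃ N₄)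
      ((n₁ * M₃) · s₁≈0 ⊞ (m₁ * N₃) · s₂≈0)) (*-congʳ (sym Δβᵠ))

    private
      -- The determinant of the change of basis displayed in `Δβᵠα` and `Δβᵠα₂`.
      s·t : Δβ ᵠ * Δα ≈ t₁ * t₂ + s₁ * s₂
      s·t = trans (*-congʳ Δβᵠ)
        (solve 8 (λ m₁ m₂ n₁ n₂ M₃ M₄ N₃ N₄ →
           (M₃ :* N₄ :+ M₄ :* N₃) :* (m₁ :* n₂ :+ m₂ :* n₁)
           := (m₁ :* M₄ :+ m₂ :* M₃) :* (n₁ :* N₄ :+ n₂ :* N₃) :+ (m₁ :* N₄ :+ m₂ :* N₃) :* (n₁ :* M₄ :+ n₂ :* M₃))
           m₁ m₂ n₁ n₂ M₃ M₄ N₃ N₄)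

      s·t≉0+0 : ¬ Δβ ᵠ * Δα ≈ 0# + 0#
      s·t≉0+0 eq = *-nonzero Δβᵠ≉0 Δα≉0 (trans eq (+-identityˡ 0#))

    -- s₁ t₂ is the value of α α₂ at the zero (N₄ , N₃) of β₂^Q, and t₁ s₂ its value at the zero (M₄
    -- , M₃) of β^Q; both vanish since α α₂ is proportional to β^Q β₂^Q. The conjugate condition
    -- supplies the third coefficient, and `s·t` rules out the degenerate combinations.
    condition⇒straight⊎crossed : γ ᵠ * e ≈ e ᵠ * δ → Straight ⊎ Crossed
    condition⇒straight⊎crossed cond = cases (s₁ ≟ 0#) (t₁ ≟ 0#)
      where
      cond′ : γ′ ᵠ * e ≈ e ᵠ * δ′
      cond′ = begin
        γ′ ᵠ * e          ≈⟨ *-cong (ᵠ-cong γ‾) e‾ ⟨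
        γ ‾ ᵠ * e ‾       ≈⟨ *-congʳ (ᵠ‾ γ) ⟨
        γ ᵠ ‾ * e ‾       ≈⟨ ‾-* (γ ᵠ) e ⟨
        (γ ᵠ * e) ‾       ≈⟨ ‾-cong cond ⟩
        (e ᵠ * δ) ‾       ≈⟨ ‾-* (e ᵠ) δ ⟩
        e ᵠ ‾ * δ ‾       ≈⟨ *-cong (trans (ᵠ‾ e) (ᵠ-cong e‾)) δ‾ ⟩
        e ᵠ * δ′          ∎
      prop : Δα * (M₃ * N₃) ≈ (M₃ * N₄ + M₄ * N₃) * (m₁ * n₁)
      prop = trans (γδ⇒proportional Δγ Δδ cond) (*-congʳ Δβᵠ)
      prop′ : Δα * (M₄ * N₄) ≈ (M₃ * N₄ + M₄ * N₃) * (m₂ * n₂)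
      prop′ = trans (γδ⇒proportional Δγ′ Δδ′ cond′) (*-congʳ Δβᵠ)
      s₁t₂≈0 : s₁ * t₂ ≈ 0#
      s₁t₂≈0 = integral Δβᵠ≉0 (trans (*-congʳ Δβᵠ) (linear-combination
        (solve 8 (λ m₁ m₂ n₁ n₂ M₃ M₄ N₃ N₄ →
           (M₃ :* N₄ :+ M₄ :* N₃) :* ((m₁ :* N₄ :+ m₂ :* N₃) :* (n₁ :* N₄ :+ n₂ :* N₃)) :+ :0
           := N₄ :* N₄ :* ((m₁ :* n₂ :+ m₂ :* n₁) :* (M₃ :* N₃) :+ (M₃ :* N₄ :+ M₄ :* N₃) :* (m₁ :* n₁))
           :+ N₃ :* N₃ :* ((m₁ :* n₂ :+ m₂ :* n₁) :* (M₄ :* N₄) :+ (M₃ :* N₄ :+ M₄ :* N₃) :* (m₂ :* n₂)))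
           m₁ m₂ n₁ n₂ M₃ M₄ N₃ N₄)
        ((N₄ * N₄) · prop ⊞ (N₃ * N₃) · prop′)))
      t₁s₂≈0 : t₁ * s₂ ≈ 0#
      t₁s₂≈0 = integral Δβᵠ≉0 (trans (*-congʳ Δβᵠ) (linear-combination
        (solve 8 (λ m₁ m₂ n₁ n₂ M₃ M₄ N₃ N₄ →
           (M₃ :* N₄ :+ M₄ :* N₃) :* ((m₁ :* M₄ :+ m₂ :* M₃) :* (n₁ :* M₄ :+ n₂ :* M₃)) :+ :0
           := M₄ :* M₄ :* ((m₁ :* n₂ :+ m₂ :* n₁) :* (M₃ :* N₃) :+ (M₃ :* N₄ :+ M₄ :* N₃) :* (m₁ :* n₁))
           :+ M₃ :* M₃ :* ((m₁ :* n₂ :+ m₂ :* n₁) :* (M₄ :* N₄) :+ (M₃ :* N₄ :+ M₄ :* N₃) :* (m₂ :* n₂)))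
           m₁ m₂ n₁ n₂ M₃ M₄ N₃ N₄)
        ((M₄ * M₄) · prop ⊞ (M₃ * M₃) · prop′)))
      cases : Dec (s₁ ≈ 0#) → Dec (t₁ ≈ 0#) → Straight ⊎ Crossed
      cases (no s₁≉0)  (yes t₁≈0) = inj₁ (t₁≈0 , integral s₁≉0 s₁t₂≈0)
      cases (yes s₁≈0) (no t₁≉0)  = inj₂ (s₁≈0 , integral t₁≉0 t₁s₂≈0)
      cases (no s₁≉0)  (no t₁≉0)  = contradiction
        (trans s·t (+-cong (trans (*-congˡ (integral s₁≉0 s₁t₂≈0)) (zeroʳ _)) (trans (*-congˡ (integral t₁≉0 t₁s₂≈0)) (zeroʳ _))))
        s·t≉0+0
      cases (yes s₁≈0) (yes t₁≈0) = contradiction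
        (trans s·t (+-cong (trans (*-congʳ t₁≈0) (zeroˡ _)) (trans (*-congʳ s₁≈0) (zeroˡ _))))
        s·t≉0+0

    straight⇒s₁s₂≉0 : Straight → ¬ s₁ * s₂ ≈ 0#
    straight⇒s₁s₂≉0 (t₁≈0 , _) s₁s₂≈0 = s·t≉0+0 (trans s·t (+-cong (trans (*-congʳ t₁≈0) (zeroˡ _)) s₁s₂≈0))

    crossed⇒t₁t₂≉0 : Crossed → ¬ t₁ * t₂ ≈ 0#
    crossed⇒t₁t₂≉0 (s₁≈0 , _) t₁t₂≈0 = s·t≉0+0 (trans s·t (+-cong t₁t₂≈0 (trans (*-congʳ s₁≈0) (zeroˡ _))))

    βᵠ : ∀ x → β x ᵠ ≈ M₃ * x ᵠ + M₄ * x ‾ ᵠ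
    βᵠ x = ᵠ-+* m₃ x m₄ (x ‾)

    β₂ᵠ : ∀ x → β₂ x ᵠ ≈ N₃ * x ᵠ + N₄ * x ‾ ᵠ
    β₂ᵠ x = ᵠ-+* n₃ x n₄ (x ‾)

    Δβᵠα : ∀ x → Δβ ᵠ * α x ≈ s₁ * β x ᵠ + t₁ * β₂ x ᵠ
    Δβᵠα x = trans (*-congʳ Δβᵠ) (trans
      (solve 8 (λ m₁ m₂ M₃ M₄ N₃ N₄ X X' → (M₃ :* N₄ :+ M₄ :* N₃) :* (m₁ :* X :+ m₂ :* X')
         := (m₁ :* N₄ :+ m₂ :* N₃) :* (M₃ :* X :+ M₄ :* X') :+ (m₁ :* M₄ :+ m₂ :* M₃) :* (N₃ :* X :+ N₄ :* X'))
         m₁ m₂ M₃ M₄ N₃ N₄ (x ᵠ) (x ‾ ᵠ))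
      (sym (+-cong (*-congˡ (βᵠ x)) (*-congˡ (β₂ᵠ x)))))

    Δβᵠα₂ : ∀ x → Δβ ᵠ * α₂ x ≈ t₂ * β x ᵠ + s₂ * β₂ x ᵠ
    Δβᵠα₂ x = trans (*-congʳ Δβᵠ) (trans
      (solve 8 (λ n₁ n₂ M₃ M₄ N₃ N₄ X X' → (M₃ :* N₄ :+ M₄ :* N₃) :* (n₁ :* X :+ n₂ :* X')
         := (n₁ :* N₄ :+ n₂ :* N₃) :* (M₃ :* X :+ M₄ :* X') :+ (n₁ :* M₄ :+ n₂ :* M₃) :* (N₃ :* X :+ N₄ :* X'))
         n₁ n₂ M₃ M₄ N₃ N₄ (x ᵠ) (x ‾ ᵠ))
      (sym (+-cong (*-congˡ (βᵠ x)) (*-congˡ (β₂ᵠ x)))))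

    ββ₂-injective : ∀ {x y} → β x ≈ β y → β₂ x ≈ β₂ y → x ≈ y
    ββ₂-injective {x} {y} eq eq₂ = *-cancelˡ-nonzero _ _ Δβ≉0 (linear-combination
      (solve 8 (λ m₃ m₄ n₃ n₄ x x' y y' →
         (m₃ :* n₄ :+ m₄ :* n₃) :* x :+ (m₃ :* n₄ :+ m₄ :* n₃) :* y
         := n₄ :* (m₃ :* x :+ m₄ :* x' :+ (m₃ :* y :+ m₄ :* y')) :+ m₄ :* (n₃ :* x :+ n₄ :* x' :+ (n₃ :* y :+ n₄ :* y')))
         m₃ m₄ n₃ n₄ x (x ‾) y (y ‾))
      (n₄ · eq ⊞ m₄ · eq₂))

    αβ-determine-f : ∀ {x y} → α x * β x ≈ α y * β y → α₂ x * β₂ x ≈ α₂ y * β₂ y → f x ≈ f y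
    αβ-determine-f {x} {y} eq eq₂ = *-cancelˡ-nonzero _ _ Δ≉0 (linear-combination
      (solve 8 (λ p p' r r' x x' y y' →
         (p :* r' :+ p' :* r) :* x :+ (p :* r' :+ p' :* r) :* y
         := r' :* (p :* x :+ p' :* x' :+ (p :* y :+ p' :* y')) :+ p' :* (r :* x :+ r' :* x' :+ (r :* y :+ r' :* y')))
         p p′ r r′ (f x) (f x ‾) (f y) (f y ‾))
      (r′ · trans (factored x) (trans eq (sym (factored y))) ⊞ p′ · trans (factored₂ x) (trans eq₂ (sym (factored₂ y)))))

    f-determines-αβ : ∀ {x y} → f x ≈ f y → α x * β x ≈ α y * β y
    f-determines-αβ {x} {y} eq = trans (sym (factored x)) (trans (+-cong (*-congˡ eq) (*-congˡ (‾-cong eq))) (factored y))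

    f-determines-α₂β₂ : ∀ {x y} → f x ≈ f y → α₂ x * β₂ x ≈ α₂ y * β₂ y
    f-determines-α₂β₂ {x} {y} eq = trans (sym (factored₂ x)) (trans (+-cong (*-congˡ eq) (*-congˡ (‾-cong eq))) (factored₂ y))

    -- n / e equals h + h ᵠ in the straight case and h + h ᵠ + 1 in the crossed case.
    h : Carrier
    h = m₃ * n₄ * proj₁ (inverse Δβ Δβ≉0)

    Δβh : Δβ * h ≈ m₃ * n₄
    Δβh = linear-combination (solve 3 (λ x y z → x :* (y :* z) :+ y := y :* (x :* z :+ :1)) Δβ (m₃ * n₄) (proj₁ (inverse Δβ Δβ≉0)))
      ((m₃ * n₄) · proj₂ (inverse Δβ Δβ≉0))

    private
      Δβᵠhᵠ : Δβ ᵠ * h ᵠ ≈ M₃ * N₄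
      Δβᵠhᵠ = trans (sym (ᵠ-* Δβ h)) (trans (ᵠ-cong Δβh) (ᵠ-* m₃ n₄))

      ΔΔβᵠ≉0 : ¬ Δ * Δβ ᵠ ≈ 0#
      ΔΔβᵠ≉0 = *-nonzero Δ≉0 Δβᵠ≉0

      scaled : ∀ x y → (Δ * Δβ ᵠ) * (e * (h + h ᵠ + x) + y) ≈
               Δα * ((M₃ * N₄ + M₄ * N₃) * (m₃ * n₄) + Δβ * (M₃ * N₄) + Δβ * (M₃ * N₄ + M₄ * N₃) * x) + (M₃ * N₄ + M₄ * N₃) * (Δ * y)
      scaled x y = begin
        (Δ * Δβ ᵠ) * (e * (h + h ᵠ + x) + y)
          ≈⟨ solve 7 (λ D B e h H x y → (D :* B) :* (e :* (h :+ H :+ x) :+ y) := (D :* e) :* (B :* h :+ B :* H :+ B :* x) :+ B :* (D :* y)) Δ (Δβ ᵠ) e h (h ᵠ) x y ⟩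
        (Δ * e) * (Δβ ᵠ * h + Δβ ᵠ * h ᵠ + Δβ ᵠ * x) + Δβ ᵠ * (Δ * y)
          ≈⟨ +-congʳ (*-cong Δe (+-congʳ (+-congˡ Δβᵠhᵠ))) ⟩
        (Δα * Δβ) * (Δβ ᵠ * h + M₃ * N₄ + Δβ ᵠ * x) + Δβ ᵠ * (Δ * y)
          ≈⟨ solve 8 (λ A B B' h m x D y → (A :* B) :* (B' :* h :+ m :+ B' :* x) :+ B' :* (D :* y) := A :* (B' :* (B :* h) :+ B :* m :+ B :* B' :* x) :+ B' :* (D :* y)) Δα Δβ (Δβ ᵠ) h (M₃ * N₄) x Δ y ⟩
        Δα * (Δβ ᵠ * (Δβ * h) + Δβ * (M₃ * N₄) + Δβ * Δβ ᵠ * x) + Δβ ᵠ * (Δ * y)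
          ≈⟨ +-cong (*-congˡ (+-cong (+-congʳ (*-cong Δβᵠ Δβh)) (*-congʳ (*-congˡ Δβᵠ)))) (*-congʳ Δβᵠ) ⟩
        Δα * ((M₃ * N₄ + M₄ * N₃) * (m₃ * n₄) + Δβ * (M₃ * N₄) + Δβ * (M₃ * N₄ + M₄ * N₃) * x) + (M₃ * N₄ + M₄ * N₃) * (Δ * y)
          ∎

    straight⇒eh : Straight → e * (h + h ᵠ) ≈ n
    straight⇒eh (t₁≈0 , t₂≈0) = trans (*-congˡ (sym (+-identityʳ _))) (+≈0⇒≈ (integral ΔΔβᵠ≉0 (begin
      (Δ * Δβ ᵠ) * (e * (h + h ᵠ + 0#) + n)
        ≈⟨ scaled 0# n ⟩
      Δα * ((M₃ * N₄ + M₄ * N₃) * (m₃ * n₄) + Δβ * (M₃ * N₄) + Δβ * (M₃ * N₄ + M₄ * N₃) * 0#) + (M₃ * N₄ + M₄ * N₃) * (Δ * n)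
        ≈⟨ +-congˡ (*-congˡ Δn) ⟩
      Δα * ((M₃ * N₄ + M₄ * N₃) * (m₃ * n₄) + Δβ * (M₃ * N₄) + Δβ * (M₃ * N₄ + M₄ * N₃) * 0#)
        + (M₃ * N₄ + M₄ * N₃) * (m₂ * m₃ * (n₁ * n₄) + m₁ * m₄ * (n₂ * n₃))
        ≈⟨ linear-combination
          (solve 12 (λ m₁ m₂ m₃ m₄ n₁ n₂ n₃ n₄ M₃ M₄ N₃ N₄ →
            (m₁ :* n₂ :+ m₂ :* n₁) :* ((M₃ :* N₄ :+ M₄ :* N₃) :* (m₃ :* n₄) :+ (m₃ :* n₄ :+ m₄ :* n₃) :* (M₃ :* N₄) :+ (m₃ :* n₄ :+ m₄ :* n₃) :* (M₃ :* N₄ :+ M₄ :* N₃) :* :0)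
            :+ (M₃ :* N₄ :+ M₄ :* N₃) :* (m₂ :* m₃ :* (n₁ :* n₄) :+ m₁ :* m₄ :* (n₂ :* n₃)) :+ :0
            := (m₃ :* n₄ :+ m₄ :* n₃) :* (n₁ :* N₄) :* (m₁ :* M₄ :+ m₂ :* M₃ :+ :0)
            :+ (m₃ :* n₄ :+ m₄ :* n₃) :* (m₁ :* M₄) :* (n₁ :* N₄ :+ n₂ :* N₃ :+ :0))
            m₁ m₂ m₃ m₄ n₁ n₂ n₃ n₄ M₃ M₄ N₃ N₄)
          ((Δβ * (n₁ * N₄)) · t₁≈0 ⊞ (Δβ * (m₁ * M₄)) · t₂≈0) ⟩
      0#
        ∎)))

    crossed⇒eh : Crossed → e * (h + h ᵠ + 1#) ≈ n
    crossed⇒eh (s₁≈0 , s₂≈0) = +≈0⇒≈ (integral ΔΔβᵠ≉0 (begin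
      (Δ * Δβ ᵠ) * (e * (h + h ᵠ + 1#) + n)
        ≈⟨ scaled 1# n ⟩
      Δα * ((M₃ * N₄ + M₄ * N₃) * (m₃ * n₄) + Δβ * (M₃ * N₄) + Δβ * (M₃ * N₄ + M₄ * N₃) * 1#) + (M₃ * N₄ + M₄ * N₃) * (Δ * n)
        ≈⟨ +-congˡ (*-congˡ Δn) ⟩
      Δα * ((M₃ * N₄ + M₄ * N₃) * (m₃ * n₄) + Δβ * (M₃ * N₄) + Δβ * (M₃ * N₄ + M₄ * N₃) * 1#)
        + (M₃ * N₄ + M₄ * N₃) * (m₂ * m₃ * (n₁ * n₄) + m₁ * m₄ * (n₂ * n₃))
        ≈⟨ linear-combination
          (solve 12 (λ m₁ m₂ m₃ m₄ n₁ n₂ n₃ n₄ M₃ M₄ N₃ N₄ →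
            (m₁ :* n₂ :+ m₂ :* n₁) :* ((M₃ :* N₄ :+ M₄ :* N₃) :* (m₃ :* n₄) :+ (m₃ :* n₄ :+ m₄ :* n₃) :* (M₃ :* N₄) :+ (m₃ :* n₄ :+ m₄ :* n₃) :* (M₃ :* N₄ :+ M₄ :* N₃) :* :1)
            :+ (M₃ :* N₄ :+ M₄ :* N₃) :* (m₂ :* m₃ :* (n₁ :* n₄) :+ m₁ :* m₄ :* (n₂ :* n₃)) :+ :0
            := (m₃ :* n₄ :+ m₄ :* n₃) :* (n₁ :* M₄) :* (m₁ :* N₄ :+ m₂ :* N₃ :+ :0)
            :+ (m₃ :* n₄ :+ m₄ :* n₃) :* (m₁ :* N₄) :* (n₁ :* M₄ :+ n₂ :* M₃ :+ :0))
            m₁ m₂ m₃ m₄ n₁ n₂ n₃ n₄ M₃ M₄ N₃ N₄)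
          ((Δβ * (n₁ * M₄)) · s₁≈0 ⊞ (Δβ * (m₁ * N₄)) · s₂≈0) ⟩
      0#
        ∎))

    straight⇒trace : ∀ {ν} → e * ν ≈ n → Straight → trace k ν ≈ trace ℓ (h ‾ + h)
    straight⇒trace eν≈n straight = trans
      (trace-cong k (*-cancelˡ-nonzero _ _ e≉0 (trans eν≈n (sym (straight⇒eh straight)))))
      (trace-x+xᵠ h)

    crossed⇒trace : ∀ {ν} → e * ν ≈ n → Crossed → trace k ν ≈ trace ℓ (h ‾ + h) + 1#
    crossed⇒trace eν≈n crossed = trans
      (trace-cong k (*-cancelˡ-nonzero _ _ e≉0 (trans eν≈n (sym (crossed⇒eh crossed)))))
      (trans (trace-+ k _ 1#) (+-cong (trace-x+xᵠ h) (trace-1-odd i)))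

  -- Conjugate factorisations, and zeros exchanged by ‾.

  β-cong : ∀ {p p′} (F : Factored p p′) → Congruent _≈_ _≈_ (Factored.β F)
  β-cong F eq = +-cong (*-congˡ eq) (*-congˡ (‾-cong eq))

  -- The conjugate of p f + p′ f ‾ is p′ ‾ f + p ‾ f ‾. Conjugation also exchanges x and x ‾, whence
  -- the reversed order of the coefficients of each form.
  conjugate : ∀ {p p′} → Factored p p′ → Factored (p′ ‾) (p ‾)
  conjugate {p} {p′} F = record
    { m₁ = m₂ ‾ ; m₂ = m₁ ‾ ; m₃ = m₄ ‾ ; m₄ = m₃ ‾
    ; m₁m₃ = conj (trans (+-comm _ _) m₂m₄) (*-congˡ (‾‾ d))
    ; m₁m₄ = conj (trans (+-comm _ _) m₂m₃) (*-congˡ (‾‾ c))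
    ; m₂m₃ = conj (trans (+-comm _ _) m₁m₄) (*-congˡ (‾‾ b))
    ; m₂m₄ = conj (trans (+-comm _ _) m₁m₃) (*-congˡ (‾‾ a))
    }
    where
    open Factored F
    conj : ∀ {x y z w} → p′ * (z ‾) + p * y ≈ x * w → p′ ‾ * z ‾ ‾ ≈ p′ ‾ * z → p′ ‾ * z + p ‾ * y ‾ ≈ x ‾ * w ‾
    conj {x} {y} {z} {w} eq z‾‾ = trans (+-congʳ (sym z‾‾)) (trans (sym (‾-+* p′ (z ‾) p y)) (trans (‾-cong eq) (‾-* x w)))

  conjugate-α : ∀ {p p′} (F : Factored p p′) x → Factored.α (conjugate F) x ≈ Factored.α F x ‾
  conjugate-α F x = sym (trans (‾-+* m₁ (x ᵠ) m₂ (x ‾ ᵠ)) (trans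
    (+-cong (*-congˡ (ᵠ‾ x)) (*-congˡ (trans (ᵠ‾ (x ‾)) (ᵠ-cong (‾‾ x))))) (+-comm _ _)))
    where open Factored F

  conjugate-β : ∀ {p p′} (F : Factored p p′) x → Factored.β (conjugate F) x ≈ Factored.β F x ‾
  conjugate-β F x = sym (trans (‾-+* m₃ x m₄ (x ‾)) (trans (+-congˡ (*-congˡ (‾‾ x))) (+-comm _ _)))
    where open Factored F

  module NonSplit {p p′} (F : Factored p p′) (e≉0 : ¬ e ≈ 0#) (Δ≉0 : ¬ p * p ‾ + p′ * p′ ‾ ≈ 0#) where

    open Pair F (conjugate F) e≉0 Δ≉0 public

    h‾≈h : h ‾ ≈ h
    h‾≈h = *-cancelˡ-nonzero _ _ Δβ≉0 (begin
      Δβ * h ‾            ≈⟨ *-congʳ Δβ‾ ⟨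
      Δβ ‾ * h ‾          ≈⟨ ‾-* Δβ h ⟨
      (Δβ * h) ‾          ≈⟨ ‾-cong Δβh ⟩
      (m₃ * m₃ ‾) ‾       ≈⟨ norm‾ m₃ ⟩
      m₃ * m₃ ‾           ≈⟨ Δβh ⟨
      Δβ * h              ∎)
      where
      Δβ‾ : Δβ ‾ ≈ Δβ
      Δβ‾ = trans (‾-+ _ _) (+-cong (norm‾ m₃) (norm‾ m₄))

    β-injective : Injective _≈_ _≈_ β
    β-injective {x} {y} eq = ββ₂-injective eq (trans (conjugate-β F x) (trans (‾-cong eq) (sym (conjugate-β F y))))

    -- As β₂ is the conjugate of β, the product α β is w^(qQ+1) at w = β x, up to a nonzero
    -- constant.
    crossed⇒injective : Crossed → Injective _≈_ _≈_ f
    crossed⇒injective crossed@(s₁≈0 , _) {x} {y} fx≈fy = β-injective (x‾ᵠx-injective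
      (*-cancelˡ-nonzero _ _ (λ t₁≈0 → crossed⇒t₁t₂≉0 crossed (trans (*-congʳ t₁≈0) (zeroˡ _))) (begin
        t₁ * (β x ‾ ᵠ * β x)           ≈⟨ scaled-αβ x ⟨
        Δβ ᵠ * (α x * β x)             ≈⟨ *-congˡ (f-determines-αβ fx≈fy) ⟩
        Δβ ᵠ * (α y * β y)             ≈⟨ scaled-αβ y ⟩
        t₁ * (β y ‾ ᵠ * β y)           ∎)))
      where
      scaled-αβ : ∀ x → Δβ ᵠ * (α x * β x) ≈ t₁ * (β x ‾ ᵠ * β x)
      scaled-αβ x = begin
        Δβ ᵠ * (α x * β x)                               ≈⟨ *-assoc _ _ _ ⟨
        Δβ ᵠ * α x * β x                                 ≈⟨ *-congʳ (Δβᵠα x) ⟩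
        (s₁ * β x ᵠ + t₁ * β₂ x ᵠ) * β x                 ≈⟨ *-congʳ (+-cong (trans (*-congʳ s₁≈0) (zeroˡ _)) (*-congˡ (ᵠ-cong (conjugate-β F x)))) ⟩
        (0# + t₁ * β x ‾ ᵠ) * β x                        ≈⟨ solve 3 (λ t x y → (:0 :+ t :* y) :* x := t :* (y :* x)) t₁ (β x) (β x ‾ ᵠ) ⟩
        t₁ * (β x ‾ ᵠ * β x)                             ∎

    -- α₂ β₂ is the conjugate of α β, so α β alone determines f and is injective with it. Written in
    -- w = β x, which runs over the whole field, it is the form of `twisted-form-injective`.
    injective⇒crossed : Injective _≈_ _≈_ f → Crossed
    injective⇒crossed f-injective = s₁≈0 , s₂≈0
      where
      form : Carrier → Carrier
      form w = (s₁ * w ᵠ + t₁ * w ‾ ᵠ) * w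

      form-cong : Congruent _≈_ _≈_ form
      form-cong eq = *-cong (+-cong (*-congˡ (ᵠ-cong eq)) (*-congˡ (ᵠ-cong (‾-cong eq)))) eq

      form-β : ∀ x → form (β x) ≈ Δβ ᵠ * (α x * β x)
      form-β x = trans (*-congʳ (trans (+-congˡ (*-congˡ (ᵠ-cong (sym (conjugate-β F x))))) (sym (Δβᵠα x)))) (*-assoc _ _ _)

      form∘β-injective : ∀ x y → form (β x) ≈ form (β y) → x ≈ y
      form∘β-injective x y eq = f-injective (αβ-determine-f αβ (begin
        α₂ x * β₂ x              ≈⟨ *-cong (conjugate-α F x) (conjugate-β F x) ⟩
        α x ‾ * β x ‾            ≈⟨ ‾-* _ _ ⟨
        (α x * β x) ‾            ≈⟨ ‾-cong αβ ⟩
        (α y * β y) ‾            ≈⟨ ‾-* _ _ ⟩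
        α y ‾ * β y ‾            ≈⟨ *-cong (conjugate-α F y) (conjugate-β F y) ⟨
        α₂ y * β₂ y              ∎))
        where
        αβ : α x * β x ≈ α y * β y
        αβ = *-cancelˡ-nonzero _ _ Δβᵠ≉0 (trans (sym (form-β x)) (trans eq (form-β y)))

      s₁≈0 : s₁ ≈ 0#
      s₁≈0 = twisted-form-injective s₁ t₁ λ {w} {w′} eq →
        let x , βx≈w  = injective⇒surjective (β-cong F) β-injective w
            y , βy≈w′ = injective⇒surjective (β-cong F) β-injective w′
            x≈y = form∘β-injective x y (trans (form-cong βx≈w) (trans eq (sym (form-cong βy≈w′))))
        in trans (sym βx≈w) (trans (β-cong F x≈y) βy≈w′)

      s₂≈0 : s₂ ≈ 0#
      s₂≈0 = begin
        m₂ ‾ * M₄ + m₁ ‾ * M₃            ≈⟨ +-comm _ _ ⟩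
        m₁ ‾ * M₃ + m₂ ‾ * M₄            ≈⟨ +-cong (*-congˡ (ᵠ-cong (‾‾ m₃))) (*-congˡ (ᵠ-cong (‾‾ m₄))) ⟨
        m₁ ‾ * m₃ ‾ ‾ ᵠ + m₂ ‾ * m₄ ‾ ‾ ᵠ ≈⟨ +-cong (*-congˡ (ᵠ‾ (m₃ ‾))) (*-congˡ (ᵠ‾ (m₄ ‾))) ⟨
        m₁ ‾ * N₄ ‾ + m₂ ‾ * N₃ ‾        ≈⟨ ‾-+* m₁ N₄ m₂ N₃ ⟨
        s₁ ‾                             ≈⟨ ‾-cong s₁≈0 ⟩
        0# ‾                             ≈⟨ 0‾ ⟩
        0#                               ∎

  -- Zeros fixed by ‾.

  module RankOne {p p′} (F : Factored p p′) (p≉0 : ¬ p ≈ 0#) (p′≉0 : ¬ p′ ≈ 0#) (norms : p * p ‾ ≈ p′ * p′ ‾)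
                 (m₁m₂≉0 : ¬ (Factored.m₁ F ≈ 0# × Factored.m₂ F ≈ 0#))
                 (m₃m₄≉0 : ¬ (Factored.m₃ F ≈ 0# × Factored.m₄ F ≈ 0#)) where

    open Factored F

    private
      p‾≉0 : ¬ p ‾ ≈ 0#
      p‾≉0 = ^-nonzero q p≉0
      p′‾≉0 : ¬ p′ ‾ ≈ 0#
      p′‾≉0 = ^-nonzero q p′≉0

      conj : ∀ {x y x₁ x₂ x₃ x₄} → p * x + p′ * y ‾ ≈ x₁ * x₂ → p * y + p′ * x ‾ ≈ x₃ * x₄ →
             p * (x₁ ‾ * x₂ ‾) ≈ p′ ‾ * (x₃ * x₄)
      conj {x} {y} {x₁} {x₂} {x₃} {x₄} eq₁ eq₂ = begin
        p * (x₁ ‾ * x₂ ‾)                        ≈⟨ *-congˡ (trans (sym (‾-* x₁ x₂)) (trans (‾-cong (sym eq₁)) (trans (‾-+* p x p′ (y ‾)) (+-congˡ (*-congˡ (‾‾ y)))))) ⟩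
        p * (p ‾ * x ‾ + p′ ‾ * y)               ≈⟨ linear-combination
          (solve 6 (λ p p' q q' x y → p :* (q :* x :+ q' :* y) :+ q' :* (p :* y :+ p' :* x) := x :* (p :* q :+ p' :* q')) p p′ (p ‾) (p′ ‾) (x ‾) y)
          (x ‾ · norms) ⟩
        p′ ‾ * (p * y + p′ * x ‾)                ≈⟨ *-congˡ eq₂ ⟩
        p′ ‾ * (x₃ * x₄)                         ∎

      conj₁₃ : p * (m₁ ‾ * m₃ ‾) ≈ p′ ‾ * (m₂ * m₄)
      conj₁₃ = conj m₁m₃ m₂m₄

      conj₁₄ : p * (m₁ ‾ * m₄ ‾) ≈ p′ ‾ * (m₂ * m₃)
      conj₁₄ = conj m₁m₄ m₂m₃

      cancel₂ : ∀ {x y z} → ¬ x ≈ 0# → ¬ y ≈ 0# → x * (y * z) ≈ 0# → z ≈ 0#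
      cancel₂ x≉0 y≉0 eq = integral y≉0 (integral x≉0 eq)

      0*ˡ : ∀ {x y z} → y ≈ 0# → x * (y * z) ≈ 0#
      0*ˡ y≈0 = trans (*-congˡ (trans (*-congʳ y≈0) (zeroˡ _))) (zeroʳ _)

      0*ʳ : ∀ {x y z} → z ≈ 0# → x * (y * z) ≈ 0#
      0*ʳ z≈0 = trans (*-congˡ (trans (*-congˡ z≈0) (zeroʳ _))) (zeroʳ _)

      zero‾ : ∀ {x} → x ≈ 0# → x ‾ ≈ 0#
      zero‾ x≈0 = trans (‾-cong x≈0) 0‾

      ‾-zero : ∀ {x} → x ‾ ≈ 0# → x ≈ 0#
      ‾-zero {x} x‾≈0 = trans (sym (‾‾ x)) (zero‾ x‾≈0)

      m₁≉0 : ¬ m₁ ≈ 0#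
      m₁≉0 m₁≈0 = m₃m₄≉0 (cancel₂ p′‾≉0 m₂≉0 (trans (sym conj₁₄) (0*ˡ (zero‾ m₁≈0))) , cancel₂ p′‾≉0 m₂≉0 (trans (sym conj₁₃) (0*ˡ (zero‾ m₁≈0))))
        where
        m₂≉0 : ¬ m₂ ≈ 0#
        m₂≉0 m₂≈0 = m₁m₂≉0 (m₁≈0 , m₂≈0)

      m₁‾≉0 : ¬ m₁ ‾ ≈ 0#
      m₁‾≉0 = ^-nonzero q m₁≉0

      m₂≉0 : ¬ m₂ ≈ 0#
      m₂≉0 m₂≈0 = m₃m₄≉0 (‾-zero (cancel₂ p≉0 m₁‾≉0 (trans conj₁₃ (0*ˡ m₂≈0))) , ‾-zero (cancel₂ p≉0 m₁‾≉0 (trans conj₁₄ (0*ˡ m₂≈0))))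

      m₃≉0 : ¬ m₃ ≈ 0#
      m₃≉0 m₃≈0 = m₃m₄≉0 (m₃≈0 , cancel₂ p′‾≉0 m₂≉0 (trans (sym conj₁₃) (0*ʳ (zero‾ m₃≈0))))

      m₄≉0 : ¬ m₄ ≈ 0#
      m₄≉0 m₄≈0 = m₃m₄≉0 (cancel₂ p′‾≉0 m₂≉0 (trans (sym conj₁₄) (0*ʳ (zero‾ m₄≈0))) , m₄≈0)

    -- Equal norms of p and p′ make (p , p′) and (p′ ‾ , p ‾) proportional, so the product α β is
    -- its own conjugate up to a scalar. The ratio of `conj₁₃` and `conj₁₄` shows the same for the
    -- factor β; their product, one of them conjugated, shows it for α in `norms₁₂`.
    norms₃₄ : m₃ * m₃ ‾ ≈ m₄ * m₄ ‾
    norms₃₄ = *-cancelˡ-nonzero _ _ (*-nonzero (*-nonzero p≉0 p′‾≉0) (*-nonzero m₁‾≉0 m₂≉0)) (linear-combination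
      (solve 8 (λ p q m₁ m₂ m₃ m₃' m₄ m₄' → p :* q :* (m₁ :* m₂) :* (m₃ :* m₃') :+ p :* q :* (m₁ :* m₂) :* (m₄ :* m₄')
         := q :* (m₂ :* m₃) :* (p :* (m₁ :* m₃') :+ q :* (m₂ :* m₄)) :+ q :* (m₂ :* m₄) :* (p :* (m₁ :* m₄') :+ q :* (m₂ :* m₃)))
         p (p′ ‾) (m₁ ‾) m₂ m₃ (m₃ ‾) m₄ (m₄ ‾))
      ((p′ ‾ * (m₂ * m₃)) · conj₁₃ ⊞ (p′ ‾ * (m₂ * m₄)) · conj₁₄))

    norms₁₂ : m₁ * m₁ ‾ ≈ m₂ * m₂ ‾
    norms₁₂ = *-cancelˡ-nonzero _ _ (*-nonzero (*-nonzero p≉0 p‾≉0) (*-nonzero (^-nonzero q m₃≉0) m₄≉0)) (linear-combination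
      (solve 10 (λ p p' q q' m₁ m₁' m₂ m₂' m₃' m₄ → p :* q :* (m₃' :* m₄) :* (m₁ :* m₁') :+ p :* q :* (m₃' :* m₄) :* (m₂ :* m₂')
         := q :* (m₁ :* m₄) :* (p :* (m₁' :* m₃') :+ q' :* (m₂ :* m₄))
         :+ q' :* (m₂ :* m₄) :* (q :* (m₁ :* m₄) :+ p' :* (m₂' :* m₃'))
         :+ m₂ :* m₂' :* (m₃' :* m₄) :* (p :* q :+ p' :* q'))
         p p′ (p ‾) (p′ ‾) m₁ (m₁ ‾) m₂ (m₂ ‾) (m₃ ‾) m₄)
      ((p ‾ * (m₁ * m₄)) · conj₁₃ ⊞ (p′ ‾ * (m₂ * m₄)) · conj₁₄‾ ⊞ (m₂ * m₂ ‾ * (m₃ ‾ * m₄)) · norms))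
      where
      conj₁₄‾ : p ‾ * (m₁ * m₄) ≈ p′ * (m₂ ‾ * m₃ ‾)
      conj₁₄‾ = begin
        p ‾ * (m₁ * m₄)                 ≈⟨ *-congˡ (*-cong (‾‾ m₁) (‾‾ m₄)) ⟨
        p ‾ * (m₁ ‾ ‾ * m₄ ‾ ‾)         ≈⟨ *-congˡ (‾-* _ _) ⟨
        p ‾ * (m₁ ‾ * m₄ ‾) ‾           ≈⟨ ‾-* _ _ ⟨
        (p * (m₁ ‾ * m₄ ‾)) ‾           ≈⟨ ‾-cong conj₁₄ ⟩
        (p′ ‾ * (m₂ * m₃)) ‾            ≈⟨ ‾-* _ _ ⟩
        p′ ‾ ‾ * (m₂ * m₃) ‾            ≈⟨ *-cong (‾‾ p′) (‾-* _ _) ⟩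
        p′ * (m₂ ‾ * m₃ ‾)              ∎

    β-parallel : ∀ x y → β x * β y ‾ ≈ β x ‾ * β y
    β-parallel x y = trans (*-congˡ (β‾ y)) (trans (linear-combination
      (solve 8 (λ m₃ m₄ m₃' m₄' x x' y y' →
         (m₃ :* x :+ m₄ :* x') :* (m₃' :* y' :+ m₄' :* y) :+ (m₃' :* x' :+ m₄' :* x) :* (m₃ :* y :+ m₄ :* y')
         := (x :* y' :+ x' :* y) :* (m₃ :* m₃' :+ m₄ :* m₄')) m₃ m₄ (m₃ ‾) (m₄ ‾) x (x ‾) y (y ‾))
      ((x * y ‾ + x ‾ * y) · norms₃₄)) (*-congʳ (sym (β‾ x))))
      where
      β‾ : ∀ x → β x ‾ ≈ m₃ ‾ * x ‾ + m₄ ‾ * x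
      β‾ x = trans (‾-+* m₃ x m₄ (x ‾)) (+-congˡ (*-congˡ (‾‾ x)))

    -- f maps the zeros of α and of β into the same line, so they are parallel.
    injective⇒straight : Injective _≈_ _≈_ f → m₁ * m₄ ᵠ + m₂ * m₃ ᵠ ≈ 0#
    injective⇒straight f-injective =
      integral (^-nonzero Q y≉0) (linear-combination
        (solve 6 (λ m₁ m₂ M₃ M₄ Y Y' → Y :* (m₁ :* M₄ :+ m₂ :* M₃) :+ :0 := M₄ :* (m₁ :* Y :+ m₂ :* Y') :+ m₂ :* (M₃ :* Y :+ M₄ :* Y'))
          m₁ m₂ (m₃ ᵠ) (m₄ ᵠ) (y ᵠ) (y ‾ ᵠ))
        (m₄ ᵠ · m₁Y≈m₂Y′ ⊞ m₂ · M₃Y≈M₄Y′))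
      where
      kernel-β = equal-norms⇒kernel m₄ m₃ (sym norms₃₄)
      kernel-α = equal-norms⇒kernel m₂ m₁ (sym norms₁₂)
      x = proj₁ kernel-β
      x≉0 = proj₁ (proj₂ kernel-β)
      m₃x≈m₄x‾ = proj₂ (proj₂ kernel-β)
      y = proj₁ (ᵠ√ (proj₁ kernel-α))
      yᵠ≈ = proj₂ (ᵠ√ (proj₁ kernel-α))

      y≉0 : ¬ y ≈ 0#
      y≉0 y≈0 = proj₁ (proj₂ kernel-α) (trans (sym yᵠ≈) (trans (ᵠ-cong y≈0) 0ᵠ))

      m₁Y≈m₂Y′ : m₁ * y ᵠ ≈ m₂ * y ‾ ᵠ
      m₁Y≈m₂Y′ = trans (*-congˡ yᵠ≈) (trans (proj₂ (proj₂ kernel-α)) (*-congˡ (trans (‾-cong (sym yᵠ≈)) (ᵠ‾ y))))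

      vanishing : ∀ w → α w * β w ≈ 0# → p * f w ≈ p′ * f w ‾
      vanishing w αβ≈0 = +≈0⇒≈ (trans (factored w) αβ≈0)

      pfx : p * f x ≈ p′ * f x ‾
      pfx = vanishing x (trans (*-congˡ (≈⇒+≈0 m₃x≈m₄x‾)) (zeroʳ _))

      pfy : p * f y ≈ p′ * f y ‾
      pfy = vanishing y (trans (*-congʳ (≈⇒+≈0 m₁Y≈m₂Y′)) (zeroˡ _))

      x∥y : x * y ‾ ≈ x ‾ * y
      x∥y = f-reflects-parallel f-injective x y≉0 (*-cancelˡ-nonzero _ _ p≉0 (linear-combination
        (solve 6 (λ p p' x x' y y' → p :* (x :* y') :+ p :* (x' :* y) := y' :* (p :* x :+ p' :* x') :+ x' :* (p :* y :+ p' :* y'))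
          p p′ (f x) (f x ‾) (f y) (f y ‾))
        (f y ‾ · pfx ⊞ f x ‾ · pfy)))

      m₃y≈m₄y‾ : m₃ * y ≈ m₄ * y ‾
      m₃y≈m₄y‾ = *-cancelˡ-nonzero _ _ x≉0 (linear-combination
        (solve 6 (λ m₃ m₄ x x' y y' → x :* (m₃ :* y) :+ x :* (m₄ :* y') := y :* (m₃ :* x :+ m₄ :* x') :+ m₄ :* (x :* y' :+ x' :* y))
          m₃ m₄ x (x ‾) y (y ‾))
        (y · m₃x≈m₄x‾ ⊞ m₄ · x∥y))

      M₃Y≈M₄Y′ : m₃ ᵠ * y ᵠ ≈ m₄ ᵠ * y ‾ ᵠ
      M₃Y≈M₄Y′ = trans (sym (ᵠ-* m₃ y)) (trans (ᵠ-cong m₃y≈m₄y‾) (ᵠ-* m₄ (y ‾)))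

  module Split {p p′ r r′} (F : Factored p p′) (G : Factored r r′) (e≉0 : ¬ e ≈ 0#) (Δ≉0 : ¬ p * r′ + p′ * r ≈ 0#)
               (p≉0 : ¬ p ≈ 0#) (p′≉0 : ¬ p′ ≈ 0#) (norms-p : p * p ‾ ≈ p′ * p′ ‾)
               (r≉0 : ¬ r ≈ 0#) (r′≉0 : ¬ r′ ≈ 0#) (norms-r : r * r ‾ ≈ r′ * r′ ‾) where

    open Pair F G e≉0 Δ≉0 public

    private
      0+0 : ∀ {x y z w} → x ≈ 0# → y ≈ 0# → x * z + y * w ≈ 0#
      0+0 x≈0 y≈0 = trans (+-cong (trans (*-congʳ x≈0) (zeroˡ _)) (trans (*-congʳ y≈0) (zeroˡ _))) (+-identityˡ 0#)

      0+0′ : ∀ {x y z w} → x ≈ 0# → y ≈ 0# → z * y + w * x ≈ 0#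
      0+0′ x≈0 y≈0 = trans (+-cong (trans (*-congˡ y≈0) (zeroʳ _)) (trans (*-congˡ x≈0) (zeroʳ _))) (+-identityˡ 0#)

      m₁m₂≉0 : ¬ (m₁ ≈ 0# × m₂ ≈ 0#)
      m₁m₂≉0 (m₁≈0 , m₂≈0) = Δα≉0 (0+0 m₁≈0 m₂≈0)

      m₃m₄≉0 : ¬ (m₃ ≈ 0# × m₄ ≈ 0#)
      m₃m₄≉0 (m₃≈0 , m₄≈0) = Δβ≉0 (0+0 m₃≈0 m₄≈0)

      n₁n₂≉0 : ¬ (n₁ ≈ 0# × n₂ ≈ 0#)
      n₁n₂≉0 (n₁≈0 , n₂≈0) = Δα≉0 (0+0′ n₁≈0 n₂≈0)

      n₃n₄≉0 : ¬ (n₃ ≈ 0# × n₄ ≈ 0#)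
      n₃n₄≉0 (n₃≈0 , n₄≈0) = Δβ≉0 (0+0′ n₃≈0 n₄≈0)

      module F₁ = RankOne F p≉0 p′≉0 norms-p m₁m₂≉0 m₃m₄≉0
      module F₂ = RankOne G r≉0 r′≉0 norms-r n₁n₂≉0 n₃n₄≉0

    injective⇒straight : Injective _≈_ _≈_ f → Straight
    injective⇒straight f-injective = F₁.injective⇒straight f-injective , F₂.injective⇒straight f-injective

    -- Each of β and β₂ takes its values in one line over 𝔽_q, and along such a line w ↦ w^(Q+1) is
    -- injective.
    straight⇒injective : Straight → Injective _≈_ _≈_ f
    straight⇒injective straight@(t₁≈0 , t₂≈0) {x} {y} fx≈fy = ββ₂-injective
      (xᵠx-injective (F₁.β-parallel x y) (*-cancelˡ-nonzero _ _ s₁≉0 (begin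
        s₁ * (β x ᵠ * β x)        ≈⟨ scaled-αβ x ⟨
        Δβ ᵠ * (α x * β x)        ≈⟨ *-congˡ (f-determines-αβ fx≈fy) ⟩
        Δβ ᵠ * (α y * β y)        ≈⟨ scaled-αβ y ⟩
        s₁ * (β y ᵠ * β y)        ∎)))
      (xᵠx-injective (F₂.β-parallel x y) (*-cancelˡ-nonzero _ _ s₂≉0 (begin
        s₂ * (β₂ x ᵠ * β₂ x)      ≈⟨ scaled-α₂β₂ x ⟨
        Δβ ᵠ * (α₂ x * β₂ x)      ≈⟨ *-congˡ (f-determines-α₂β₂ fx≈fy) ⟩
        Δβ ᵠ * (α₂ y * β₂ y)      ≈⟨ scaled-α₂β₂ y ⟩
        s₂ * (β₂ y ᵠ * β₂ y)      ∎)))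
      where
      s₁≉0 : ¬ s₁ ≈ 0#
      s₁≉0 s₁≈0 = straight⇒s₁s₂≉0 straight (trans (*-congʳ s₁≈0) (zeroˡ _))
      s₂≉0 : ¬ s₂ ≈ 0#
      s₂≉0 s₂≈0 = straight⇒s₁s₂≉0 straight (trans (*-congˡ s₂≈0) (zeroʳ _))
      scaled-αβ : ∀ x → Δβ ᵠ * (α x * β x) ≈ s₁ * (β x ᵠ * β x)
      scaled-αβ x = trans (sym (*-assoc _ _ _)) (trans (*-congʳ (Δβᵠα x)) (linear-combination
        (solve 5 (λ s t x X Y → (s :* X :+ t :* Y) :* x :+ s :* (X :* x) := Y :* x :* (t :+ :0)) s₁ t₁ (β x) (β x ᵠ) (β₂ x ᵠ))
        ((β₂ x ᵠ * β x) · t₁≈0)))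
      scaled-α₂β₂ : ∀ x → Δβ ᵠ * (α₂ x * β₂ x) ≈ s₂ * (β₂ x ᵠ * β₂ x)
      scaled-α₂β₂ x = trans (sym (*-assoc _ _ _)) (trans (*-congʳ (Δβᵠα₂ x)) (linear-combination
        (solve 5 (λ s t x X Y → (t :* X :+ s :* Y) :* x :+ s :* (Y :* x) := X :* x :* (t :+ :0)) s₂ t₂ (β₂ x) (β x ᵠ) (β₂ x ᵠ))
        ((β x ᵠ * β₂ x) · t₂≈0)))

    -- The norm relations of β and β₂ turn the conjugate of h = m₃ n₄ / Δβ into m₄ n₃ / Δβ, and the
    -- two numerators add up to Δβ.
    h‾+h≈1 : h ‾ + h ≈ 1#
    h‾+h≈1 = *-cancelˡ-nonzero _ _ Δβ≉0 (begin
      Δβ * (h ‾ + h)              ≈⟨ distribˡ _ _ _ ⟩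
      Δβ * h ‾ + Δβ * h           ≈⟨ +-cong Δβh‾ Δβh ⟩
      m₄ * n₃ + m₃ * n₄           ≈⟨ +-comm _ _ ⟩
      Δβ                          ≈⟨ *-identityʳ Δβ ⟨
      Δβ * 1#                     ∎)
      where
      Δβ‾ : Δβ ‾ ≈ m₃ ‾ * n₄ ‾ + m₄ ‾ * n₃ ‾
      Δβ‾ = ‾-+* m₃ n₄ m₄ n₃
      Δβ‾h‾ : Δβ ‾ * h ‾ ≈ m₃ ‾ * n₄ ‾
      Δβ‾h‾ = trans (sym (‾-* Δβ h)) (trans (‾-cong Δβh) (‾-* m₃ n₄))
      Δβh‾ : Δβ * h ‾ ≈ m₄ * n₃
      Δβh‾ = *-cancelˡ-nonzero _ _ (^-nonzero q Δβ≉0) (begin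
        Δβ ‾ * (Δβ * h ‾)                            ≈⟨ solve 3 (λ x y z → x :* (y :* z) := y :* (x :* z)) (Δβ ‾) Δβ (h ‾) ⟩
        Δβ * (Δβ ‾ * h ‾)                            ≈⟨ *-congˡ Δβ‾h‾ ⟩
        Δβ * (m₃ ‾ * n₄ ‾)                           ≈⟨ linear-combination
          (solve 8 (λ m₃ m₃' m₄ m₄' n₃ n₃' n₄ n₄' →
             (m₃ :* n₄ :+ m₄ :* n₃) :* (m₃' :* n₄') :+ (m₃' :* n₄' :+ m₄' :* n₃') :* (m₄ :* n₃)
             := n₄ :* n₄' :* (m₃ :* m₃' :+ m₄ :* m₄') :+ m₄ :* m₄' :* (n₃ :* n₃' :+ n₄ :* n₄'))
             m₃ (m₃ ‾) m₄ (m₄ ‾) n₃ (n₃ ‾) n₄ (n₄ ‾))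
          ((n₄ * n₄ ‾) · F₁.norms₃₄ ⊞ (m₄ * m₄ ‾) · F₂.norms₃₄) ⟩
        (m₃ ‾ * n₄ ‾ + m₄ ‾ * n₃ ‾) * (m₄ * n₃)      ≈⟨ *-congʳ Δβ‾ ⟨
        Δβ ‾ * (m₄ * n₃)                             ∎)

  -- The zeros of the pencil, and the criterion for e ≠ 0.

  trace-0 : ∀ n → trace n 0# ≈ 0#
  trace-0 n = trans (trace-cong n (sym (+-identityˡ 0#))) (trans (trace-+ n 0# 0#) (x+x≈0 _))

  module _ (e≉0 : ¬ e ≈ 0#) {ν : Carrier} (eν≈n : e * ν ≈ n) where

    -- Condition (2) appears multiplied by e, which removes the exponent Q - 1; ν is the quotient n
    -- / e.
    Conditions : Set r₂
    Conditions = γ ᵠ * e ≈ e ᵠ * δ × trace k ν ≈ 1#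

    private
      -- For z² + z = θ θ′ / e², the vector (e z , θ) is a zero of θ p² + e p p′ + θ′ p′²,
      -- and so is (e (z + 1) , θ).
      isotropic : ∀ {z} → e * e * (z * z + z) ≈ θ * θ′ →
                  θ * ((e * z) * (e * z)) + e * ((e * z) * θ) + θ′ * (θ * θ) ≈ 0#
      isotropic {z} eq = linear-combination
        (solve 4 (λ e z t t' → t :* ((e :* z) :* (e :* z)) :+ e :* ((e :* z) :* t) :+ t' :* (t :* t) :+ :0
                  := t :* (e :* e :* (z :* z :+ z) :+ t :* t')) e z θ θ′)
        (θ · eq)

      e²z² : ∀ {z w} → z ‾ ≈ w → (e * z) * (e * z) ‾ ≈ e * e * (z * w)
      e²z² {z} {w} z‾≈w = trans (*-congˡ (trans (‾-* e z) (*-cong e‾ z‾≈w))) (solve 3 (λ e z w → e :* z :* (e :* w) := e :* e :* (z :* w)) e z w)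

      -- For z in 𝔽_q the norms of e z and θ differ by e² z ≠ 0, so the zero (e z , θ) and its
      -- conjugate (θ ‾ , e z) are distinct.
      nonsplit : ∀ {z} → ¬ z ≈ 0# → e * e * (z * z + z) ≈ θ * θ′ → z ‾ ≈ z →
                 (Injective _≈_ _≈_ f → Conditions) × (Conditions → Injective _≈_ _≈_ f)
      nonsplit {z} z≉0 z-root z‾≈z = necessary , sufficient
        where
        Δ≉0 : ¬ e * z * (e * z) ‾ + θ * θ ‾ ≈ 0#
        Δ≉0 eq = *-nonzero (*-nonzero e≉0 e≉0) z≉0 (begin
          e * e * z                              ≈⟨ linear-combination
            (solve 4 (λ e z t t' → e :* e :* z :+ (e :* e :* (z :* z) :+ t :* t') := :1 :* (e :* e :* (z :* z :+ z) :+ t :* t')) e z θ θ′)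
            (1# · z-root) ⟩
          e * e * (z * z) + θ * θ′               ≈⟨ +-cong (e²z² z‾≈z) (*-congˡ θ‾) ⟨
          e * z * (e * z) ‾ + θ * θ ‾            ≈⟨ eq ⟩
          0#                                     ∎)

        open NonSplit (factor (isotropic z-root)) e≉0 Δ≉0

        trace-h : trace ℓ (h ‾ + h) ≈ 0#
        trace-h = trans (trace-cong ℓ (≈⇒+≈0 h‾≈h)) (trace-0 ℓ)

        necessary : Injective _≈_ _≈_ f → Conditions
        necessary f-injective = let crossed = injective⇒crossed f-injective in
          proportional⇒condition (crossed⇒proportional crossed) ,
          trans (crossed⇒trace eν≈n crossed) (trans (+-congʳ trace-h) (+-identityˡ 1#))

        sufficient : Conditions → Injective _≈_ _≈_ f
        sufficient (condition , trace≈1) = [ (λ straight → contradiction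
            (trans (sym trace≈1) (trans (straight⇒trace eν≈n straight) trace-h)) 1≉0) , crossed⇒injective ]′
          (condition⇒straight⊎crossed condition)

      -- Here e z has norm e² z (z + 1) = θ θ ‾, and so has e (z + 1): either zero is its own
      -- conjugate up to a scalar.
      split : ∀ {z} → ¬ z ≈ 0# → e * e * (z * z + z) ≈ θ * θ′ → z ‾ ≈ z + 1# →
              (Injective _≈_ _≈_ f → Conditions) × (Conditions → Injective _≈_ _≈_ f)
      split {z} z≉0 z-root z‾≈z+1 = necessary , sufficient
        where
        w-root : e * e * ((z + 1#) * (z + 1#) + (z + 1#)) ≈ θ * θ′
        w-root = trans (solve 2 (λ e z → e :* e :* ((z :+ :1) :* (z :+ :1) :+ (z :+ :1)) := e :* e :* (z :* z :+ z)) e z) z-root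

        w≉0 : ¬ z + 1# ≈ 0#
        w≉0 w≈0 = ^-nonzero q z≉0 (trans z‾≈z+1 w≈0)

        w‾≈z : (z + 1#) ‾ ≈ z
        w‾≈z = trans (‾-cong (sym z‾≈z+1)) (‾‾ z)

        norms-p : (e * z) * (e * z) ‾ ≈ θ * θ ‾
        norms-p = trans (e²z² z‾≈z+1) (trans (solve 2 (λ e z → e :* e :* (z :* (z :+ :1)) := e :* e :* (z :* z :+ z)) e z)
          (trans z-root (*-congˡ (sym θ‾))))

        norms-r : (e * (z + 1#)) * (e * (z + 1#)) ‾ ≈ θ * θ ‾
        norms-r = trans (e²z² w‾≈z) (trans (solve 2 (λ e z → e :* e :* ((z :+ :1) :* z) := e :* e :* (z :* z :+ z)) e z)
          (trans z-root (*-congˡ (sym θ‾))))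

        p≉0 : ¬ e * z ≈ 0#
        p≉0 = *-nonzero e≉0 z≉0

        θ≉0 : ¬ θ ≈ 0#
        θ≉0 θ≈0 = *-nonzero p≉0 (^-nonzero q p≉0) (trans norms-p (trans (*-congʳ θ≈0) (zeroˡ _)))

        Δ≉0 : ¬ e * z * θ + θ * (e * (z + 1#)) ≈ 0#
        Δ≉0 eq = *-nonzero e≉0 θ≉0 (trans
          (solve 3 (λ e z t → e :* t := e :* z :* t :+ t :* (e :* (z :+ :1))) e z θ) eq)

        open Split (factor (isotropic z-root)) (factor (isotropic w-root)) e≉0 Δ≉0
          p≉0 θ≉0 norms-p (*-nonzero e≉0 w≉0) θ≉0 norms-r

        trace-h : trace ℓ (h ‾ + h) ≈ 1#
        trace-h = trans (trace-cong ℓ h‾+h≈1) (trace-1-odd j)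

        necessary : Injective _≈_ _≈_ f → Conditions
        necessary f-injective = let straight = injective⇒straight f-injective in
          proportional⇒condition (straight⇒proportional straight) , trans (straight⇒trace eν≈n straight) trace-h

        sufficient : Conditions → Injective _≈_ _≈_ f
        sufficient (condition , trace≈1) = [ straight⇒injective , (λ crossed → contradiction
            (trans (sym trace≈1) (trans (crossed⇒trace eν≈n crossed) (trans (+-congʳ trace-h) 1+1≈0))) 1≉0) ]′
          (condition⇒straight⊎crossed condition)

      -- z = 0 must be avoided: it occurs only when θ = 0, where (e z , θ) would be the zero vector.
      -- The other root, 1, is taken instead.
      root : ∃[ z ] ¬ z ≈ 0# × e * e * (z * z + z) ≈ θ * θ′ × (z ‾ ≈ z ⊎ z ‾ ≈ z + 1#)
      root = normalise (z₀ ≟ 0#)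
        where
        e⁻¹ = proj₁ (inverse e e≉0)
        ee⁻¹≈1 = proj₂ (inverse e e≉0)
        u = θ * θ′ * (e⁻¹ * e⁻¹)
        e²u : e * e * u ≈ θ * θ′
        e²u = linear-combination
          (solve 3 (λ e i t → e :* e :* (t :* (i :* i)) :+ t := t :* (e :* i :+ :1) :* (e :* i :+ :1)) e e⁻¹ (θ * θ′))
          ((θ * θ′ * (e * e⁻¹ + 1#)) · ee⁻¹≈1)
        u‾≈u : u ‾ ≈ u
        u‾≈u = *-cancelˡ-nonzero _ _ (*-nonzero e≉0 e≉0) (begin
          e * e * u ‾              ≈⟨ *-congʳ (*-cong e‾ e‾) ⟨
          e ‾ * e ‾ * u ‾          ≈⟨ *-congʳ (‾-* e e) ⟨
          (e * e) ‾ * u ‾          ≈⟨ ‾-* (e * e) u ⟨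
          (e * e * u) ‾            ≈⟨ ‾-cong e²u ⟩
          (θ * θ′) ‾               ≈⟨ ‾-* θ θ′ ⟩
          θ ‾ * θ′ ‾               ≈⟨ *-cong θ‾ θ′‾ ⟩
          θ′ * θ                   ≈⟨ *-comm θ′ θ ⟩
          θ * θ′                   ≈⟨ e²u ⟨
          e * e * u                ∎)
        z₀ = proj₁ (artin-schreier u u‾≈u)
        z₀²+z₀≈u = proj₂ (artin-schreier u u‾≈u)

        conjugate-root : ∀ {z} → z * z + z ≈ u → z ‾ ≈ z ⊎ z ‾ ≈ z + 1#
        conjugate-root {z} eq = [ (λ z‾+z≈0 → inj₁ (+≈0⇒≈ z‾+z≈0))
                                , (λ z‾+z≈1 → inj₂ (linear-combination (solve 2 (λ z z' → z' :+ (z :+ :1) := :1 :* (z' :+ z :+ :1)) z (z ‾)) (1# · z‾+z≈1))) ]′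
          (idempotent (linear-combination
            (solve 3 (λ z z' u → (z' :+ z) :* (z' :+ z) :+ (z' :+ z) := :1 :* (z' :* z' :+ z' :+ u) :+ :1 :* (z :* z :+ z :+ u)) z (z ‾) u)
            (1# · z‾²+z‾≈u ⊞ 1# · eq)))
          where
          z‾²+z‾≈u : z ‾ * z ‾ + z ‾ ≈ u
          z‾²+z‾≈u = trans (+-congʳ (sym (‾-* z z))) (trans (sym (‾-+ (z * z) z)) (trans (‾-cong eq) u‾≈u))

        normalise : Dec (z₀ ≈ 0#) → ∃[ z ] ¬ z ≈ 0# × e * e * (z * z + z) ≈ θ * θ′ × (z ‾ ≈ z ⊎ z ‾ ≈ z + 1#)
        normalise (no z₀≉0)  = z₀ , z₀≉0 , trans (*-congˡ z₀²+z₀≈u) e²u , conjugate-root z₀²+z₀≈u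
        normalise (yes z₀≈0) = 1# , 1≉0 , trans (*-congˡ 1²+1≈u) e²u , conjugate-root 1²+1≈u
          where
          1²+1≈u : 1# * 1# + 1# ≈ u
          1²+1≈u = trans (solve 0 (:1 :* :1 :+ :1 := :0 :* :0 :+ :0)) (trans (sym (+-cong (*-cong z₀≈0 z₀≈0) z₀≈0)) z₀²+z₀≈u)

    criterion : (Injective _≈_ _≈_ f → Conditions) × (Conditions → Injective _≈_ _≈_ f)
    criterion = let z , z≉0 , z-root , z‾≈ = root in [ nonsplit z≉0 z-root , split z≉0 z-root ]′ z‾≈

-- Evaluation of polynomials.

module PolynomialEvaluation {r₁ r₂} (R : CommutativeRing r₁ r₂) where

  open CommutativeRing R hiding (zero)
  open Polynomials R
  open Exp commutativeSemiring
  open SetoidReasoning setoid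
  open CommutativeSemigroupProperties +-commutativeSemigroup using (interchange)
  open CommutativeSemigroupProperties *-commutativeSemigroup using (x∙yz≈y∙xz)

  eval-cong : ∀ f → Congruent _≈_ _≈_ (eval f)
  eval-cong []      x≈y = refl
  eval-cong (a ∷ f) x≈y = +-congˡ (*-cong x≈y (eval-cong f x≈y))

  eval-⊕ : ∀ f g x → eval (f ⊕ g) x ≈ eval f x + eval g x
  eval-⊕ []      g       x = sym (+-identityˡ _)
  eval-⊕ (a ∷ f) []      x = sym (+-identityʳ _)
  eval-⊕ (a ∷ f) (b ∷ g) x = begin
    a + b + x * eval (f ⊕ g) x              ≈⟨ +-congˡ (trans (*-congˡ (eval-⊕ f g x)) (distribˡ x _ _)) ⟩
    a + b + (x * eval f x + x * eval g x)   ≈⟨ interchange _ _ _ _ ⟩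
    a + x * eval f x + (b + x * eval g x)   ∎

  eval-map : ∀ a f x → eval (map (a *_) f) x ≈ a * eval f x
  eval-map a []      x = sym (zeroʳ a)
  eval-map a (b ∷ f) x = begin
    a * b + x * eval (map (a *_) f) x   ≈⟨ +-congˡ (trans (*-congˡ (eval-map a f x)) (x∙yz≈y∙xz x a _)) ⟩
    a * b + a * (x * eval f x)          ≈⟨ distribˡ a _ _ ⟨
    a * (b + x * eval f x)              ∎

  eval-⊗ : ∀ f g x → eval (f ⊗ g) x ≈ eval f x * eval g x
  eval-⊗ []      g x = sym (zeroˡ _)
  eval-⊗ (a ∷ f) g x = begin
    eval (map (a *_) g ⊕ (0# ∷ f ⊗ g)) x          ≈⟨ eval-⊕ (map (a *_) g) (0# ∷ f ⊗ g) x ⟩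
    eval (map (a *_) g) x + (0# + x * eval (f ⊗ g) x)
      ≈⟨ +-cong (eval-map a g x) (trans (+-identityˡ _) (trans (*-congˡ (eval-⊗ f g x)) (sym (*-assoc _ _ _)))) ⟩
    a * eval g x + x * eval f x * eval g x        ≈⟨ distribʳ _ _ _ ⟨
    (a + x * eval f x) * eval g x                 ∎

  eval-const : ∀ a x → eval (const a) x ≈ a
  eval-const a x = trans (+-congˡ (zeroʳ x)) (+-identityʳ a)

  eval-X : ∀ x → eval X x ≈ x
  eval-X x = trans (+-identityˡ _) (trans (*-congˡ (eval-const 1# x)) (*-identityʳ x))

  eval-↑ : ∀ f n x → eval (f ↑ n) x ≈ eval f x ^ n
  eval-↑ f zero    x = eval-const 1# x
  eval-↑ f (suc n) x = trans (eval-⊗ f (f ↑ n) x) (*-congˡ (eval-↑ f n x))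

  eval-X↑ : ∀ n x → eval (X ↑ n) x ≈ x ^ n
  eval-X↑ n x = trans (eval-↑ X n x) (^-congˡ n (eval-X x))

  eval-⟨⟩ : ∀ f g x → eval (f ⟨ g ⟩) x ≈ eval f (eval g x)
  eval-⟨⟩ []      g x = refl
  eval-⟨⟩ (a ∷ f) g x = begin
    eval (const a ⊕ g ⊗ f ⟨ g ⟩) x                ≈⟨ eval-⊕ (const a) (g ⊗ f ⟨ g ⟩) x ⟩
    eval (const a) x + eval (g ⊗ f ⟨ g ⟩) x       ≈⟨ +-cong (eval-const a x) (eval-⊗ g (f ⟨ g ⟩) x) ⟩
    a + eval g x * eval (f ⟨ g ⟩) x               ≈⟨ +-congˡ (*-congˡ (eval-⟨⟩ f g x)) ⟩
    a + eval g x * eval f (eval g x)              ∎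

-- From apartness and coefficient lists to the criterion.

module _ {r₁ r₂ r₃} (F : HeytingField r₁ r₂ r₃) where

  open HeytingField F hiding (zero)
  open FieldNotions F

  private
    R : CommutativeRing r₁ r₂
    R = HeytingCommutativeRing.commutativeRing (HeytingField.heytingCommutativeRing F)

  #0⇒≉0 : ∀ {x} → x # 0# → ¬ x ≈ 0#
  #0⇒≉0 x#0 x≈0 = proj₂ (tight _ _) x≈0 x#0

  invertible⇒#0 : ∀ {x y} → x * y ≈ 1# → x # 0#
  invertible⇒#0 {x} {y} xy≈1 = invertible⇒# (y , trans (*-comm _ _) eq , eq)
    where
    open AbelianGroupProperties (CommutativeRing.+-abelianGroup R) using (ε⁻¹≈ε)
    eq : (x - 0#) * y ≈ 1#
    eq = trans (*-congʳ (trans (+-congˡ ε⁻¹≈ε) (+-identityʳ x))) xy≈1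

  1≉0 : ¬ 1# ≈ 0#
  1≉0 = #0⇒≉0 (invertible⇒#0 (*-identityʳ 1#))

  -- Being invertible is decidable by enumeration, which turns ¬ ¬ (x # 0#) into invertibility.
  finite⇒inverse : ∀ {n} → HasCardinality n → ∀ x → ¬ x ≈ 0# → ∃[ y ] x * y ≈ 1#
  finite⇒inverse enumeration x x≉0 =
    let i , eq = decidable-stable (Fin.any? (λ i → (x * from i) ≟ 1#)) λ none → x≉0 (proj₁ (tight _ _) λ x#0 →
          let y , _ , xy≈1 = #0⇒invertible x#0
          in none (to y , trans (*-congˡ (strictlyInverseʳ y)) xy≈1))
    in from i , eq
    where
    open Inverse enumeration using (to; from; strictlyInverseʳ)
    _≟_ = via-injection (Inverse⇒Injection enumeration) Fin._≟_

  module _ (i j : ℕ) (cardinality : HasCardinality ((2 ℕ.^ suc (i ℕ.* 2)) ℕ.^ 2)) (a b c d : Carrier) where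

    private
      enumeration : HasCardinality (2 ℕ.^ (suc (i ℕ.* 2) ℕ.* 2))
      enumeration = ≡.subst HasCardinality (ℕ.^-*-assoc 2 (suc (i ℕ.* 2)) 2) cardinality

      isFiniteField : IsFiniteField R (2 ℕ.^ (suc (i ℕ.* 2) ℕ.* 2))
      isFiniteField = record { 1≉0 = 1≉0 ; inverse = finite⇒inverse enumeration ; enumeration = enumeration }

    open QuadraticExtension R i j isFiniteField
      using (k; ℓ; q; Q; _‾; _ᵠ; ᵠ-*; ᵠ-cong; inverse; *-cancelˡ-nonzero; injective⇒surjective; solve; _:+_; _:*_; _:=_)
    open Quadrinomial R i j isFiniteField a b c d
      using (e; n; γ; δ; f; f-injective⇒e≉0; criterion)
    open Exp (CommutativeRing.commutativeSemiring R) using (^-congˡ; ^-congʳ)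
    open PolynomialEvaluation R
    open SetoidReasoning setoid

    private
      A poly : Poly
      A = const a ⊗ X ↑ (Q ℕ.+ 1) ⊕ const b ⊗ X ↑ Q ⊕ const c ⊗ X ⊕ const d
      poly = X ↑ (Q ℕ.+ 1) ⊗ A ⟨ X ↑ (q ℕ.∸ 1) ⟩

      e₀ n₀ : Carrier
      e₀ = a ^ (q ℕ.+ 1) + b ^ (q ℕ.+ 1) + c ^ (q ℕ.+ 1) + d ^ (q ℕ.+ 1)
      n₀ = b ^ (q ℕ.+ 1) + c ^ (q ℕ.+ 1)

      ^+1 : ∀ x m → x ^ (m ℕ.+ 1) ≈ x * x ^ m
      ^+1 x m = ^-congʳ x (ℕ.+-comm m 1)

      e₀≈e : e₀ ≈ e
      e₀≈e = +-cong (+-cong (+-cong (^+1 a q) (^+1 b q)) (^+1 c q)) (^+1 d q)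

      n₀≈n : n₀ ≈ n
      n₀≈n = +-cong (^+1 b q) (^+1 c q)

      eval-term : ∀ s g w → eval (const s ⊗ g) w ≈ s * eval g w
      eval-term s g w = trans (eval-⊗ (const s) g w) (*-congʳ (eval-const s w))

      eval-A : ∀ w → eval A w ≈ a * (w * w ᵠ) + b * w ᵠ + c * w + d
      eval-A w = trans (eval-⊕ (const a ⊗ X ↑ (Q ℕ.+ 1) ⊕ const b ⊗ X ↑ Q ⊕ const c ⊗ X) (const d) w) (+-cong
        (trans (eval-⊕ (const a ⊗ X ↑ (Q ℕ.+ 1) ⊕ const b ⊗ X ↑ Q) (const c ⊗ X) w) (+-cong
          (trans (eval-⊕ (const a ⊗ X ↑ (Q ℕ.+ 1)) (const b ⊗ X ↑ Q) w) (+-cong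
            (trans (eval-term a (X ↑ (Q ℕ.+ 1)) w) (*-congˡ (trans (eval-X↑ (Q ℕ.+ 1) w) (^+1 w Q))))
            (trans (eval-term b (X ↑ Q) w) (*-congˡ (eval-X↑ Q w)))))
          (trans (eval-term c X w) (*-congˡ (eval-X w)))))
        (eval-const d w))

      -- For w = x^(q-1), the factor x x^Q pairs each w with an x and each w^Q with an x^Q. As x w =
      -- x^q is an identity of exponents, x = 0 is no exception.
      eval-poly : ∀ x → eval poly x ≈ f x
      eval-poly x = begin
        eval poly x
          ≈⟨ eval-⊗ (X ↑ (Q ℕ.+ 1)) (A ⟨ X ↑ (q ℕ.∸ 1) ⟩) x ⟩
        eval (X ↑ (Q ℕ.+ 1)) x * eval (A ⟨ X ↑ (q ℕ.∸ 1) ⟩) x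
          ≈⟨ *-cong (trans (eval-X↑ (Q ℕ.+ 1) x) (^+1 x Q))
               (trans (eval-⟨⟩ A (X ↑ (q ℕ.∸ 1)) x) (trans (eval-cong A (eval-X↑ (q ℕ.∸ 1) x)) (eval-A w))) ⟩
        x * x ᵠ * (a * (w * w ᵠ) + b * w ᵠ + c * w + d)
          ≈⟨ solve 8 (λ a b c d x X w W → x :* X :* (a :* (w :* W) :+ b :* W :+ c :* w :+ d)
               := a :* ((X :* W) :* (x :* w)) :+ b :* ((X :* W) :* x) :+ c :* (X :* (x :* w)) :+ d :* (X :* x)) a b c d x (x ᵠ) w (w ᵠ) ⟩
        a * ((x ᵠ * w ᵠ) * (x * w)) + b * ((x ᵠ * w ᵠ) * x) + c * (x ᵠ * (x * w)) + d * (x ᵠ * x)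
          ≈⟨ +-congʳ (+-cong (+-cong (*-congˡ (*-cong XW xw)) (*-congˡ (*-congʳ XW))) (*-congˡ (*-congˡ xw))) ⟩
        f x
          ∎
        where
        w = x ^ (q ℕ.∸ 1)
        xw : x * w ≈ x ‾
        xw = ^-congʳ x (ℕ.m+[n∸m]≡n (ℕ.m^n>0 2 k))
        XW : x ᵠ * w ᵠ ≈ x ‾ ᵠ
        XW = trans (sym (ᵠ-* x w)) (ᵠ-cong xw)

      permutes⇒injective : Permutes poly → Injective _≈_ _≈_ f
      permutes⇒injective (poly-injective , _) {x} {y} fx≈fy = poly-injective (trans (eval-poly x) (trans fx≈fy (sym (eval-poly y))))

      injective⇒permutes : Injective _≈_ _≈_ f → Permutes poly
      injective⇒permutes f-injective = poly-injective , λ y →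
        let x , eq = injective⇒surjective (eval-cong poly) poly-injective y
        in x , λ z≈x → trans (eval-cong poly z≈x) eq
        where
        poly-injective : Injective _≈_ _≈_ (eval poly)
        poly-injective {x} {y} eq = f-injective (trans (sym (eval-poly x)) (trans eq (eval-poly y)))

      e₀^Q-1 : e * e₀ ^ (Q ℕ.∸ 1) ≈ e ᵠ
      e₀^Q-1 = trans (*-congˡ (^-congˡ (Q ℕ.∸ 1) e₀≈e)) (^-congʳ e (ℕ.m+[n∸m]≡n (ℕ.m^n>0 2 ℓ)))

      condition⇒ : ¬ e ≈ 0# → γ ᵠ * e ≈ e ᵠ * δ → γ ᵠ ≈ e₀ ^ (Q ℕ.∸ 1) * δ
      condition⇒ e≉0 eq = *-cancelˡ-nonzero _ _ e≉0 (begin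
        e * γ ᵠ                        ≈⟨ *-comm _ _ ⟩
        γ ᵠ * e                        ≈⟨ eq ⟩
        e ᵠ * δ                        ≈⟨ *-congʳ e₀^Q-1 ⟨
        e * e₀ ^ (Q ℕ.∸ 1) * δ         ≈⟨ *-assoc _ _ _ ⟩
        e * (e₀ ^ (Q ℕ.∸ 1) * δ)       ∎)

      ⇒condition : γ ᵠ ≈ e₀ ^ (Q ℕ.∸ 1) * δ → γ ᵠ * e ≈ e ᵠ * δ
      ⇒condition eq = begin
        γ ᵠ * e                        ≈⟨ *-comm _ _ ⟩
        e * γ ᵠ                        ≈⟨ *-congˡ eq ⟩
        e * (e₀ ^ (Q ℕ.∸ 1) * δ)       ≈⟨ *-assoc _ _ _ ⟨
        e * e₀ ^ (Q ℕ.∸ 1) * δ         ≈⟨ *-congʳ e₀^Q-1 ⟩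
        e ᵠ * δ                        ∎

      quotient-n/e : (e#0 : e₀ # 0#) → e * divide n₀ e₀ e#0 ≈ n
      quotient-n/e e#0 = let y , _ , e₀y≈1 = #0⇒invertible e#0 in begin
        e * (n₀ * y)     ≈⟨ *-cong e₀≈e (*-congʳ (sym n₀≈n)) ⟨
        e₀ * (n * y)     ≈⟨ solve 3 (λ e n y → e :* (n :* y) := n :* (e :* y)) e₀ n y ⟩
        n * (e₀ * y)     ≈⟨ *-congˡ e₀y≈1 ⟩
        n * 1#           ≈⟨ *-identityʳ n ⟩
        n                ∎

    permutes⇔conditions :
      Permutes poly ⇔
      (Σ[ e#0 ∈ e₀ # 0# ] (γ ᵠ ≈ e₀ ^ (Q ℕ.∸ 1) * δ) × Tr k (divide n₀ e₀ e#0) ≈ 1#)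
    permutes⇔conditions = mk⇔ necessary sufficient
      where
      necessary : Permutes poly → Σ[ e#0 ∈ e₀ # 0# ] (γ ᵠ ≈ e₀ ^ (Q ℕ.∸ 1) * δ) × Tr k (divide n₀ e₀ e#0) ≈ 1#
      necessary permutes = e#0 , condition⇒ e≉0 condition , trace≈1
        where
        f-injective : Injective _≈_ _≈_ f
        f-injective = permutes⇒injective permutes
        e≉0 : ¬ e ≈ 0#
        e≉0 = f-injective⇒e≉0 f-injective
        e#0 : e₀ # 0#
        e#0 = invertible⇒#0 (trans (*-congʳ e₀≈e) (proj₂ (inverse e e≉0)))
        conditions = proj₁ (criterion e≉0 (quotient-n/e e#0)) f-injective
        condition = proj₁ conditions
        trace≈1 = proj₂ conditions

      sufficient : (Σ[ e#0 ∈ e₀ # 0# ] (γ ᵠ ≈ e₀ ^ (Q ℕ.∸ 1) * δ) × Tr k (divide n₀ e₀ e#0) ≈ 1#) → Permutes poly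
      sufficient (e#0 , condition , trace≈1) = injective⇒permutes
        (proj₂ (criterion (λ e≈0 → #0⇒≉0 e#0 (trans e₀≈e e≈0)) (quotient-n/e e#0)) (⇒condition condition , trace≈1))

corollary9p1 :
    ∀ {u v w} (F : HeytingField u v w) (k ℓ : ℕ) →
    let open HeytingField F
        open FieldNotions F
        q = 2 ℕ.^ k
        Q = 2 ℕ.^ ℓ
    in
    2 ∤ k → 2 ∤ ℓ →
    HasCardinality (q ℕ.^ 2) →
    (a b c d : Carrier) →
    let A = const a ⊗ X ↑ (Q ℕ.+ 1) ⊕ const b ⊗ X ↑ Q ⊕ const c ⊗ X ⊕ const d
        f = X ↑ (Q ℕ.+ 1) ⊗ A ⟨ X ↑ (q ℕ.∸ 1) ⟩
        e = a ^ (q ℕ.+ 1) + b ^ (q ℕ.+ 1) + c ^ (q ℕ.+ 1) + d ^ (q ℕ.+ 1)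
    in
    Permutes f
    ⇔
    (Σ[ e#0 ∈ e # 0# ]
      ((a ^ q * b + c ^ q * d) ^ Q ≈ e ^ (Q ℕ.∸ 1) * (a ^ q * c + b ^ q * d))
      × Tr k (divide (b ^ (q ℕ.+ 1) + c ^ (q ℕ.+ 1)) e e#0) ≈ 1#)
corollary9p1 F k ℓ 2∤k 2∤ℓ with 2∤⇒odd k 2∤k | 2∤⇒odd ℓ 2∤ℓ
... | i , ≡.refl | j , ≡.refl = permutes⇔conditions F i j
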